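{- For every fixed $C>0$ there exists $\delta_C>0$ depending only on $C$ such that, for every $a_0\in\{1,2,3,5,6\}$ and all sufficiently large $X$, $$\#\mathcal{E}_{C,a_0}(X)\geqslant\delta_C X.$$
   Context: For $C>0$, $a_0\in\{1,2,3,5,6\}$ and $X\geqslant 3$, $\mathcal{E}_{C,a_0}(X)$ denotes the set of integers $n$ with $X<n\leqslant 2X$ and $n\equiv a_0\pmod 8$ such that $n\neq x^2+y^2+z^2$ for all $x,y,z\in\mathbb{Z}$ with $|z|\leqslant C\sqrt{\log n}$. -}

module Defs where

open import Data.Empty using (⊥; ⊥-elim)
open import Data.Integer using (ℤ; +_; -[1+_]; ∣_∣; +≤+)
import Data.Integer as ℤ
import Data.Integer.Properties as ℤ
open import Data.List using (List; length)
open import Data.List.Relation.Unary.All using (All)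
open import Data.List.Relation.Unary.Unique.Propositional using (Unique)
open import Data.Nat using (ℕ; zero; suc; _∸_; _%_)
import Data.Nat as ℕ
import Data.Nat.Properties as ℕ
open import Data.Nat.Tactic.RingSolver using (solve-∀)
open import Data.Product using (Σ; ∃; _×_; _,_; proj₁; proj₂)
open import Data.Rational hiding (∣_∣)
open import Data.Rational.Properties
open import Data.Rational.Solver using (module +-*-Solver)
import Data.Rational.Unnormalised as ℚᵘ
import Data.Rational.Unnormalised.Properties as ℚᵘ
open import Data.Sum using (_⊎_; inj₁; inj₂)
open import Relation.Binary.Definitions using (tri<; tri≈; tri>)
open import Relation.Binary.PropositionalEquality
  using (_≡_; _≢_; refl; sym; trans; cong; cong₂; subst; subst₂)
open import Relation.Nullary using (yes; no)

-- Two-sided Dedekind cuts; locatedness excludes a gap between L and U.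
record ℝ : Set₁ where
  field
    L U       : ℚ → Set
    L-inh     : ∃ L
    U-inh     : ∃ U
    L-closed  : ∀ {p q} → p < q → L q → L p
    U-closed  : ∀ {p q} → p < q → U p → U q
    L-open    : ∀ {q} → L q → ∃ λ r → q < r × L r
    U-open    : ∀ {q} → U q → ∃ λ r → r < q × U r
    disjoint  : ∀ {q} → L q → U q → ⊥
    located   : ∀ {p q} → p < q → L p ⊎ U q

open ℝ

infix 4 _<ᴿ_ _≤ᴿ_

_<ᴿ_ : ℝ → ℝ → Set
x <ᴿ y = ∃ λ q → U x q × L y q

_≤ᴿ_ : ℝ → ℝ → Set
x ≤ᴿ y = ∀ q → L x q → L y q

fromℚ : ℚ → ℝ
fromℚ x = record
  { L        = λ q → q < x
  ; U        = λ q → x < q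
  ; L-inh    = x - 1ℚ , subst (x - 1ℚ <_) (+-identityʳ x) (+-monoʳ-< x (negative⁻¹ (- 1ℚ)))
  ; U-inh    = x + 1ℚ , subst (_< x + 1ℚ) (+-identityʳ x) (+-monoʳ-< x (positive⁻¹ 1ℚ))
  ; L-closed = <-trans
  ; U-closed = λ p<q x<p → <-trans x<p p<q
  ; L-open   = <-dense
  ; U-open   = λ x<q → let r , x<r , r<q = <-dense x<q in r , r<q , x<r
  ; disjoint = <-asym
  ; located  = loc
  }
  where
  loc : ∀ {p q} → p < q → p < x ⊎ x < q
  loc {p} p<q with p <? x
  ... | yes p<x = inj₁ p<x
  ... | no  p≮x = inj₂ (≤-<-trans (≮⇒≥ p≮x) p<q)

fromℕ : ℕ → ℝ
fromℕ n = fromℚ (+ n / 1)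

L-closed≤ : ∀ x {p q} → p ≤ q → L x q → L x p
L-closed≤ x {p} {q} p≤q Lq with <-cmp p q
... | tri< p<q _ _ = L-closed x p<q Lq
... | tri≈ _ p≡q _ = subst (L x) (sym p≡q) Lq
... | tri> _ _ q<p = ⊥-elim (<-irrefl refl (≤-<-trans p≤q q<p))

U-closed≤ : ∀ x {p q} → p ≤ q → U x p → U x q
U-closed≤ x {p} {q} p≤q Up with <-cmp p q
... | tri< p<q _ _ = U-closed x p<q Up
... | tri≈ _ p≡q _ = subst (U x) p≡q Up
... | tri> _ _ q<p = ⊥-elim (<-irrefl refl (≤-<-trans p≤q q<p))

L<U : ∀ x {p q} → L x p → U x q → p < q
L<U x {p} {q} Lp Uq with p <? q
... | yes p<q = p<q
... | no  p≮q = ⊥-elim (disjoint x Lp (U-closed≤ x (≮⇒≥ p≮q) Uq))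

L-⊔ : ∀ x {p q} → L x p → L x q → L x (p ⊔ q)
L-⊔ x {p} {q} Lp Lq with ≤-total p q
... | inj₁ p≤q = subst (L x) (sym (p≤q⇒p⊔q≡q p≤q)) Lq
... | inj₂ q≤p = subst (L x) (sym (p≥q⇒p⊔q≡p q≤p)) Lp

U-⊓ : ∀ x {p q} → U x p → U x q → U x (p ⊓ q)
U-⊓ x {p} {q} Up Uq with ≤-total p q
... | inj₁ p≤q = subst (U x) (sym (p≤q⇒p⊓q≡p p≤q)) Up
... | inj₂ q≤p = subst (U x) (sym (p≥q⇒p⊓q≡q q≤p)) Uq

open +-*-Solver

0≤-diff : ∀ {p q} → p ≤ q → 0ℚ ≤ q - p
0≤-diff {p} {q} p≤q = subst (_≤ q - p) (+-inverseʳ p) (+-monoˡ-≤ (- p) p≤q)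

0<-diff : ∀ {p q} → p < q → 0ℚ < q - p
0<-diff {p} {q} p<q = subst (_< q - p) (+-inverseʳ p) (+-monoˡ-< (- p) p<q)

≤-by : ∀ {p q} e → 0ℚ ≤ e → q ≡ p + e → p ≤ q
≤-by {p} e 0≤e refl = subst (_≤ p + e) (+-identityʳ p) (+-monoʳ-≤ p 0≤e)

<-by : ∀ {p q} e → 0ℚ < e → q ≡ p + e → p < q
<-by {p} e 0<e refl = subst (_< p + e) (+-identityʳ p) (+-monoʳ-< p 0<e)

0≤+ : ∀ {p q} → 0ℚ ≤ p → 0ℚ ≤ q → 0ℚ ≤ p + q
0≤+ = +-mono-≤

0≤* : ∀ {p q} → 0ℚ ≤ p → 0ℚ ≤ q → 0ℚ ≤ p * q
0≤* {p} {q} 0≤p 0≤q =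
  subst (_≤ p * q) (*-zeroʳ p) (*-monoˡ-≤-nonNeg p {{nonNegative 0≤p}} 0≤q)

0<* : ∀ {p q} → 0ℚ < p → 0ℚ < q → 0ℚ < p * q
0<* {p} {q} 0<p 0<q =
  subst (_< p * q) (*-zeroʳ p) (*-monoʳ-<-pos p {{positive 0<p}} 0<q)

sq-mono-< : ∀ {p q} → 0ℚ ≤ p → p < q → p * p < q * q
sq-mono-< {p} {q} 0≤p p<q =
  ≤-<-trans (*-monoˡ-≤-nonNeg p {{nonNegative 0≤p}} (<⇒≤ p<q))
            (*-monoˡ-<-pos q {{positive (≤-<-trans 0≤p p<q)}} p<q)

fromℕ-suc : ∀ k → + suc k / 1 ≡ 1ℚ + + k / 1
fromℕ-suc k = toℚᵘ-injective (ℚᵘ.≃-trans (toℚᵘ-fromℚᵘ (ℚᵘ.mkℚᵘ (+ suc k) 0))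
  (ℚᵘ.≃-sym (ℚᵘ.≃-trans (toℚᵘ-homo-+ 1ℚ (+ k / 1))
    (ℚᵘ.≃-trans (ℚᵘ.+-congʳ (toℚᵘ 1ℚ) (toℚᵘ-fromℚᵘ (ℚᵘ.mkℚᵘ (+ k) 0)))
      (ℚᵘ.*≡* (cong (λ t → (+ 1 ℤ.+ t) ℤ.* + 1) (ℤ.*-identityʳ (+ k))))))))

infixr 7 _·_

_·_ : ℕ → ℚ → ℚ
zero  · h = 0ℚ
suc k · h = h + k · h

·≡* : ∀ k h → k · h ≡ (+ k / 1) * h
·≡* zero    h = sym (*-zeroˡ h)
·≡* (suc k) h = trans (cong (λ t → h + t) (·≡* k h))
  (trans (solve 2 (λ h t → h :+ t :* h := (con 1ℚ :+ t) :* h) refl h (+ k / 1))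
         (cong (_* h) (sym (fromℕ-suc k))))

≤-fromℕ : ∀ q → q ≤ + ∣ ↥ q ∣ / 1
≤-fromℕ q@(mkℚ n d _) = toℚᵘ-cancel-≤ (ℚᵘ.≤-trans (ℚᵘ.*≤* (bound n))
  (ℚᵘ.≤-reflexive (ℚᵘ.≃-sym (toℚᵘ-fromℚᵘ (ℚᵘ.mkℚᵘ (+ ∣ n ∣) 0)))))
  where
  bound : ∀ n → n ℤ.* + 1 ℤ.≤ + ∣ n ∣ ℤ.* + suc d
  bound (+ k)    = subst₂ ℤ._≤_ (ℤ.pos-* k 1) (ℤ.pos-* k (suc d))
                     (+≤+ (ℕ.*-monoʳ-≤ k (ℕ.s≤s ℕ.z≤n)))
  bound -[1+ k ] = ℤ.-≤+

archimedean : ∀ q {h} → 0ℚ < h → ∃ λ k → q ≤ k · h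
archimedean q {h} 0<h = k , ≤-trans (≤-reflexive q≡) (≤-trans
    (*-monoʳ-≤-nonNeg h {{nonNegative (<⇒≤ 0<h)}} (≤-fromℕ (q * 1/ h)))
    (≤-reflexive (sym (·≡* k h))))
  where
  instance
    h≢0 : NonZero h
    h≢0 = >-nonZero 0<h
  k : ℕ
  k = ∣ ↥ (q * 1/ h) ∣
  q≡ : q ≡ q * 1/ h * h
  q≡ = sym (trans (*-assoc q (1/ h) h) (trans (cong (q *_) (*-inverseˡ h)) (*-identityʳ q)))

record Bracket (x : ℝ) (M w : ℚ) : Set where
  field
    lo hi  : ℚ
    L-lo   : L x lo
    U-hi   : U x hi
    -M≤lo  : - M ≤ lo
    hi≤M   : hi ≤ M
    width  : hi ≤ lo + w

bracket : ∀ x {M w} → L x (- M) → U x M → 0ℚ < w → Bracket x M w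
bracket x {M} {w} L-M UM 0<w =
  let k , M+M≤kh = archimedean (M + M) 0<h
  in walk k (- M) L-M ≤-refl
       (subst₂ _≤_ (solve 1 (λ M → :- M :+ (M :+ M) := M) refl M) refl (+-monoʳ-≤ (- M) M+M≤kh))
  where
  h : ℚ
  h = w * ½
  0<h : 0ℚ < h
  0<h = 0<* 0<w (positive⁻¹ ½)
  w≡ : ∀ a → a + h + h ≡ a + w
  w≡ a = solve 2 (λ a w → a :+ w :* con ½ :+ w :* con ½ := a :+ w) refl a w
  walk : ∀ k a → L x a → - M ≤ a → M ≤ a + k · h → Bracket x M w
  walk zero a La _ M≤a =
    ⊥-elim (disjoint x La (U-closed≤ x (subst (M ≤_) (+-identityʳ a) M≤a) UM))
  walk (suc k) a La -M≤a M≤ with located x {a + h} {a + h + h} (<-by h 0<h refl)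
  ... | inj₁ La+h = walk k (a + h) La+h (≤-trans -M≤a (≤-by h (<⇒≤ 0<h) refl))
                      (subst (M ≤_) (sym (+-assoc a h (k · h))) M≤)
  ... | inj₂ Ua+2h = record
    { lo    = a
    ; hi    = (a + h + h) ⊓ M
    ; L-lo  = La
    ; U-hi  = U-⊓ x Ua+2h UM
    ; -M≤lo = -M≤a
    ; hi≤M  = p⊓q≤q (a + h + h) M
    ; width = ≤-trans (p⊓q≤p (a + h + h) M) (≤-reflexive (w≡ a))
    }

bounded : ∀ x y → ∃ λ M → 0ℚ < M × L x (- M) × U x M × L y (- M) × U y M
bounded x y =
  M , <-≤-trans (positive⁻¹ 1ℚ) (p≤q⊔p m 1ℚ)
    , Lx , U-closed≤ x b≤M (proj₂ (U-inh x))
    , Ly , U-closed≤ y d≤M (proj₂ (U-inh y))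
  where
  a b c d m M : ℚ
  a = proj₁ (L-inh x)
  b = proj₁ (U-inh x)
  c = proj₁ (L-inh y)
  d = proj₁ (U-inh y)
  m = (- a ⊔ b) ⊔ (- c ⊔ d)
  M = m ⊔ 1ℚ
  m≤M : m ≤ M
  m≤M = p≤p⊔q m 1ℚ
  flip : ∀ {s} → - s ≤ M → - M ≤ s
  flip {s} -s≤M = subst (- M ≤_) (solve 1 (λ s → :- (:- s) := s) refl s) (neg-antimono-≤ -s≤M)
  Lx : L x (- M)
  Lx = L-closed≤ x (flip (≤-trans (≤-trans (p≤p⊔q (- a) b) (p≤p⊔q (- a ⊔ b) (- c ⊔ d))) m≤M))
         (proj₂ (L-inh x))
  Ly : L y (- M)
  Ly = L-closed≤ y (flip (≤-trans (≤-trans (p≤p⊔q (- c) d) (p≤q⊔p (- a ⊔ b) (- c ⊔ d))) m≤M))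
         (proj₂ (L-inh y))
  b≤M : b ≤ M
  b≤M = ≤-trans (≤-trans (p≤q⊔p (- a) b) (p≤p⊔q (- a ⊔ b) (- c ⊔ d))) m≤M
  d≤M : d ≤ M
  d≤M = ≤-trans (≤-trans (p≤q⊔p (- c) d) (p≤q⊔p (- a ⊔ b) (- c ⊔ d))) m≤M

-- Interval arithmetic: a product lies above (below) q as soon as all four
-- products of end points of some pair of enclosing intervals do.
record MulL (x y : ℝ) (q : ℚ) : Set where
  constructor mulL
  field
    {a b c d} : ℚ
    La : L x a
    Ub : U x b
    Lc : L y c
    Ud : U y d
    q<ac : q < a * c
    q<ad : q < a * d
    q<bc : q < b * c
    q<bd : q < b * d

record MulU (x y : ℝ) (q : ℚ) : Set where
  constructor mulU
  field
    {a b c d} : ℚ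
    La : L x a
    Ub : U x b
    Lc : L y c
    Ud : U y d
    ac<q : a * c < q
    ad<q : a * d < q
    bc<q : b * c < q
    bd<q : b * d < q

segment< : ∀ {q c d t} u → c ≤ t → t ≤ d → q < u * c → q < u * d → q < u * t
segment< u c≤t t≤d q<uc q<ud with ≤-total 0ℚ u
... | inj₁ 0≤u = <-≤-trans q<uc (*-monoˡ-≤-nonNeg u {{nonNegative 0≤u}} c≤t)
... | inj₂ u≤0 = <-≤-trans q<ud (*-monoˡ-≤-nonPos u {{nonPositive u≤0}} t≤d)

segment> : ∀ {q c d t} u → c ≤ t → t ≤ d → u * c < q → u * d < q → u * t < q
segment> u c≤t t≤d uc<q ud<q with ≤-total 0ℚ u
... | inj₁ 0≤u = ≤-<-trans (*-monoˡ-≤-nonNeg u {{nonNegative 0≤u}} t≤d) ud<q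
... | inj₂ u≤0 = ≤-<-trans (*-monoˡ-≤-nonPos u {{nonPositive u≤0}} c≤t) uc<q

box< : ∀ {q a b c d s t} → a ≤ s → s ≤ b → c ≤ t → t ≤ d →
       q < a * c → q < a * d → q < b * c → q < b * d → q < s * t
box< {q} {a} {b} {c} {d} {s} {t} a≤s s≤b c≤t t≤d ac ad bc bd =
  subst (q <_) (*-comm t s) (segment< t a≤s s≤b
    (subst (q <_) (*-comm a t) (segment< a c≤t t≤d ac ad))
    (subst (q <_) (*-comm b t) (segment< b c≤t t≤d bc bd)))

box> : ∀ {q a b c d s t} → a ≤ s → s ≤ b → c ≤ t → t ≤ d →
       a * c < q → a * d < q → b * c < q → b * d < q → s * t < q
box> {q} {a} {b} {c} {d} {s} {t} a≤s s≤b c≤t t≤d ac ad bc bd =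
  subst (_< q) (*-comm t s) (segment> t a≤s s≤b
    (subst (_< q) (*-comm a t) (segment> a c≤t t≤d ac ad))
    (subst (_< q) (*-comm b t) (segment> b c≤t t≤d bc bd)))

mul-disjoint : ∀ x y {q} → MulL x y q → MulU x y q → ⊥
mul-disjoint x y {q}
  (mulL {a}  {b}  {c}  {d}  La  Ub  Lc  Ud  ac  ad  bc  bd)
  (mulU {a′} {b′} {c′} {d′} La′ Ub′ Lc′ Ud′ ac′ ad′ bc′ bd′) =
  <-asym
    (box< (p≤p⊔q a a′) (s≤ Ub) (p≤p⊔q c c′) (t≤ Ud) ac ad bc bd)
    (box> (p≤q⊔p a a′) (s≤ Ub′) (p≤q⊔p c c′) (t≤ Ud′) ac′ ad′ bc′ bd′)
  where
  s≤ : ∀ {r} → U x r → a ⊔ a′ ≤ r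
  s≤ Ur = <⇒≤ (L<U x (L-⊔ x La La′) Ur)
  t≤ : ∀ {r} → U y r → c ⊔ c′ ≤ r
  t≤ Ur = <⇒≤ (L<U y (L-⊔ y Lc Lc′) Ur)

mul-L-open : ∀ x y {q} → MulL x y q → ∃ λ r → q < r × MulL x y r
mul-L-open x y {q} (mulL {a} {b} {c} {d} La Ub Lc Ud ac ad bc bd) =
  let r , q<r , r<m = <-dense q<m
  in r , q<r , mulL La Ub Lc Ud
       (<-≤-trans r<m (≤-trans (p⊓q≤p ((a * c) ⊓ (a * d)) ((b * c) ⊓ (b * d))) (p⊓q≤p (a * c) (a * d))))
       (<-≤-trans r<m (≤-trans (p⊓q≤p ((a * c) ⊓ (a * d)) ((b * c) ⊓ (b * d))) (p⊓q≤q (a * c) (a * d))))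
       (<-≤-trans r<m (≤-trans (p⊓q≤q ((a * c) ⊓ (a * d)) ((b * c) ⊓ (b * d))) (p⊓q≤p (b * c) (b * d))))
       (<-≤-trans r<m (≤-trans (p⊓q≤q ((a * c) ⊓ (a * d)) ((b * c) ⊓ (b * d))) (p⊓q≤q (b * c) (b * d))))
  where
  meet : ∀ u v → q < u → q < v → q < u ⊓ v
  meet u v q<u q<v with ≤-total u v
  ... | inj₁ u≤v = subst (q <_) (sym (p≤q⇒p⊓q≡p u≤v)) q<u
  ... | inj₂ v≤u = subst (q <_) (sym (p≥q⇒p⊓q≡q v≤u)) q<v
  q<m : q < ((a * c) ⊓ (a * d)) ⊓ ((b * c) ⊓ (b * d))
  q<m = meet ((a * c) ⊓ (a * d)) ((b * c) ⊓ (b * d)) (meet (a * c) (a * d) ac ad) (meet (b * c) (b * d) bc bd)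

mul-U-open : ∀ x y {q} → MulU x y q → ∃ λ r → r < q × MulU x y r
mul-U-open x y {q} (mulU {a} {b} {c} {d} La Ub Lc Ud ac ad bc bd) =
  let r , m<r , r<q = <-dense m<q
  in r , r<q , mulU La Ub Lc Ud
       (≤-<-trans (≤-trans (p≤p⊔q (a * c) (a * d)) (p≤p⊔q (a * c ⊔ a * d) (b * c ⊔ b * d))) m<r)
       (≤-<-trans (≤-trans (p≤q⊔p (a * c) (a * d)) (p≤p⊔q (a * c ⊔ a * d) (b * c ⊔ b * d))) m<r)
       (≤-<-trans (≤-trans (p≤p⊔q (b * c) (b * d)) (p≤q⊔p (a * c ⊔ a * d) (b * c ⊔ b * d))) m<r)
       (≤-<-trans (≤-trans (p≤q⊔p (b * c) (b * d)) (p≤q⊔p (a * c ⊔ a * d) (b * c ⊔ b * d))) m<r)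
  where
  join : ∀ u v → u < q → v < q → u ⊔ v < q
  join u v u<q v<q with ≤-total u v
  ... | inj₁ u≤v = subst (_< q) (sym (p≤q⇒p⊔q≡q u≤v)) v<q
  ... | inj₂ v≤u = subst (_< q) (sym (p≥q⇒p⊔q≡p v≤u)) u<q
  m<q : (a * c ⊔ a * d) ⊔ (b * c ⊔ b * d) < q
  m<q = join (a * c ⊔ a * d) (b * c ⊔ b * d) (join (a * c) (a * d) ac ad) (join (b * c) (b * d) bc bd)

near-L : ∀ {M u e w} → - M ≤ u → u ≤ M → 0ℚ ≤ e → e ≤ w → 0ℚ ≤ u * e + M * w
near-L {M} {u} {e} {w} -M≤u u≤M 0≤e e≤w =
  subst (0ℚ ≤_)
    (solve 4 (λ M u e w → (u :- :- M) :* e :+ M :* (w :- e) := u :* e :+ M :* w) refl M u e w)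
    (0≤+ (0≤* (0≤-diff -M≤u) 0≤e) (0≤* 0≤M (0≤-diff e≤w)))
  where
  0≤M : 0ℚ ≤ M
  0≤M = subst (0ℚ ≤_) (solve 1 (λ M → (M :- :- M) :* con ½ := M) refl M)
          (0≤* (0≤-diff (≤-trans -M≤u u≤M)) (nonNegative⁻¹ ½))

near-U : ∀ {M u e w} → - M ≤ u → u ≤ M → 0ℚ ≤ e → e ≤ w → 0ℚ ≤ M * w - u * e
near-U {M} {u} {e} {w} -M≤u u≤M 0≤e e≤w =
  subst (0ℚ ≤_)
    (solve 4 (λ M u e w → (:- u) :* e :+ M :* w := M :* w :- u :* e) refl M u e w)
    (near-L (neg-antimono-≤ u≤M)
      (subst (- u ≤_) (solve 1 (λ M → :- (:- M) := M) refl M) (neg-antimono-≤ -M≤u)) 0≤e e≤w)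

mul-located : ∀ x y {p r} → p < r → MulL x y p ⊎ MulU x y r
mul-located x y {p} {r} p<r = go (bounded x y)
  where
  go : (∃ λ M → 0ℚ < M × L x (- M) × U x M × L y (- M) × U y M) → MulL x y p ⊎ MulU x y r
  go (M , 0<M , LxM , UxM , LyM , UyM) = decide (p + η + η ≤? a * c)
    where
    instance
      M≢0 : NonZero M
      M≢0 = pos⇒nonZero M {{positive 0<M}}
    ⅛ w η : ℚ
    ⅛ = + 1 / 8
    w = (r - p) * ⅛ * 1/ M
    η = M * w + M * w
    0<w : 0ℚ < w
    0<w = 0<* (0<* (0<-diff p<r) (positive⁻¹ ⅛)) (positive⁻¹ (1/ M) {{1/pos⇒pos M {{positive 0<M}}}})
    0<Mw : 0ℚ < M * w
    0<Mw = 0<* 0<M 0<w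
    0<η : 0ℚ < η
    0<η = +-mono-< 0<Mw 0<Mw
    Mw≡ : M * w ≡ (r - p) * ⅛
    Mw≡ = trans (solve 3 (λ M v i → M :* (v :* i) := v :* (i :* M)) refl M ((r - p) * ⅛) (1/ M))
            (trans (cong ((r - p) * ⅛ *_) (*-inverseˡ M)) (*-identityʳ ((r - p) * ⅛)))
    r≡ : r ≡ p + η + η + η + η
    r≡ = trans
      (solve 2 (λ r p → let t = (r :- p) :* con ⅛ ; h = t :+ t in r := p :+ h :+ h :+ h :+ h) refl r p)
      (cong (λ t → p + (t + t) + (t + t) + (t + t) + (t + t)) (sym Mw≡))
    module X = Bracket (bracket x LxM UxM 0<w)
    module Y = Bracket (bracket y LyM UyM 0<w)
    a b c d : ℚ
    a = X.lo
    b = X.hi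
    c = Y.lo
    d = Y.hi
    a≤b : a ≤ b
    a≤b = <⇒≤ (L<U x X.L-lo X.U-hi)
    c≤d : c ≤ d
    c≤d = <⇒≤ (L<U y Y.L-lo Y.U-hi)
    e≤w : ∀ {s t} → t ≤ s + w → t - s ≤ w
    e≤w {s} {t} t≤ = subst (t - s ≤_) (solve 2 (λ s w → s :+ w :- s := w) refl s w) (+-monoˡ-≤ (- s) t≤)
    a≤M : a ≤ M
    a≤M = ≤-trans a≤b X.hi≤M
    -M≤d : - M ≤ d
    -M≤d = ≤-trans Y.-M≤lo c≤d
    c≤M : c ≤ M
    c≤M = ≤-trans c≤d Y.hi≤M
    adL : 0ℚ ≤ a * (d - c) + M * w
    adL = near-L X.-M≤lo a≤M (0≤-diff c≤d) (e≤w Y.width)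
    adU : 0ℚ ≤ M * w - a * (d - c)
    adU = near-U X.-M≤lo a≤M (0≤-diff c≤d) (e≤w Y.width)
    bcL : 0ℚ ≤ c * (b - a) + M * w
    bcL = near-L Y.-M≤lo c≤M (0≤-diff a≤b) (e≤w X.width)
    bcU : 0ℚ ≤ M * w - c * (b - a)
    bcU = near-U Y.-M≤lo c≤M (0≤-diff a≤b) (e≤w X.width)
    bdL : 0ℚ ≤ d * (b - a) + M * w
    bdL = near-L -M≤d Y.hi≤M (0≤-diff a≤b) (e≤w X.width)
    bdU : 0ℚ ≤ M * w - d * (b - a)
    bdU = near-U -M≤d Y.hi≤M (0≤-diff a≤b) (e≤w X.width)
    decide : _ → MulL x y p ⊎ MulU x y r
    decide (yes m≤ac) = inj₁ (mulL X.L-lo X.U-hi Y.L-lo Y.U-hi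
      (<-≤-trans p<p+η (≤-trans (≤-by η (<⇒≤ 0<η) refl) m≤ac))
      (<-≤-trans p<p+η (≤-by _ (0≤+ (0≤+ (0≤-diff m≤ac) adL) (<⇒≤ 0<Mw))
        (solve 6 (λ a c d M w p → let h = M :* w :+ M :* w in
           a :* d := p :+ h :+ (a :* c :- (p :+ h :+ h) :+ (a :* (d :- c) :+ M :* w) :+ M :* w))
           refl a c d M w p)))
      (<-≤-trans p<p+η (≤-by _ (0≤+ (0≤+ (0≤-diff m≤ac) bcL) (<⇒≤ 0<Mw))
        (solve 6 (λ a b c M w p → let h = M :* w :+ M :* w in
           b :* c := p :+ h :+ (a :* c :- (p :+ h :+ h) :+ (c :* (b :- a) :+ M :* w) :+ M :* w))
           refl a b c M w p)))
      (<-≤-trans p<p+η (≤-by _ (0≤+ (0≤+ (0≤-diff m≤ac) adL) bdL)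
        (solve 7 (λ a b c d M w p → let h = M :* w :+ M :* w in
           b :* d := p :+ h :+ (a :* c :- (p :+ h :+ h) :+ (a :* (d :- c) :+ M :* w)
                                 :+ (d :* (b :- a) :+ M :* w)))
           refl a b c d M w p))))
      where
      p<p+η : p < p + η
      p<p+η = <-by η 0<η refl
    decide (no m≰ac) = inj₂ (mulU X.L-lo X.U-hi Y.L-lo Y.U-hi
      (<-trans (≰⇒> m≰ac) (<-trans (<-by η 0<η refl) p+3η<r))
      (≤-<-trans (≤-by _ (0≤+ (0≤+ ac≤m adU) (<⇒≤ 0<Mw))
        (solve 6 (λ a c d M w p → let h = M :* w :+ M :* w in
           p :+ h :+ h :+ h := a :* d :+ (p :+ h :+ h :- a :* c :+ (M :* w :- a :* (d :- c)) :+ M :* w))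
           refl a c d M w p)) p+3η<r)
      (≤-<-trans (≤-by _ (0≤+ (0≤+ ac≤m bcU) (<⇒≤ 0<Mw))
        (solve 6 (λ a b c M w p → let h = M :* w :+ M :* w in
           p :+ h :+ h :+ h := b :* c :+ (p :+ h :+ h :- a :* c :+ (M :* w :- c :* (b :- a)) :+ M :* w))
           refl a b c M w p)) p+3η<r)
      (≤-<-trans (≤-by _ (0≤+ (0≤+ ac≤m adU) bdU)
        (solve 7 (λ a b c d M w p → let h = M :* w :+ M :* w in
           p :+ h :+ h :+ h := b :* d :+ (p :+ h :+ h :- a :* c :+ (M :* w :- a :* (d :- c))
                                           :+ (M :* w :- d :* (b :- a))))
           refl a b c d M w p)) p+3η<r))
      where
      ac≤m : 0ℚ ≤ p + η + η - a * c
      ac≤m = 0≤-diff (<⇒≤ (≰⇒> m≰ac))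
      p+3η<r : p + η + η + η < r
      p+3η<r = <-by η 0<η r≡

infixl 7 _*ᴿ_

_*ᴿ_ : ℝ → ℝ → ℝ
x *ᴿ y = record
  { L        = MulL x y
  ; U        = MulU x y
  ; L-inh    = L-inhabited
  ; U-inh    = U-inhabited
  ; L-closed = λ { p<q (mulL La Ub Lc Ud ac ad bc bd) → mulL La Ub Lc Ud
                     (<-trans p<q ac) (<-trans p<q ad) (<-trans p<q bc) (<-trans p<q bd) }
  ; U-closed = λ { p<q (mulU La Ub Lc Ud ac ad bc bd) → mulU La Ub Lc Ud
                     (<-trans ac p<q) (<-trans ad p<q) (<-trans bc p<q) (<-trans bd p<q) }
  ; L-open   = mul-L-open x y
  ; U-open   = mul-U-open x y
  ; disjoint = mul-disjoint x y
  ; located  = mul-located x y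
  }
  where
  a b c d m n : ℚ
  a = proj₁ (L-inh x)
  b = proj₁ (U-inh x)
  c = proj₁ (L-inh y)
  d = proj₁ (U-inh y)
  m = ((a * c) ⊓ (a * d)) ⊓ ((b * c) ⊓ (b * d))
  n = (a * c ⊔ a * d) ⊔ (b * c ⊔ b * d)
  below : m - 1ℚ < m
  below = subst (m - 1ℚ <_) (+-identityʳ m) (+-monoʳ-< m (negative⁻¹ (- 1ℚ)))
  above : n < n + 1ℚ
  above = <-by 1ℚ (positive⁻¹ 1ℚ) refl
  L-inhabited : ∃ (MulL x y)
  L-inhabited = m - 1ℚ , mulL (proj₂ (L-inh x)) (proj₂ (U-inh x)) (proj₂ (L-inh y)) (proj₂ (U-inh y))
    (<-≤-trans below (≤-trans (p⊓q≤p ((a * c) ⊓ (a * d)) ((b * c) ⊓ (b * d))) (p⊓q≤p (a * c) (a * d))))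
    (<-≤-trans below (≤-trans (p⊓q≤p ((a * c) ⊓ (a * d)) ((b * c) ⊓ (b * d))) (p⊓q≤q (a * c) (a * d))))
    (<-≤-trans below (≤-trans (p⊓q≤q ((a * c) ⊓ (a * d)) ((b * c) ⊓ (b * d))) (p⊓q≤p (b * c) (b * d))))
    (<-≤-trans below (≤-trans (p⊓q≤q ((a * c) ⊓ (a * d)) ((b * c) ⊓ (b * d))) (p⊓q≤q (b * c) (b * d))))
  U-inhabited : ∃ (MulU x y)
  U-inhabited = n + 1ℚ , mulU (proj₂ (L-inh x)) (proj₂ (U-inh x)) (proj₂ (L-inh y)) (proj₂ (U-inh y))
    (≤-<-trans (≤-trans (p≤p⊔q (a * c) (a * d)) (p≤p⊔q (a * c ⊔ a * d) (b * c ⊔ b * d))) above)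
    (≤-<-trans (≤-trans (p≤q⊔p (a * c) (a * d)) (p≤p⊔q (a * c ⊔ a * d) (b * c ⊔ b * d))) above)
    (≤-<-trans (≤-trans (p≤p⊔q (b * c) (b * d)) (p≤q⊔p (a * c ⊔ a * d) (b * c ⊔ b * d))) above)
    (≤-<-trans (≤-trans (p≤q⊔p (b * c) (b * d)) (p≤q⊔p (a * c ⊔ a * d) (b * c ⊔ b * d))) above)

-- For x < 0 this is 0.
√ : ℝ → ℝ
√ x = record
  { L        = Low
  ; U        = Upp
  ; L-inh    = - 1ℚ , - ½ , neg< , inj₁ (negative⁻¹ (- ½))
  ; U-inh    = upper (proj₁ (U-inh x)) (proj₂ (U-inh x))
  ; L-closed = λ { p<q (r , q<r , s) → r , <-trans p<q q<r , s }
  ; U-closed = λ { p<q (r , r<p , s) → r , <-trans r<p p<q , s }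
  ; L-open   = λ { (r , q<r , s) → let t , q<t , t<r = <-dense q<r in t , q<t , r , t<r , s }
  ; U-open   = λ { (r , r<q , s) → let t , r<t , t<q = <-dense r<q in t , t<q , r , r<t , s }
  ; disjoint = disj
  ; located  = loc
  }
  where
  Low Upp : ℚ → Set
  Low q = ∃ λ r → q < r × (r < 0ℚ ⊎ (0ℚ ≤ r × L x (r * r)))
  Upp q = ∃ λ r → r < q × (0ℚ ≤ r × U x (r * r))
  neg< : - 1ℚ < - ½
  neg< = *<* (ℤ.-<- (ℕ.s≤s ℕ.z≤n))
  upper : ∀ u → U x u → ∃ Upp
  upper u Uu = s + 1ℚ , s , <-by 1ℚ (positive⁻¹ 1ℚ) refl , 0≤s , U-closed≤ x u≤s² Uu
    where
    s : ℚ
    s = u ⊔ 1ℚ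
    1≤s : 1ℚ ≤ s
    1≤s = p≤q⊔p u 1ℚ
    0≤s : 0ℚ ≤ s
    0≤s = ≤-trans (nonNegative⁻¹ 1ℚ) 1≤s
    u≤s² : u ≤ s * s
    u≤s² = ≤-trans (p≤p⊔q u 1ℚ)
      (subst (_≤ s * s) (*-identityʳ s) (*-monoˡ-≤-nonNeg s {{nonNegative 0≤s}} 1≤s))
  disj : ∀ {q} → Low q → Upp q → ⊥
  disj (r , q<r , inj₁ r<0) (t , t<q , 0≤t , _) =
    <-irrefl refl (≤-<-trans 0≤t (<-trans t<q (<-trans q<r r<0)))
  disj (r , q<r , inj₂ (_ , Lr)) (t , t<q , 0≤t , Ut) =
    <-asym (L<U x Lr Ut) (sq-mono-< 0≤t (<-trans t<q q<r))
  loc : ∀ {p q} → p < q → Low p ⊎ Upp q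
  loc p<q with <-dense p<q
  ... | s , p<s , s<q with <-dense s<q
  ... | t , s<t , t<q with s <? 0ℚ
  ... | yes s<0 = inj₁ (s , p<s , inj₁ s<0)
  ... | no  s≮0 with located x (sq-mono-< (≮⇒≥ s≮0) s<t)
  ... | inj₁ Ls² = inj₁ (s , p<s , inj₂ (≮⇒≥ s≮0 , Ls²))
  ... | inj₂ Ut² = inj₂ (t , t<q , ≤-trans (≮⇒≥ s≮0) (<⇒≤ s<t) , Ut²)

-- recipSum a k = 1/(a+1) + 1/(a+2) + ⋯ + 1/(a+k)
recipSum : ℕ → ℕ → ℚ
recipSum a zero    = 0ℚ
recipSum a (suc k) = + 1 / suc a + recipSum (suc a) k

-- Riemann sums of ∫₁ⁿ dt/t for the partition of mesh 1/M, where M = m + 1: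
--   lowerSum = Σ_{M < j ≤ nM} 1/j,   upperSum = Σ_{M ≤ j < nM} 1/j.
lowerSum upperSum : ℕ → ℕ → ℚ
lowerSum n m = recipSum (suc m) ((n ∸ 1) ℕ.* suc m)
upperSum n m = recipSum m       ((n ∸ 1) ℕ.* suc m)

recip-pos : ∀ a → 0ℚ < + 1 / suc a
recip-pos a = positive⁻¹ (+ 1 / suc a) {{normalize-pos 1 (suc a)}}

recip-anti : ∀ {a b} → a ℕ.≤ b → + 1 / suc b ≤ + 1 / suc a
recip-anti {a} {b} a≤b = toℚᵘ-cancel-≤
  (ℚᵘ.≤-trans (ℚᵘ.≤-reflexive (toℚᵘ-fromℚᵘ (ℚᵘ.mkℚᵘ (+ 1) b)))
  (ℚᵘ.≤-trans (ℚᵘ.*≤* (ℤ.*-monoˡ-≤-nonNeg (+ 1) (+≤+ (ℕ.s≤s a≤b))))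
              (ℚᵘ.≤-reflexive (ℚᵘ.≃-sym (toℚᵘ-fromℚᵘ (ℚᵘ.mkℚᵘ (+ 1) a))))))

recip-split : ∀ k d → suc k · (+ 1 / suc (k ℕ.+ d ℕ.* suc k)) ≡ + 1 / suc d
recip-split k d = trans (·≡* (suc k) (+ 1 / suc (k ℕ.+ d ℕ.* suc k))) (toℚᵘ-injective
  (ℚᵘ.≃-trans (toℚᵘ-homo-* (+ suc k / 1) (+ 1 / suc (k ℕ.+ d ℕ.* suc k)))
  (ℚᵘ.≃-trans (ℚᵘ.*-cong (toℚᵘ-fromℚᵘ (ℚᵘ.mkℚᵘ (+ suc k) 0))
                         (toℚᵘ-fromℚᵘ (ℚᵘ.mkℚᵘ (+ 1) (k ℕ.+ d ℕ.* suc k))))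
  (ℚᵘ.≃-trans (ℚᵘ.*≡* (cong +_ (eq k d)))
              (ℚᵘ.≃-sym (toℚᵘ-fromℚᵘ (ℚᵘ.mkℚᵘ (+ 1) d)))))))
  where
  eq : ∀ k d → suc k ℕ.* 1 ℕ.* suc d ≡ 1 ℕ.* (1 ℕ.* suc (k ℕ.+ d ℕ.* suc k))
  eq = solve-∀

recipSum-+ : ∀ a k l → recipSum a (k ℕ.+ l) ≡ recipSum a k + recipSum (a ℕ.+ k) l
recipSum-+ a zero    l = trans (cong (λ t → recipSum t l) (sym (ℕ.+-identityʳ a)))
                               (sym (+-identityˡ (recipSum (a ℕ.+ 0) l)))
recipSum-+ a (suc k) l = trans (cong (λ t → + 1 / suc a + t) (recipSum-+ (suc a) k l))
  (trans (sym (+-assoc (+ 1 / suc a) (recipSum (suc a) k) (recipSum (suc a ℕ.+ k) l)))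
         (cong (λ t → recipSum a (suc k) + recipSum t l) (sym (ℕ.+-suc a k))))

recipSum-anti : ∀ a k → recipSum (suc a) k ≤ recipSum a k
recipSum-anti a zero    = ≤-refl
recipSum-anti a (suc k) = +-mono-≤ (recip-anti (ℕ.n≤1+n a)) (recipSum-anti (suc a) k)

recipSum-mono : ∀ a k → recipSum a k ≤ recipSum a (suc k)
recipSum-mono a zero    = ≤-trans (<⇒≤ (recip-pos a)) (≤-reflexive (sym (+-identityʳ (+ 1 / suc a))))
recipSum-mono a (suc k) = +-monoʳ-≤ (+ 1 / suc a) (recipSum-mono (suc a) k)

recipSum-≥ : ∀ a k b → a ℕ.+ k ℕ.≤ suc b → k · (+ 1 / suc b) ≤ recipSum a k
recipSum-≥ a zero    b _ = ≤-refl
recipSum-≥ a (suc k) b h =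
  +-mono-≤ (recip-anti (ℕ.≤-trans (ℕ.m≤m+n a k) (ℕ.≤-pred h′))) (recipSum-≥ (suc a) k b h′)
  where
  h′ : suc a ℕ.+ k ℕ.≤ suc b
  h′ = subst (ℕ._≤ suc b) (ℕ.+-suc a k) h

recipSum-≤ : ∀ a k → recipSum a k ≤ k · (+ 1 / suc a)
recipSum-≤ a zero    = ≤-refl
recipSum-≤ a (suc k) =
  +-monoʳ-≤ (+ 1 / suc a) (≤-trans (recipSum-anti a k) (recipSum-≤ a k))

refine-lower : ∀ k m K → recipSum m K ≤ recipSum (m ℕ.* suc k) (K ℕ.* suc k)
refine-lower k m zero    = ≤-refl
refine-lower k m (suc K) = ≤-trans
  (+-mono-≤
    (subst (_≤ recipSum (m ℕ.* suc k) (suc k)) (recip-split k m)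
      (recipSum-≥ (m ℕ.* suc k) (suc k) (k ℕ.+ m ℕ.* suc k)
        (ℕ.≤-reflexive (ℕ.+-comm (m ℕ.* suc k) (suc k)))))
    (≤-trans (refine-lower k (suc m) K)
      (≤-reflexive (cong (λ t → recipSum t (K ℕ.* suc k)) (ℕ.+-comm (suc k) (m ℕ.* suc k))))))
  (≤-reflexive (sym (recipSum-+ (m ℕ.* suc k) (suc k) (K ℕ.* suc k))))

refine-upper : ∀ k m K → recipSum (k ℕ.+ m ℕ.* suc k) (K ℕ.* suc k) ≤ recipSum m K
refine-upper k m zero    = ≤-refl
refine-upper k m (suc K) = ≤-trans
  (≤-reflexive (recipSum-+ (k ℕ.+ m ℕ.* suc k) (suc k) (K ℕ.* suc k)))
  (+-mono-≤
    (≤-trans (recipSum-≤ (k ℕ.+ m ℕ.* suc k) (suc k)) (≤-reflexive (recip-split k m)))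
    (≤-trans (≤-reflexive (cong (λ t → recipSum t (K ℕ.* suc k)) (eq k m)))
      (refine-upper k (suc m) K)))
  where
  eq : ∀ k m → k ℕ.+ m ℕ.* suc k ℕ.+ suc k ≡ k ℕ.+ suc m ℕ.* suc k
  eq = solve-∀

lower≤upper : ∀ n m k → lowerSum n m ≤ upperSum n k
lower≤upper n m k = ≤-trans (refine-lower k (suc m) (N ℕ.* suc m))
  (≤-trans (≤-reflexive (cong₂ recipSum (eq₁ k m) (eq₂ N k m)))
  (≤-trans (recipSum-anti (m ℕ.+ k ℕ.* suc m) (N ℕ.* suc k ℕ.* suc m))
           (refine-upper m k (N ℕ.* suc k))))
  where
  N : ℕ
  N = n ∸ 1
  eq₁ : ∀ k m → suc m ℕ.* suc k ≡ suc (m ℕ.+ k ℕ.* suc m)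
  eq₁ = solve-∀
  eq₂ : ∀ N k m → N ℕ.* suc m ℕ.* suc k ≡ N ℕ.* suc k ℕ.* suc m
  eq₂ = solve-∀

mesh : ∀ n m → upperSum n m ≤ + 1 / suc m + lowerSum n m
mesh n m = recipSum-mono m ((n ∸ 1) ℕ.* suc m)

small-recip : ∀ {ε} → 0ℚ < ε → ∃ λ m → + 1 / suc m ≤ ε
small-recip {mkℚ (+ zero) d _}  (*<* (ℤ.+<+ ()))
small-recip {mkℚ (+ suc n) d _} _ = d , toℚᵘ-cancel-≤
  (ℚᵘ.≤-trans (ℚᵘ.≤-reflexive (toℚᵘ-fromℚᵘ (ℚᵘ.mkℚᵘ (+ 1) d)))
    (ℚᵘ.*≤* (ℤ.*-monoʳ-≤-nonNeg (+ suc d) {+ 1} {+ suc n} (+≤+ (ℕ.s≤s ℕ.z≤n)))))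
small-recip {mkℚ -[1+ n ] d _} (*<* ())

-- log n = ∫₁ⁿ dt/t, as the cut between its lower and its upper Riemann sums.
-- For n = 0 this is 0.
log : ℕ → ℝ
log n = record
  { L        = λ q → ∃ λ m → q < lowerSum n m
  ; U        = λ q → ∃ λ m → upperSum n m < q
  ; L-inh    = lowerSum n 0 - 1ℚ , 0 ,
               subst (lowerSum n 0 - 1ℚ <_) (+-identityʳ (lowerSum n 0))
                 (+-monoʳ-< (lowerSum n 0) (negative⁻¹ (- 1ℚ)))
  ; U-inh    = upperSum n 0 + 1ℚ , 0 , <-by 1ℚ (positive⁻¹ 1ℚ) refl
  ; L-closed = λ { p<q (m , q<) → m , <-trans p<q q< }
  ; U-closed = λ { p<q (m , <p) → m , <-trans <p p<q }
  ; L-open   = λ { (m , q<) → let r , q<r , r< = <-dense q< in r , q<r , m , r< }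
  ; U-open   = λ { (m , <q) → let r , <r , r<q = <-dense <q in r , r<q , m , <r }
  ; disjoint = λ { (m , q<) (k , <q) →
                   <-irrefl refl (<-trans q< (≤-<-trans (lower≤upper n m k) <q)) }
  ; located  = loc
  }
  where
  loc : ∀ {p q} → p < q → (∃ λ m → p < lowerSum n m) ⊎ (∃ λ m → upperSum n m < q)
  loc {p} {q} p<q with <-dense p<q
  ... | s , p<s , s<q with small-recip (0<-diff s<q)
  ... | m , ε≤ with p <? lowerSum n m
  ... | yes p<l = inj₁ (m , p<l)
  ... | no  p≮l = inj₂ (m , ≤-<-trans (mesh n m) (≤-<-trans (+-monoʳ-≤ (+ 1 / suc m) (≮⇒≥ p≮l))
                    (<-≤-trans (+-monoʳ-< (+ 1 / suc m) p<s)
                      (≤-trans (+-monoˡ-≤ s ε≤)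
                        (≤-reflexive (solve 2 (λ q s → q :- s :+ s := q) refl q s))))))

-- Since X ≥ 3, the integers n > X are natural numbers.
𝓔 : (C : ℝ) (a₀ : ℕ) (X : ℝ) → ℕ → Set
𝓔 C a₀ X n =
  X <ᴿ fromℕ n × fromℕ n ≤ᴿ fromℕ 2 *ᴿ X × n % 8 ≡ a₀ ×
  (∀ (x y z : ℤ) → fromℕ ∣ z ∣ ≤ᴿ C *ᴿ √ (log n) →
   + n ≢ x ℤ.* x ℤ.+ y ℤ.* y ℤ.+ z ℤ.* z)

-- # P ≥ r for a finite set P of naturals: r is at most the length of some
-- list of distinct elements of P.  Membership in 𝓔 need not be decidable, so
-- # P is not available constructively as a numeral.
infix 4 #_≥_

#_≥_ : (ℕ → Set) → ℝ → Set
# P ≥ r = ∃ λ (ns : List ℕ) → Unique ns × All P ns × r ≤ᴿ fromℕ (length ns)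

{-# OPTIONS --safe #-}
module Submission where

-- For an odd squarefree M composed of primes 3 mod 4, weight n by the number of u mod M with n ≡ u² (mod M).  If n = m + z²
-- with m a sum of two squares, then m ≡ u² - z² = s (s + 2z) (mod M) for s = u - z; for given s this requires g = gcd(s, M)
-- to divide m, hence g² ∣ m, and leaves at most g classes of z mod M.  Summed over n ≤ x and |z| ≤ c √(log x), the weight of
-- the representable n is therefore ≪ √(log x) Σ_s g B(x / g²) / M, where B counts sums of two squares.  As
-- B(x) ≪ x / √(log x), this is ≪ (x / M) Σ_s 1/g = x ∏_{p ∣ M} (1 - 1/p + 1/p²), a small part of the total weight ≍ x once M
-- has enough prime factors, so that a positive proportion of the n in each class mod 8 is unrepresentable.
--
-- The analytic inputs come from S = Σ 1/a over squarefree a ≤ x with prime factors 1 mod 4 (or 2):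
-- * S² ≪ log x, because for such a the number of divisors is r = 1 ∗ χ, r is nonnegative everywhere and Σ_d χ(d)/d ≤ 1;
-- * B(x) log x ≪ x S: write the log of a as a sum over its prime factors and use Chebyshev's bound;
-- * log x ≪ Σ_{m ≤ x} 1/m ≪ S ∏_{p ≡ 3 (4), p ≤ x} (1 + 1/p), so that the product diverges.
-- Logarithms are replaced throughout by the bit length len.

open import Defs
open import Data.List using (_∷_; [])
open import Data.List.Membership.Propositional using (_∈_)
open import Data.Product using (∃; _×_)

-- Counting pairs (m, z) alone cannot work: their number is of order C √(log x) · x / √(log x),
-- which for large C exceeds the number of available n. The weight repairs this. For an odd prime p
-- the congruence u² - z² ≡ m (mod p) has 2p - 1 solutions (z, u) when p ∣ m and only p - 1
-- otherwise, while for p ≡ 3 (mod 4) a sum of two squares is divisible by p only if it is divisible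
-- by p². So on average the representable n have fewer square roots modulo p, and each such p saves
-- a factor 1 - 1/p + 1/p². As ∑ 1/p over these primes diverges, the saving can be made as large as
-- C demands, with M depending on C alone. An unrepresentable n has weight at most M, so the
-- resulting density is of order 1/M.
--
-- Any constant in B(x) ≪ x / √(log x) is absorbed in the same way, hence the crude bounds
-- throughout. An integer r with r² at most a bit length stands for √(log x), and several estimates
-- are compared only after squaring.

module Arithmetic where

  open import Data.Empty using (⊥; ⊥-elim)
  open import Data.List.Relation.Unary.All using (_∷_)
  open import Data.Nat
  open import Data.Nat.Combinatorics using (_C_; nCk≡n!/k![n-k]!; k![n∸k]!∣n!; nCk+nC[k+1]≡[n+1]C[k+1])
  open import Data.Nat.Coprimality using (Coprime; coprime-divisor; coprime-Bézout)
  import Data.Nat.Coprimality as Coprimality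
  open import Data.Nat.DivMod
  open import Data.Nat.Divisibility
  open import Data.Nat.GCD using (module Bézout)
  open import Data.Nat.Induction using (<-rec)
  open import Data.Nat.Primality
  open import Data.Nat.Primality.Factorisation using (PrimeFactorisation; factorise)
  open import Data.Nat.Properties
  open import Data.Nat.Tactic.RingSolver using (solve-∀)
  open import Data.Product using (_,_)
  open import Data.Sum using (_⊎_; inj₁; inj₂)
  open import Relation.Binary.PropositionalEquality
  open import Relation.Nullary using (Dec; yes; no; ¬_; contradiction)
  open import Relation.Nullary.Decidable using (_×-dec_; _→-dec_; ¬?; map′)

  -- Bit length

  len : ℕ → ℕ
  len zero    = 0
  len (suc n) with 2 ^ len n ≤? suc n
  ... | yes _ = suc (len n)
  ... | no  _ = len n

  n<2^len : ∀ n → n < 2 ^ len n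
  n<2^len zero    = s≤s z≤n
  n<2^len (suc n) with 2 ^ len n ≤? suc n
  ... | yes _ = ≤-trans (s≤s (n<2^len n)) (≤-trans (+-monoˡ-≤ (2 ^ len n) (m^n>0 2 (len n)))
                  (≤-reflexive (cong (2 ^ len n +_) (sym (+-identityʳ (2 ^ len n))))))
  ... | no  h = ≰⇒> h

  <len⇒2^≤ : ∀ n {i} → i < len n → 2 ^ i ≤ n
  <len⇒2^≤ (suc n) {i} i< with 2 ^ len n ≤? suc n
  <len⇒2^≤ (suc n) {i} i< | no _  = m≤n⇒m≤1+n (<len⇒2^≤ n i<)
  <len⇒2^≤ (suc n) {i} i< | yes h with m≤n⇒m<n∨m≡n (s≤s⁻¹ i<)
  ... | inj₁ i<len = m≤n⇒m≤1+n (<len⇒2^≤ n i<len)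
  ... | inj₂ refl  = h

  len-≤ : ∀ n ℓ → n < 2 ^ ℓ → len n ≤ ℓ
  len-≤ n ℓ n<2^ℓ = ≮⇒≥ λ ℓ<len → <-irrefl refl (<-≤-trans n<2^ℓ (<len⇒2^≤ n ℓ<len))

  len-mono : ∀ {m n} → m ≤ n → len m ≤ len n
  len-mono {m} {n} m≤n = len-≤ m (len n) (≤-<-trans m≤n (n<2^len n))

  len-* : ∀ m n → len (m * n) ≤ len m + len n
  len-* m n = len-≤ (m * n) (len m + len n)
    (subst (m * n <_) (sym (^-distribˡ-+-* 2 (len m) (len n))) (*-mono-< (n<2^len m) (n<2^len n)))

  2^≤⇒<len : ∀ n i → 2 ^ i ≤ n → i < len n
  2^≤⇒<len n i h = ≰⇒> λ len≤i → <-irrefl refl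
    (<-≤-trans (n<2^len n) (≤-trans (^-monoʳ-≤ 2 len≤i) h))

  len-≤-self : ∀ n → len n ≤ n
  len-≤-self n = len-≤ n n (n<2^n n)
    where
    n<2^n : ∀ n → n < 2 ^ n
    n<2^n zero    = s≤s z≤n
    n<2^n (suc n) = ≤-trans (s≤s (n<2^n n)) (+-mono-≤ (m^n>0 2 n) (≤-reflexive (sym (+-identityʳ (2 ^ n)))))

  -- Primes and residues modulo 4

  prime⇒>1 : ∀ {p} → Prime p → 1 < p
  prime⇒>1 {p} pp = nonTrivial⇒n>1 p {{prime⇒nonTrivial pp}}

  prime⇒>0 : ∀ {p} → Prime p → 0 < p
  prime⇒>0 pp = <⇒≤ (prime⇒>1 pp)

  prime-divisor : ∀ n → 1 < n → ∃ λ p → Prime p × p ∣ n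
  prime-divisor n 1<n = go (factorise n {{>-nonZero (<⇒≤ 1<n)}})
    where
    go : PrimeFactorisation n → ∃ λ p → Prime p × p ∣ n
    go record { factors = [] ; isFactorisation = n≡ } =
      contradiction (sym n≡) (<⇒≢ 1<n)
    go record { factors = p ∷ ps ; isFactorisation = n≡ ; factorsPrime = pp ∷ _ } =
      p , pp , subst (p ∣_) (sym n≡) (m∣m*n _)

  prime∣prime : ∀ {p q} → Prime p → Prime q → p ∣ q → p ≡ q
  prime∣prime pp pq p∣q with prime⇒irreducible pq p∣q
  ... | inj₁ refl = contradiction (prime⇒>1 pp) (<-irrefl refl)
  ... | inj₂ p≡q  = p≡q

  prime∤⇒coprime : ∀ {p n} → Prime p → ¬ p ∣ n → Coprime p n
  prime∤⇒coprime pp p∤n (d∣p , d∣n) with prime⇒irreducible pp d∣p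
  ... | inj₁ d≡1  = d≡1
  ... | inj₂ refl = contradiction d∣n p∤n

  even-or-odd : ∀ n → ∃ λ h → n ≡ 2 * h ⊎ n ≡ suc (2 * h)
  even-or-odd zero = 0 , inj₁ refl
  even-or-odd (suc n) with even-or-odd n
  ... | h , inj₁ refl = h , inj₂ refl
  ... | h , inj₂ refl = suc h , inj₁ (cong suc (sym (+-suc h (h + 0))))

  %4-cases : ∀ n → n % 4 ≡ 0 ⊎ n % 4 ≡ 1 ⊎ n % 4 ≡ 2 ⊎ n % 4 ≡ 3
  %4-cases n with n % 4 | m%n<n n 4
  ... | 0 | _ = inj₁ refl
  ... | 1 | _ = inj₂ (inj₁ refl)
  ... | 2 | _ = inj₂ (inj₂ (inj₁ refl))
  ... | 3 | _ = inj₂ (inj₂ (inj₂ refl))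
  ... | suc (suc (suc (suc _))) | s≤s (s≤s (s≤s (s≤s ())))

  -- Descent: if n ∣ y² + 1 with y < n even, then the cofactor of n is again 3 mod 4 and is less than n.
  3mod4∤sq+1 : ∀ n → n % 4 ≡ 3 → ∀ x → ¬ n ∣ x * x + 1
  3mod4∤sq+1 = <-rec _ step
    where
    step : ∀ n → (∀ {k} → k < n → k % 4 ≡ 3 → ∀ x → ¬ k ∣ x * x + 1) →
           n % 4 ≡ 3 → ∀ x → ¬ n ∣ x * x + 1
    step n@(suc n-1) rec n≡3 x n∣ = even (reduce (x % n) (m%n<n x n) (∣m+n∣m⇒∣n
        (subst (n ∣_) (trans (cong (λ t → t * t + 1) (m≡m%n+[m/n]*n x n)) (split (x % n) (x / n) n)) n∣)
        (n∣m*n (2 * (x % n) * (x / n) + (x / n) * (x / n) * n))))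
      where
      split : ∀ r q n → (r + q * n) * (r + q * n) + 1 ≡ (2 * r * q + q * q * n) * n + (r * r + 1)
      split = solve-∀
      n≡ : n ≡ 3 + n / 4 * 4
      n≡ = trans (m≡m%n+[m/n]*n n 4) (cong (_+ n / 4 * 4) n≡3)
      n-odd : ∀ h → n ≢ 2 * h
      n-odd h n≡2h = even≢odd h (suc (n / 4 * 2))
        (trans (sym n≡2h) (trans n≡ (odd-form (n / 4))))
        where
        odd-form : ∀ c → 3 + c * 4 ≡ suc (2 * suc (c * 2))
        odd-form = solve-∀
      -- An odd y is replaced by n - y, which is even because n is odd and has the same square
      -- modulo n. Evenness makes y² + 1 congruent to 1 modulo 4.
      reduce : ∀ y → y < n → n ∣ y * y + 1 → ∃ λ h → 2 * h < n × n ∣ 2 * h * (2 * h) + 1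
      reduce y y<n n∣y with even-or-odd y
      ... | h , inj₁ refl = h , y<n , n∣y
      ... | h , inj₂ refl with even-or-odd (n ∸ suc (2 * h))
      ... | h′ , inj₂ eq′ = contradiction
              (trans (sym (m+[n∸m]≡n (<⇒≤ y<n))) (trans (cong (suc (2 * h) +_) eq′) (form h h′))) (n-odd (suc (h + h′)))
        where
        form : ∀ h h′ → suc (2 * h) + suc (2 * h′) ≡ 2 * suc (h + h′)
        form = solve-∀
      ... | h′ , inj₁ eq′ = h′ , subst (_< n) eq′ z<n , subst (λ t → n ∣ t * t + 1) eq′
              (∣m+n∣m⇒∣n (subst (n ∣_) (trans (cong (λ t → t * t + (y * y + 1)) (sym sum≡n)) (sym eq″))
                 (∣m∣n⇒∣m+n (m∣m*n n) n∣y)) (n∣m*n (2 * y)))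
        where
        z : ℕ
        z = n ∸ y
        sum≡n : y + z ≡ n
        sum≡n = m+[n∸m]≡n (<⇒≤ y<n)
        z<n : z < n
        z<n = subst (z <_) sum≡n (m<n+m z (s≤s z≤n))
        form : ∀ y z → 2 * y * (y + z) + (z * z + 1) ≡ (y + z) * (y + z) + (y * y + 1)
        form = solve-∀
        eq″ : 2 * y * n + (z * z + 1) ≡ (y + z) * (y + z) + (y * y + 1)
        eq″ = trans (cong (λ t → 2 * y * t + (z * z + 1)) (sym sum≡n)) (form y z)
      even : (∃ λ h → 2 * h < n × n ∣ 2 * h * (2 * h) + 1) → ⊥
      even (h , y<n , divides k eq) = rec k<n k≡3 (2 * h) (divides n (trans eq (*-comm k n)))
        where
        kn≡1 : (k * n) % 4 ≡ 1
        kn≡1 = trans (cong (_% 4) (trans (sym eq) (form h))) ([m+kn]%n≡m%n 1 (h * h) 4)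
          where
          form : ∀ h → 2 * h * (2 * h) + 1 ≡ 1 + h * h * 4
          form = solve-∀
        k*3≡1 : (k % 4 * 3) % 4 ≡ 1
        k*3≡1 = trans (cong (λ t → (k % 4 * t) % 4) (sym n≡3)) (trans (sym (%-distribˡ-* k n 4)) kn≡1)
        k≡3 : k % 4 ≡ 3
        k≡3 with k % 4 | m%n<n k 4 | k*3≡1
        ... | 3 | _ | _ = refl
        ... | suc (suc (suc (suc _))) | s≤s (s≤s (s≤s (s≤s ()))) | _
        -- From y ≤ n - 1: k n = y² + 1 ≤ (n - 1)² + 1 < n².
        k<n : k < n
        k<n = *-cancelʳ-< n k n (subst (_< n * n) eq (≤-trans (s≤s (+-monoˡ-≤ 1 (*-mono-≤ (s≤s⁻¹ y<n) (s≤s⁻¹ y<n))))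
                (subst (_≤ n * n) (form₁ n-1) (≤-trans (+-monoʳ-≤ (n-1 * n-1) (+-monoʳ-≤ 1 n-1≥1)) (≤-reflexive (form₂ n-1))))))
          where
          nontrivial : ∀ m → suc m % 4 ≡ 3 → 1 ≤ m + m
          nontrivial (suc m) _ = s≤s z≤n
          n-1≥1 : 1 ≤ n-1 + n-1
          n-1≥1 = nontrivial n-1 n≡3
          form₁ : ∀ a → a * a + (1 + 1) ≡ suc (a * a + 1)
          form₁ = solve-∀
          form₂ : ∀ a → a * a + (1 + (a + a)) ≡ suc a * suc a
          form₂ = solve-∀

  -- If q ∤ y, let w invert y modulo q up to sign; multiplying by w² gives q ∣ (w x)² + 1, which
  -- `3mod4∤sq+1` excludes. The two forms of Bézout's identity are w y ≡ 1 and w y ≡ -1, and the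
  -- sign disappears on squaring.
  prime-3mod4-∣-sum : ∀ {q} → Prime q → q % 4 ≡ 3 → ∀ x y → q ∣ x * x + y * y → q ∣ y
  prime-3mod4-∣-sum {q} pq q≡3 x y q∣ with q ∣? y
  ... | yes q∣y = q∣y
  ... | no  q∤y = ⊥-elim (inverse (coprime-Bézout (prime∤⇒coprime pq q∤y)))
    where
    scaled : ∀ w → w * w * (x * x + y * y) ≡ w * x * (w * x) + w * y * (w * y)
    scaled w = form w x y
      where
      form : ∀ w x y → w * w * (x * x + y * y) ≡ w * x * (w * x) + w * y * (w * y)
      form = solve-∀
    inverse : Bézout.Identity 1 q y → ⊥
    inverse (Bézout.-+ a w eq) = 3mod4∤sq+1 q q≡3 (w * x) (∣m+n∣m⇒∣n
      (subst (q ∣_) (trans (scaled w) (trans (cong (λ t → w * x * (w * x) + t * t) (sym eq)) (form (w * x) a q)))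
         (∣n⇒∣m*n (w * w) q∣))
      (n∣m*n (2 * a + a * a * q)))
      where
      form : ∀ v a q → v * v + (1 + a * q) * (1 + a * q) ≡ (2 * a + a * a * q) * q + (v * v + 1)
      form = solve-∀
    inverse (Bézout.+- a w eq) = 3mod4∤sq+1 q q≡3 (w * x) (∣m+n∣m⇒∣n
      (subst (q ∣_) (trans (cong₂ _+_ (scaled w) (cong (2 *_) (sym eq))) (trans (form (w * x) (w * y))
          (cong (λ t → t * t + (w * x * (w * x) + 1)) eq)))
         (∣m∣n⇒∣m+n (∣n⇒∣m*n (w * w) q∣) (∣n⇒∣m*n 2 (n∣m*n a))))
      (∣n⇒∣m*n (a * q) (n∣m*n a)))
      where
      form : ∀ v u → v * v + u * u + 2 * (1 + u) ≡ (1 + u) * (1 + u) + (v * v + 1)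
      form = solve-∀

  -- Sums of two squares

  record SF (T : ℕ → Set) (n : ℕ) : Set where
    field
      squarefree : ∀ d → d * d ∣ n → d ≡ 1
      primes     : ∀ p → Prime p → p ∣ n → T p

  open SF public

  SF⇒>0 : ∀ {T n} → SF T n → 0 < n
  SF⇒>0 {n = zero}  sf = contradiction (squarefree sf 2 (4 ∣0)) λ ()
  SF⇒>0 {n = suc n} sf = s≤s z≤n

  SF? : ∀ {T} → (∀ p → Dec (T p)) → ∀ n → Dec (SF T n)
  SF? T? zero = no λ sf → <-irrefl refl (SF⇒>0 sf)
  SF? {T} T? n@(suc _) = map′ to from
    (allUpTo? (λ d → (d * d ∣? n) →-dec (d ≟ 1)) (suc n) ×-dec
     allUpTo? (λ p → prime? p →-dec ((p ∣? n) →-dec T? p)) (suc n))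
    where
    to : (∀ {d} → d < suc n → d * d ∣ n → d ≡ 1) × (∀ {p} → p < suc n → Prime p → p ∣ n → T p) → SF T n
    to (h₁ , h₂) = record
      { squarefree = λ d dd∣ → h₁ (s≤s (∣⇒≤ (∣-trans (m∣m*n d) dd∣))) dd∣
      ; primes     = λ p pp p∣ → h₂ (s≤s (∣⇒≤ p∣)) pp p∣ }
    from : SF T n → (∀ {d} → d < suc n → d * d ∣ n → d ≡ 1) × (∀ {p} → p < suc n → Prime p → p ∣ n → T p)
    from sf = (λ _ → squarefree sf _) , (λ _ → primes sf _)

  SF-1 : ∀ {T} → SF T 1
  SF-1 = record
    { squarefree = λ d dd∣1 → ∣1⇒≡1 (∣-trans (m∣m*n d) dd∣1)
    ; primes     = λ p pp p∣1 → contradiction (∣1⇒≡1 p∣1) (λ p≡1 → <⇒≢ (prime⇒>1 pp) (sym p≡1)) }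

  SF-∣ : ∀ {T d n} → d ∣ n → SF T n → SF T d
  SF-∣ d∣n sf = record
    { squarefree = λ e h → squarefree sf e (∣-trans h d∣n)
    ; primes     = λ p pp h → primes sf p pp (∣-trans h d∣n) }

  SF-⊆ : ∀ {T T′ n} → (∀ {p} → Prime p → p ∣ n → T p → T′ p) → SF T n → SF T′ n
  SF-⊆ f sf = record { squarefree = squarefree sf ; primes = λ p pp h → f pp h (primes sf p pp h) }

  SF-cons : ∀ {T p n} → Prime p → T p → ¬ p ∣ n → SF T n → SF T (p * n)
  SF-cons {T} {p} {n} pp Tp p∤n sf = record { squarefree = sqf ; primes = prs }
    where
    sqf : ∀ d → d * d ∣ p * n → d ≡ 1
    sqf d dd∣ with p ∣? d
    ... | yes p∣d = contradiction
            (*-cancelˡ-∣ p {{>-nonZero (prime⇒>0 pp)}} (∣-trans (*-pres-∣ p∣d p∣d) dd∣)) p∤n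
    ... | no  p∤d = squarefree sf d (coprime-divisor (Coprimality.sym (prime∤⇒coprime pp p∤dd)) dd∣)
      where
      p∤dd : ¬ p ∣ d * d
      p∤dd h with euclidsLemma d d pp h
      ... | inj₁ h = p∤d h
      ... | inj₂ h = p∤d h
    prs : ∀ r → Prime r → r ∣ p * n → T r
    prs r pr r∣ with euclidsLemma p n pr r∣
    ... | inj₁ r∣p = subst T (sym (prime∣prime pr pp r∣p)) Tp
    ... | inj₂ r∣n = primes sf r pr r∣n

  SF-uncons : ∀ {T p n} → Prime p → SF T (p * n) → ¬ p ∣ n
  SF-uncons {p = p} pp sf p∣n = contradiction (squarefree sf p (*-monoʳ-∣ p p∣n))
    (λ p≡1 → <⇒≢ (prime⇒>1 pp) (sym p≡1))

  -- Primes are multiplied in one at a time: a prime not yet present joins a or b according to T,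
  -- and a prime already present leaves it again and enters d, because it now occurs squared.
  squarefree-split : ∀ {T : ℕ → Set} → (∀ p → Dec (T p)) → ∀ n → 0 < n →
    ∃ λ d → ∃ λ a → ∃ λ b → n ≡ d * d * (a * b) × SF T a × SF (λ p → ¬ T p) b
  squarefree-split {T} T? = <-rec _ step
    where
    Split : ℕ → Set
    Split n = ∃ λ d → ∃ λ a → ∃ λ b → n ≡ d * d * (a * b) × SF T a × SF (λ p → ¬ T p) b
    extend : ∀ p n → Prime p → Split n → Split (p * n)
    extend p n pp (d , a , b , refl , sa , sb) with T? p
    ... | yes Tp with p ∣? a
    ...   | no  p∤a = d , p * a , b , form p d a b , SF-cons pp Tp p∤a sa , sb
      where
      form : ∀ p d a b → p * (d * d * (a * b)) ≡ d * d * (p * a * b)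
      form = solve-∀
    ...   | yes (divides a′ refl) = p * d , a′ , b , form p d a′ b , SF-∣ (m∣m*n p) sa , sb
      where
      form : ∀ p d a b → p * (d * d * (a * p * b)) ≡ p * d * (p * d) * (a * b)
      form = solve-∀
    extend p n pp (d , a , b , refl , sa , sb) | no ¬Tp with p ∣? b
    ...   | no  p∤b = d , a , p * b , form p d a b , sa , SF-cons pp ¬Tp p∤b sb
      where
      form : ∀ p d a b → p * (d * d * (a * b)) ≡ d * d * (a * (p * b))
      form = solve-∀
    ...   | yes (divides b′ refl) = p * d , a , b′ , form p d a b′ , sa , SF-∣ (m∣m*n p) sb
      where
      form : ∀ p d a b → p * (d * d * (a * (b * p))) ≡ p * d * (p * d) * (a * b)
      form = solve-∀
    step : ∀ n → (∀ {k} → k < n → 0 < k → Split k) → 0 < n → Split n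
    step 1 rec _ = 1 , 1 , 1 , refl , SF-1 , SF-1
    step n@(suc (suc _)) rec _ with prime-divisor n (s≤s (s≤s z≤n))
    ... | p , pp , divides k eq = subst Split (sym (trans eq (*-comm k p)))
            (extend p k pp (rec (quotient-< {p} {n} (divides k eq) {{prime⇒nonTrivial pp}}) (k>0 k eq)))
      where
      k>0 : ∀ k → n ≡ k * p → 0 < k
      k>0 (suc k) _ = s≤s z≤n

  IsSumOfTwoSquares : ℕ → Set
  IsSumOfTwoSquares m = ∃ λ x → ∃ λ y → m ≡ x * x + y * y

  prime-3mod4-descent : ∀ {q m} → Prime q → q % 4 ≡ 3 → q ∣ m → IsSumOfTwoSquares m →
    ∃ λ m′ → m ≡ q * q * m′ × IsSumOfTwoSquares m′
  prime-3mod4-descent {q} pq q≡3 q∣m (x , y , refl)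
    with prime-3mod4-∣-sum pq q≡3 x y q∣m
       | prime-3mod4-∣-sum pq q≡3 y x (subst (q ∣_) (+-comm (x * x) (y * y)) q∣m)
  ... | divides y′ refl | divides x′ refl = x′ * x′ + y′ * y′ , form x′ y′ q , x′ , y′ , refl
    where
    form : ∀ x y q → x * q * (x * q) + y * q * (y * q) ≡ q * q * (x * x + y * y)
    form = solve-∀

  -- A prime factor 3 mod 4 comes off together with its square and leaves a smaller sum of two
  -- squares. Once no such prime is left, the b of `squarefree-split` has no prime factor at all and
  -- equals 1.
  sumOfTwoSquares-shape : ∀ m → 0 < m → IsSumOfTwoSquares m →
    ∃ λ d → ∃ λ a → m ≡ d * d * a × SF (λ p → p % 4 ≢ 3) a
  sumOfTwoSquares-shape = <-rec _ step
    where
    Shape : ℕ → Set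
    Shape m = ∃ λ d → ∃ λ a → m ≡ d * d * a × SF (λ p → p % 4 ≢ 3) a
    step : ∀ m → (∀ {k} → k < m → 0 < k → IsSumOfTwoSquares k → Shape k) →
           0 < m → IsSumOfTwoSquares m → Shape m
    step m rec 0<m s with anyUpTo? (λ q → prime? q ×-dec (q % 4 ≟ 3) ×-dec (q ∣? m)) (suc m)
    ... | yes (q , _ , pq , q≡3 , q∣m) = descend (prime-3mod4-descent pq q≡3 q∣m s)
      where
      descend : (∃ λ m′ → m ≡ q * q * m′ × IsSumOfTwoSquares m′) → Shape m
      descend (zero , eq , _) = contradiction (trans eq (*-zeroʳ (q * q))) (λ m≡0 → <⇒≢ 0<m (sym m≡0))
      descend (m′@(suc _) , eq , s′) with rec m′<m (s≤s z≤n) s′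
        where
        m′<m : m′ < m
        m′<m = subst (m′ <_) (trans (*-comm m′ (q * q)) (sym eq))
                 (m<m*n m′ (q * q) (*-mono-< (prime⇒>1 pq) (prime⇒>1 pq)))
      ... | d , a , eq′ , sa = q * d , a , trans eq (trans (cong (q * q *_) eq′) (form q d a)) , sa
        where
        form : ∀ q d a → q * q * (d * d * a) ≡ q * d * (q * d) * a
        form = solve-∀
    ... | no none with squarefree-split (λ p → ¬? (p % 4 ≟ 3)) m 0<m
    ...   | d , a , b , eq , sa , sb with b ≟ 1
    ...     | yes refl = d , a , trans eq (cong (d * d *_) (*-identityʳ a)) , sa
    ...     | no  b≢1 with prime-divisor b (≤∧≢⇒< (SF⇒>0 sb) (λ 1≡b → b≢1 (sym 1≡b)))
    ...       | p , pp , p∣b with p % 4 ≟ 3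
    ...         | yes p≡3 = contradiction (p , s≤s (∣⇒≤ {{>-nonZero 0<m}} p∣m) , pp , p≡3 , p∣m) none
      where
      p∣m : p ∣ m
      p∣m = subst (p ∣_) (sym eq) (∣n⇒∣m*n (d * d) (∣n⇒∣m*n a p∣b))
    ...         | no  p≢3 = contradiction p≢3 (primes sb p pp p∣b)

  -- Chebyshev's upper bound

  primeLen : ℕ → ℕ
  primeLen p with prime? p
  ... | yes _ = len p
  ... | no  _ = 0

  primeFactor : ℕ → ℕ
  primeFactor p with prime? p
  ... | yes _ = p
  ... | no  _ = 1

  -- Chebyshev's function over the primes below n, with bit lengths for logarithms.
  θ : ℕ → ℕ
  θ zero    = 0
  θ (suc n) = θ n + primeLen n

  θ-from : ℕ → ℕ → ℕ
  θ-from n zero    = 0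
  θ-from n (suc k) = θ-from n k + primeLen (suc (n + k))

  primorial-from : ℕ → ℕ → ℕ
  primorial-from n zero    = 1
  primorial-from n (suc k) = primorial-from n k * primeFactor (suc (n + k))

  θ-+ : ∀ n k → θ (suc (n + k)) ≡ θ (suc n) + θ-from n k
  θ-+ n zero    = trans (cong (λ t → θ (suc t)) (+-identityʳ n)) (sym (+-identityʳ (θ (suc n))))
  θ-+ n (suc k) = trans (cong (λ t → θ (suc t)) (+-suc n k))
    (trans (cong (_+ primeLen (suc (n + k))) (θ-+ n k)) (+-assoc (θ (suc n)) (θ-from n k) _))

  -- For a prime, 2^(len p) ≤ 2p ≤ p². The square is the price of rounding log p up to a bit length;
  -- it doubles the exponent 2n of the bound on the central binomial coefficient to the 4n of
  -- `θ-dyadic`.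
  2^primeLen≤ : ∀ p → 2 ^ primeLen p ≤ primeFactor p * primeFactor p
  2^primeLen≤ p with prime? p
  ... | no  _  = s≤s z≤n
  ... | yes pp with len p in eq
  ...   | zero  = *-mono-≤ (prime⇒>0 pp) (prime⇒>0 pp)
  ...   | suc ℓ = *-mono-≤ (prime⇒>1 pp) (<len⇒2^≤ p (≤-reflexive (sym eq)))

  2^θ-from≤ : ∀ n k → 2 ^ θ-from n k ≤ primorial-from n k * primorial-from n k
  2^θ-from≤ n zero    = s≤s z≤n
  2^θ-from≤ n (suc k) = begin
    2 ^ (θ-from n k + primeLen p)                ≡⟨ ^-distribˡ-+-* 2 (θ-from n k) (primeLen p) ⟩
    2 ^ θ-from n k * 2 ^ primeLen p              ≤⟨ *-mono-≤ (2^θ-from≤ n k) (2^primeLen≤ p) ⟩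
    P * P * (primeFactor p * primeFactor p)      ≡⟨ form P (primeFactor p) ⟩
    P * primeFactor p * (P * primeFactor p)      ∎
    where
    open ≤-Reasoning
    p P : ℕ
    p = suc (n + k)
    P = primorial-from n k
    form : ∀ a b → a * a * (b * b) ≡ a * b * (a * b)
    form = solve-∀

  prime∤primorial-from : ∀ {p} n k → Prime p → n + k < p → ¬ p ∣ primorial-from n k
  prime∤primorial-from n zero pp _ p∣1 = <⇒≢ (prime⇒>1 pp) (sym (∣1⇒≡1 p∣1))
  prime∤primorial-from {p} n (suc k) pp n+k<p p∣ with euclidsLemma (primorial-from n k) _ pp p∣
  ... | inj₁ h = prime∤primorial-from n k pp (<-trans (+-monoʳ-< n (n<1+n k)) n+k<p) h
  ... | inj₂ h with prime? (suc (n + k))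
  ...   | no  _  = <⇒≢ (prime⇒>1 pp) (sym (∣1⇒≡1 h))
  ...   | yes pr = <⇒≢ n+k<p (trans (+-suc n k) (sym (prime∣prime pp pr h)))

  prime∣!⇒≤ : ∀ {p} n → Prime p → p ∣ n ! → p ≤ n
  prime∣!⇒≤ zero    pp h = contradiction (sym (∣1⇒≡1 h)) (<⇒≢ (prime⇒>1 pp))
  prime∣!⇒≤ (suc n) pp h with euclidsLemma (suc n) (n !) pp h
  ... | inj₁ h = ∣⇒≤ h
  ... | inj₂ h = m≤n⇒m≤1+n (prime∣!⇒≤ n pp h)

  ∣! : ∀ {p n} → 0 < p → p ≤ n → p ∣ n !
  ∣! {suc p} _ p≤n = ∣-trans (m∣m*n (p !)) (m≤n⇒m!∣n! p≤n)

  prime∣central : ∀ {p} n → Prime p → n < p → p ≤ n + n → p ∣ (n + n) C n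
  prime∣central {p} n pp n<p p≤2n with euclidsLemma ((n + n) C n) (n ! * (n + n ∸ n) !) pp
      (subst (p ∣_) (sym factorial) (∣! (prime⇒>0 pp) p≤2n))
    where
    instance
      nz : NonZero (n ! * (n + n ∸ n) !)
      nz = m*n≢0 (n !) ((n + n ∸ n) !) {{n !≢0}} {{(n + n ∸ n) !≢0}}
    factorial : ((n + n) C n) * (n ! * (n + n ∸ n) !) ≡ (n + n) !
    factorial = trans (cong (_* (n ! * (n + n ∸ n) !)) (nCk≡n!/k![n-k]! (m≤m+n n n)))
                      (m/n*n≡m (k![n∸k]!∣n! (m≤m+n n n)))
  ... | inj₁ h = h
  ... | inj₂ h with euclidsLemma (n !) _ pp h
  ...   | inj₁ h = contradiction (prime∣!⇒≤ n pp h) (<⇒≱ n<p)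
  ...   | inj₂ h = contradiction (prime∣!⇒≤ n pp (subst (λ t → p ∣ t !) (m+n∸n≡m n n) h)) (<⇒≱ n<p)

  coprime-*-∣ : ∀ {m n o} → Coprime m n → m ∣ o → n ∣ o → n * m ∣ o
  coprime-*-∣ {m} {n} c m∣o (divides k refl) =
    subst (n * m ∣_) (*-comm n k) (*-monoʳ-∣ n (coprime-divisor c (subst (m ∣_) (*-comm k n) m∣o)))

  -- Each prime in (n, 2n] divides (2n)! but not n!, so it divides the binomial coefficient; being
  -- coprime to the product of the smaller ones, it can be multiplied in.
  primorial-from∣central : ∀ n k → k ≤ n → primorial-from n k ∣ (n + n) C n
  primorial-from∣central n zero    _   = 1∣ _
  primorial-from∣central n (suc k) k<n with prime? (suc (n + k))
  ... | no  _  = subst (_∣ _) (sym (*-identityʳ _)) (primorial-from∣central n k (<⇒≤ k<n))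
  ... | yes pp = coprime-*-∣
    (prime∤⇒coprime pp (prime∤primorial-from n k pp ≤-refl))
    (prime∣central n pp (s≤s (m≤m+n n k)) (subst (_≤ n + n) (+-suc n k) (+-monoʳ-≤ n k<n)))
    (primorial-from∣central n k (<⇒≤ k<n))

  C≤2^ : ∀ n k → n C k ≤ 2 ^ n
  C≤2^ zero    zero    = ≤-refl
  C≤2^ zero    (suc k) = z≤n
  C≤2^ (suc n) zero    = m^n>0 2 (suc n)
  C≤2^ (suc n) (suc k) = subst (_≤ 2 ^ suc n) (nCk+nC[k+1]≡[n+1]C[k+1] n k)
    (+-mono-≤ (C≤2^ n k) (≤-trans (C≤2^ n (suc k)) (≤-reflexive (sym (+-identityʳ (2 ^ n))))))

  C>0 : ∀ n k → k ≤ n → 0 < n C k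
  C>0 n       zero    _   = s≤s z≤n
  C>0 (suc n) (suc k) k≤n = subst (0 <_) (nCk+nC[k+1]≡[n+1]C[k+1] n k)
    (<-≤-trans (C>0 n k (s≤s⁻¹ k≤n)) (m≤m+n (n C k) (n C suc k)))

  2^-cancel-≤ : ∀ a b → 2 ^ a ≤ 2 ^ b → a ≤ b
  2^-cancel-≤ a b h = ≮⇒≥ λ b<a → <-irrefl refl (<-≤-trans (^-monoʳ-< 2 (s≤s (s≤s z≤n)) b<a) h)

  θ-dyadic : ∀ n → θ-from n n ≤ 4 * n
  θ-dyadic n = 2^-cancel-≤ (θ-from n n) (4 * n) (begin
    2 ^ θ-from n n                            ≤⟨ 2^θ-from≤ n n ⟩
    primorial-from n n * primorial-from n n   ≤⟨ *-mono-≤ P≤ P≤ ⟩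
    2 ^ (n + n) * 2 ^ (n + n)                 ≡⟨ ^-distribˡ-+-* 2 (n + n) (n + n) ⟨
    2 ^ (n + n + (n + n))                     ≡⟨ cong (2 ^_) (form n) ⟩
    2 ^ (4 * n)                               ∎)
    where
    open ≤-Reasoning
    form : ∀ n → n + n + (n + n) ≡ 4 * n
    form = solve-∀
    P≤ : primorial-from n n ≤ 2 ^ (n + n)
    P≤ = ≤-trans (∣⇒≤ {{>-nonZero (C>0 (n + n) n (m≤m+n n n))}} (primorial-from∣central n n ≤-refl))
                 (C≤2^ (n + n) n)

  primeLen≤ : ∀ p → primeLen p ≤ p
  primeLen≤ p with prime? p
  ... | yes _ = len-≤-self p
  ... | no  _ = z≤n

  chebyshev : ∀ y → θ (suc y) ≤ 6 * y
  chebyshev = <-rec _ step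
    where
    open ≤-Reasoning
    even : ∀ h → θ (suc h) ≤ 6 * h → θ (suc (2 * h)) ≤ 10 * h
    even h θ≤ = begin
      θ (suc (2 * h))          ≡⟨ cong (λ t → θ (suc (h + t))) (+-identityʳ h) ⟩
      θ (suc (h + h))          ≡⟨ θ-+ h h ⟩
      θ (suc h) + θ-from h h   ≤⟨ +-mono-≤ θ≤ (θ-dyadic h) ⟩
      6 * h + 4 * h            ≡⟨ *-distribʳ-+ h 6 4 ⟨
      10 * h                   ∎
    step : ∀ y → (∀ {k} → k < y → θ (suc k) ≤ 6 * k) → θ (suc y) ≤ 6 * y
    step y rec with even-or-odd y
    ... | zero  , inj₁ refl = z≤n
    ... | suc h , inj₁ refl = begin
      θ (suc (2 * suc h))   ≤⟨ even (suc h) (rec (m<m+n (suc h) (s≤s z≤n))) ⟩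
      10 * suc h            ≤⟨ *-monoˡ-≤ (suc h) (m≤m+n 10 2) ⟩
      12 * suc h            ≡⟨ *-assoc 6 2 (suc h) ⟩
      6 * (2 * suc h)       ∎
    -- The one new number is bounded by `primeLen` p ≤ p. This step fixes the constant: 10h + (2h +
    -- 1) has to be at most 6 (2h + 1).
    ... | h , inj₂ refl = begin
      θ (suc (2 * h)) + primeLen (suc (2 * h))
        ≤⟨ +-mono-≤ (even h (rec (s≤s (m≤m+n h (h + 0))))) (primeLen≤ (suc (2 * h))) ⟩
      10 * h + suc (2 * h)
        ≤⟨ m≤m+n _ 5 ⟩
      10 * h + suc (2 * h) + 5
        ≡⟨ form h ⟩
      6 * suc (2 * h) ∎
      where
      form : ∀ h → 10 * h + suc (2 * h) + 5 ≡ 6 * suc (2 * h)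
      form = solve-∀

open Arithmetic

open import Data.Empty using (⊥; ⊥-elim)
open import Data.Integer using (ℤ; +_; -[1+_])
import Data.Integer as ℤ
import Data.Integer.Properties as ℤ
open import Data.List using (List; length)
open import Data.List.Relation.Unary.All using (All; []; _∷_)
import Data.List.Relation.Unary.All as All
open import Data.List.Relation.Unary.AllPairs using ([]; _∷_)
open import Data.List.Relation.Unary.Unique.Propositional using (Unique)
open import Data.Nat using (ℕ; zero; suc; z≤n; s≤s; _%_; _^_)
import Data.Nat as ℕ
open import Data.Nat.Coprimality using (Coprime; coprime-divisor)
import Data.Nat.Coprimality as Coprimality
import Data.Nat.DivMod as ℕ
open import Data.Nat.Divisibility hiding (quotient)
open import Data.Nat.GCD using (gcd; gcd[m,n]∣m; gcd[m,n]∣n; gcd-greatest; c*gcd[m,n]≡gcd[cm,cn])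
open import Data.Nat.Induction using (<-rec)
open import Data.Nat.Primality using (Prime; prime?; prime[2]; euclidsLemma)
import Data.Nat.Properties as ℕ
open import Data.Nat.Tactic.RingSolver using (solve-∀)
open import Data.Product using (_,_; proj₁; proj₂)
open import Data.Rational renaming (_/_ to _÷ℤ_) hiding (∣_∣)
open import Data.Rational.Properties
open import Data.Rational.Solver using (module +-*-Solver)
open import Data.Sum using (_⊎_; inj₁; inj₂; [_,_]′)
open import Relation.Binary.PropositionalEquality hiding (J)
open import Relation.Nullary using (Dec; yes; no; ¬_; contradiction)
open import Relation.Nullary.Decidable using (_×-dec_; ¬?; map′)
open +-*-Solver
open import Algebra.Properties.Group +-0-group using (∙-cancelˡ)

-- Finite sums of rationals

*-mono-nonNeg : ∀ {a b c d} → 0ℚ ≤ a → 0ℚ ≤ c → a ≤ b → c ≤ d → a * c ≤ b * d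
*-mono-nonNeg {a} {b} {c} {d} 0≤a 0≤c a≤b c≤d =
  ≤-trans (*-monoˡ-≤-nonNeg a {{nonNegative 0≤a}} c≤d)
          (*-monoʳ-≤-nonNeg d {{nonNegative (≤-trans 0≤c c≤d)}} a≤b)

*-monoˡ : ∀ {a b c} → 0ℚ ≤ c → a ≤ b → c * a ≤ c * b
*-monoˡ {c = c} 0≤c = *-monoˡ-≤-nonNeg c {{nonNegative 0≤c}}

*-monoʳ : ∀ {a b c} → 0ℚ ≤ c → a ≤ b → a * c ≤ b * c
*-monoʳ {c = c} 0≤c = *-monoʳ-≤-nonNeg c {{nonNegative 0≤c}}

*-cancelˡ : ∀ {a b c} → 0ℚ < c → c * a ≤ c * b → a ≤ b
*-cancelˡ {c = c} 0<c h = *-cancelˡ-≤-pos c {{positive 0<c}} h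

0≤1 : 0ℚ ≤ 1ℚ
0≤1 = nonNegative⁻¹ 1ℚ

square-cancel-≤ : ∀ {a b} → 0ℚ ≤ b → a * a ≤ b * b → a ≤ b
square-cancel-≤ 0≤b h = ≮⇒≥ λ b<a → <-irrefl refl (<-≤-trans (sq-mono-< 0≤b b<a) h)

≤-+ʳ : ∀ {a b} → 0ℚ ≤ b → a ≤ a + b
≤-+ʳ {a} {b} 0≤b = ≤-by b 0≤b refl

≤-+ˡ : ∀ {a b} → 0ℚ ≤ b → a ≤ b + a
≤-+ˡ {a} {b} 0≤b = ≤-by b 0≤b (+-comm b a)

-- Naturals and their reciprocals as rationals

abstract
  -- Opaque, so that constants such as `ι 5408` are treated by `ι-+` and `ι-*` and not as normalised
  -- fractions.
  ι : ℕ → ℚ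
  ι n = + n ÷ℤ 1

  ι-def : ∀ n → ι n ≡ + n ÷ℤ 1
  ι-def n = refl

  ι-0 : ι 0 ≡ 0ℚ
  ι-0 = refl

  ι-1 : ι 1 ≡ 1ℚ
  ι-1 = refl

  ι-suc : ∀ n → ι (suc n) ≡ 1ℚ + ι n
  ι-suc = fromℕ-suc

ι-+ : ∀ m n → ι (m ℕ.+ n) ≡ ι m + ι n
ι-+ zero    n = trans (sym (+-identityˡ (ι n))) (cong (_+ ι n) (sym ι-0))
ι-+ (suc m) n = trans (ι-suc (m ℕ.+ n)) (trans (cong (λ t → 1ℚ + t) (ι-+ m n))
  (trans (sym (+-assoc 1ℚ (ι m) (ι n))) (cong (_+ ι n) (sym (ι-suc m)))))

ι-* : ∀ m n → ι (m ℕ.* n) ≡ ι m * ι n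
ι-* zero    n = trans ι-0 (sym (trans (cong (_* ι n) ι-0) (*-zeroˡ (ι n))))
ι-* (suc m) n = trans (ι-+ n (m ℕ.* n)) (trans (cong (λ t → ι n + t) (ι-* m n))
  (trans (solve 2 (λ a b → b :+ a :* b := (con 1ℚ :+ a) :* b) refl (ι m) (ι n)) (cong (_* ι n) (sym (ι-suc m)))))

0≤ι : ∀ n → 0ℚ ≤ ι n
0≤ι zero    = ≤-reflexive (sym ι-0)
0≤ι (suc n) = ≤-trans (0≤+ 0≤1 (0≤ι n)) (≤-reflexive (sym (ι-suc n)))

ι-mono : ∀ {m n} → m ℕ.≤ n → ι m ≤ ι n
ι-mono {m} {n} m≤n = ≤-by (ι (n ℕ.∸ m)) (0≤ι (n ℕ.∸ m))
  (trans (cong ι (sym (ℕ.m+[n∸m]≡n m≤n))) (ι-+ m (n ℕ.∸ m)))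

ι-mono-< : ∀ {m n} → m ℕ.< n → ι m < ι n
ι-mono-< {m} m<n = <-≤-trans (<-by 1ℚ (positive⁻¹ 1ℚ) (trans (ι-suc m) (+-comm 1ℚ (ι m)))) (ι-mono m<n)

0<ι : ∀ {n} → 0 ℕ.< n → 0ℚ < ι n
0<ι {n} 0<n = subst (_< ι n) ι-0 (ι-mono-< 0<n)

ι-cancel : ∀ {m n} → ι m ≤ ι n → m ℕ.≤ n
ι-cancel h = ℕ.≮⇒≥ λ n<m → <-irrefl refl (<-≤-trans (ι-mono-< n<m) h)

1≤ι : ∀ {n} → 0 ℕ.< n → 1ℚ ≤ ι n
1≤ι {n} 0<n = subst (_≤ ι n) ι-1 (ι-mono 0<n)

abstract
  -- The convention 1/0 = 0 makes `inv-*` unconditional and lets sums of reciprocals start at index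
  -- 0.
  inv : ℕ → ℚ
  inv zero    = 0ℚ
  inv (suc n) = + 1 ÷ℤ suc n

  inv-0 : inv 0 ≡ 0ℚ
  inv-0 = refl

  inv-def : ∀ n → inv (suc n) ≡ + 1 ÷ℤ suc n
  inv-def n = refl

  inv-1 : inv 1 ≡ 1ℚ
  inv-1 = refl

  0≤inv : ∀ n → 0ℚ ≤ inv n
  0≤inv zero    = ≤-refl
  0≤inv (suc n) = <⇒≤ (recip-pos n)

  0<inv : ∀ {n} → 0 ℕ.< n → 0ℚ < inv n
  0<inv {suc n} _ = recip-pos n

  inv-anti : ∀ {m n} → 0 ℕ.< m → m ℕ.≤ n → inv n ≤ inv m
  inv-anti {suc m} {suc n} _ (s≤s m≤n) = recip-anti m≤n

  ι*inv : ∀ {n} → 0 ℕ.< n → ι n * inv n ≡ 1ℚ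
  ι*inv {suc n} _ = trans (sym (·≡* (suc n) (+ 1 ÷ℤ suc n)))
    (trans (cong (λ t → suc n · (+ 1 ÷ℤ suc t)) (sym (ℕ.+-identityʳ n))) (recip-split n 0))

ι-cancelˡ : ∀ {n a b} → 0 ℕ.< n → ι n * a ≡ ι n * b → a ≡ b
ι-cancelˡ {n} {a} {b} 0<n eq = trans (sym (un a)) (trans (cong (inv n *_) eq) (un b))
  where
  un : ∀ t → inv n * (ι n * t) ≡ t
  un t = trans (solve 3 (λ i n t → i :* (n :* t) := (n :* i) :* t) refl (inv n) (ι n) t)
    (trans (cong (_* t) (ι*inv 0<n)) (*-identityˡ t))

inv-* : ∀ m n → inv (m ℕ.* n) ≡ inv m * inv n
inv-* zero    n = trans inv-0 (sym (trans (cong (_* inv n) inv-0) (*-zeroˡ (inv n))))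
inv-* (suc m) zero = trans (cong inv (ℕ.*-zeroʳ m)) (trans inv-0 (sym (trans (cong (inv (suc m) *_) inv-0) (*-zeroʳ (inv (suc m))))))
inv-* (suc m) (suc n) = ι-cancelˡ {suc m ℕ.* suc n} (s≤s z≤n)
  (trans (ι*inv {suc m ℕ.* suc n} (s≤s z≤n)) (sym
    (trans (cong (_* (inv (suc m) * inv (suc n))) (ι-* (suc m) (suc n)))
    (trans (solve 4 (λ a b c d → (a :* b) :* (c :* d) := (a :* c) :* (b :* d)) refl (ι (suc m)) (ι (suc n)) (inv (suc m)) (inv (suc n)))
    (trans (cong₂ _*_ (ι*inv (s≤s z≤n)) (ι*inv (s≤s z≤n))) (*-identityˡ 1ℚ))))))

ι≤*inv : ∀ {k n x} → 0 ℕ.< n → k ℕ.* n ℕ.≤ x → ι k ≤ ι x * inv n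
ι≤*inv {k} {n} {x} 0<n h = ≤-trans (≤-reflexive (sym
    (trans (*-assoc (ι k) (ι n) (inv n)) (trans (cong (ι k *_) (ι*inv 0<n)) (*-identityʳ (ι k))))))
  (*-monoʳ (0≤inv n) (≤-trans (≤-reflexive (sym (ι-* k n))) (ι-mono h)))

-- Indicators and sums over initial segments of ℕ

𝟙 : ∀ {P : Set} → Dec P → ℚ
𝟙 (yes _) = 1ℚ
𝟙 (no  _) = 0ℚ

module _ {P : Set} where
  0≤𝟙 : (p? : Dec P) → 0ℚ ≤ 𝟙 p?
  0≤𝟙 (yes _) = 0≤1
  0≤𝟙 (no  _) = ≤-refl

  𝟙≤1 : (p? : Dec P) → 𝟙 p? ≤ 1ℚ
  𝟙≤1 (yes _) = ≤-refl
  𝟙≤1 (no  _) = 0≤1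

  𝟙-yes : (p? : Dec P) → P → 𝟙 p? ≡ 1ℚ
  𝟙-yes (yes _) _ = refl
  𝟙-yes (no ¬p) p = contradiction p ¬p

  𝟙-no : (p? : Dec P) → ¬ P → 𝟙 p? ≡ 0ℚ
  𝟙-no (yes p) ¬p = contradiction p ¬p
  𝟙-no (no  _) _  = refl

𝟙-mono : ∀ {P Q : Set} (p? : Dec P) (q? : Dec Q) → (P → Q) → 𝟙 p? ≤ 𝟙 q?
𝟙-mono (yes p) q? f = ≤-reflexive (sym (𝟙-yes q? (f p)))
𝟙-mono (no  _) q? f = 0≤𝟙 q?

𝟙-cong : ∀ {P Q : Set} (p? : Dec P) (q? : Dec Q) → (P → Q) → (Q → P) → 𝟙 p? ≡ 𝟙 q?
𝟙-cong p? q? f g = ≤-antisym (𝟙-mono p? q? f) (𝟙-mono q? p? g)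

𝟙-× : ∀ {P Q : Set} (p? : Dec P) (q? : Dec Q) → 𝟙 p? * 𝟙 q? ≡ 𝟙 (p? ×-dec q?)
𝟙-× (yes _) (yes _) = refl
𝟙-× (yes _) (no  _) = refl
𝟙-× (no  _) q?      = *-zeroˡ (𝟙 q?)

𝟙*-mono : ∀ {P : Set} (p? : Dec P) {a b} → (P → a ≤ b) → 𝟙 p? * a ≤ 𝟙 p? * b
𝟙*-mono (yes p) f = *-monoˡ 0≤1 (f p)
𝟙*-mono (no  _) {a} {b} f = ≤-reflexive (trans (*-zeroˡ a) (sym (*-zeroˡ b)))

𝟙*-≤ : ∀ {P : Set} (p? : Dec P) {a b} → 0ℚ ≤ b → (P → a ≤ b) → 𝟙 p? * a ≤ b
𝟙*-≤ (yes p) {a} 0≤b f = ≤-trans (≤-reflexive (*-identityˡ a)) (f p)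
𝟙*-≤ (no  _) {a} 0≤b f = ≤-trans (≤-reflexive (*-zeroˡ a)) 0≤b

𝟙*≤ : ∀ {P : Set} (p? : Dec P) {a} → 0ℚ ≤ a → 𝟙 p? * a ≤ a
𝟙*≤ p? 0≤a = 𝟙*-≤ p? 0≤a (λ _ → ≤-refl)

∑ : ℕ → (ℕ → ℚ) → ℚ
∑ zero    f = 0ℚ
∑ (suc n) f = ∑ n f + f n

syntax ∑ n (λ i → e) = ∑[ i < n ] e
infixr 5 ∑

∑-cong< : ∀ n {f g} → (∀ i → i ℕ.< n → f i ≡ g i) → ∑ n f ≡ ∑ n g
∑-cong< zero    h = refl
∑-cong< (suc n) h = cong₂ _+_ (∑-cong< n (λ i i<n → h i (ℕ.m≤n⇒m≤1+n i<n))) (h n ℕ.≤-refl)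

∑-cong : ∀ n {f g} → (∀ i → f i ≡ g i) → ∑ n f ≡ ∑ n g
∑-cong n h = ∑-cong< n (λ i _ → h i)

∑-mono : ∀ n {f g} → (∀ i → i ℕ.< n → f i ≤ g i) → ∑ n f ≤ ∑ n g
∑-mono zero    h = ≤-refl
∑-mono (suc n) h = +-mono-≤ (∑-mono n (λ i i<n → h i (ℕ.m≤n⇒m≤1+n i<n))) (h n ℕ.≤-refl)

∑-nonNeg : ∀ n {f} → (∀ i → 0ℚ ≤ f i) → 0ℚ ≤ ∑ n f
∑-nonNeg zero    h = ≤-refl
∑-nonNeg (suc n) h = 0≤+ (∑-nonNeg n h) (h n)

∑-zero : ∀ n {f} → (∀ i → i ℕ.< n → f i ≡ 0ℚ) → ∑ n f ≡ 0ℚ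
∑-zero zero    h = refl
∑-zero (suc n) h = trans (cong₂ _+_ (∑-zero n (λ i i<n → h i (ℕ.m≤n⇒m≤1+n i<n))) (h n ℕ.≤-refl)) (+-identityˡ 0ℚ)

∑-+ : ∀ n f g → ∑ n (λ i → f i + g i) ≡ ∑ n f + ∑ n g
∑-+ zero    f g = sym (+-identityˡ 0ℚ)
∑-+ (suc n) f g = trans (cong (_+ (f n + g n)) (∑-+ n f g))
  (solve 4 (λ a b c d → (a :+ b) :+ (c :+ d) := (a :+ c) :+ (b :+ d)) refl (∑ n f) (∑ n g) (f n) (g n))

∑-*ˡ : ∀ n c f → c * ∑ n f ≡ ∑ n (λ i → c * f i)
∑-*ˡ zero    c f = *-zeroʳ c
∑-*ˡ (suc n) c f = trans (*-distribˡ-+ c (∑ n f) (f n)) (cong (_+ c * f n) (∑-*ˡ n c f))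

∑-*ʳ : ∀ n c f → ∑ n f * c ≡ ∑ n (λ i → f i * c)
∑-*ʳ n c f = trans (*-comm (∑ n f) c) (trans (∑-*ˡ n c f) (∑-cong n (λ i → *-comm c (f i))))

∑-swap : ∀ m n (f : ℕ → ℕ → ℚ) → ∑ m (λ i → ∑ n (λ j → f i j)) ≡ ∑ n (λ j → ∑ m (λ i → f i j))
∑-swap zero    n f = sym (∑-zero n (λ _ _ → refl))
∑-swap (suc m) n f = trans (cong (_+ ∑ n (f m)) (∑-swap m n f))
  (sym (∑-+ n (λ j → ∑ m (λ i → f i j)) (f m)))

∑-split : ∀ m n f → ∑ (m ℕ.+ n) f ≡ ∑ m f + ∑ n (λ i → f (m ℕ.+ i))
∑-split m zero    f = trans (cong (λ t → ∑ t f) (ℕ.+-identityʳ m)) (sym (+-identityʳ (∑ m f)))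
∑-split m (suc n) f = trans (cong (λ t → ∑ t f) (ℕ.+-suc m n))
  (trans (cong (_+ f (m ℕ.+ n)) (∑-split m n f)) (+-assoc (∑ m f) _ _))

∑-range : ∀ {m n} f → (∀ i → 0ℚ ≤ f i) → m ℕ.≤ n → ∑ m f ≤ ∑ n f
∑-range {m} {n} f 0≤f m≤n = subst (λ t → ∑ m f ≤ ∑ t f) (ℕ.m+[n∸m]≡n m≤n)
  (≤-by _ (∑-nonNeg (n ℕ.∸ m) (λ i → 0≤f (m ℕ.+ i))) (∑-split m (n ℕ.∸ m) f))

∑-const : ∀ n c → ∑ n (λ _ → c) ≡ ι n * c
∑-const zero    c = sym (trans (cong (_* c) ι-0) (*-zeroˡ c))
∑-const (suc n) c = trans (cong (_+ c) (∑-const n c))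
  (trans (solve 2 (λ a c → a :* c :+ c := (con 1ℚ :+ a) :* c) refl (ι n) c) (cong (_* c) (sym (ι-suc n))))

∑-term : ∀ n f → (∀ i → 0ℚ ≤ f i) → ∀ {a} → a ℕ.< n → f a ≤ ∑ n f
∑-term (suc n) f 0≤f {a} a<n with ℕ.m≤n⇒m<n∨m≡n (ℕ.s≤s⁻¹ a<n)
... | inj₁ a<n  = ≤-trans (∑-term n f 0≤f a<n) (≤-+ʳ (0≤f n))
... | inj₂ refl = ≤-+ˡ (∑-nonNeg n 0≤f)

∑-δ-out : ∀ n a (f : ℕ → ℚ) → n ℕ.≤ a → ∑ n (λ i → 𝟙 (a ℕ.≟ i) * f i) ≡ 0ℚ
∑-δ-out n a f n≤a = ∑-zero n λ i i<n → trans
  (cong (_* f i) (𝟙-no (a ℕ.≟ i) (λ { refl → ℕ.<-irrefl refl (ℕ.<-≤-trans i<n n≤a) }))) (*-zeroˡ (f i))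

∑-δ : ∀ n {a} (f : ℕ → ℚ) → a ℕ.< n → ∑ n (λ i → 𝟙 (a ℕ.≟ i) * f i) ≡ f a
∑-δ (suc n) {a} f a<n with ℕ.m≤n⇒m<n∨m≡n (ℕ.s≤s⁻¹ a<n)
... | inj₁ a<n  = trans (cong₂ _+_ (∑-δ n f a<n)
                    (trans (cong (_* f n) (𝟙-no (a ℕ.≟ n) (ℕ.<⇒≢ a<n))) (*-zeroˡ (f n)))) (+-identityʳ (f a))
... | inj₂ refl = trans (cong₂ _+_ (∑-δ-out n n f ℕ.≤-refl)
                    (trans (cong (_* f n) (𝟙-yes (n ℕ.≟ n) refl)) (*-identityˡ (f n)))) (+-identityˡ (f n))

∑-δ-≤ : ∀ n a (f : ℕ → ℚ) → 0ℚ ≤ f a → ∑ n (λ i → 𝟙 (a ℕ.≟ i) * f i) ≤ f a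
∑-δ-≤ n a f 0≤fa with a ℕ.<? n
... | yes a<n = ≤-reflexive (∑-δ n f a<n)
... | no  a≮n = ≤-trans (≤-reflexive (∑-δ-out n a f (ℕ.≮⇒≥ a≮n))) 0≤fa

∑-δ-const : ∀ n a c → 0ℚ ≤ c → ∑ n (λ i → 𝟙 (a ℕ.≟ i) * c) ≤ c
∑-δ-const n a c = ∑-δ-≤ n a (λ _ → c)

-- Double counting: each g i can be charged only by the single m equal to φ i, so φ may take a value
-- several times. Terms f m ≤ 0 require no witness.
∑-cover : ∀ N f A (φ : ℕ → ℕ) g → (∀ i → 0ℚ ≤ g i) →
  (∀ m → m ℕ.< N → f m ≤ 0ℚ ⊎ ∃ λ i → i ℕ.< A × φ i ≡ m × f m ≤ g i) → ∑ N f ≤ ∑ A g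
∑-cover N f A φ g 0≤g h = begin
  ∑ N f                                            ≤⟨ ∑-mono N pointwise ⟩
  ∑[ m < N ] ∑[ i < A ] 𝟙 (φ i ℕ.≟ m) * g i        ≡⟨ ∑-swap N A _ ⟩
  ∑[ i < A ] ∑[ m < N ] 𝟙 (φ i ℕ.≟ m) * g i        ≤⟨ ∑-mono A (λ i _ → ∑-δ-const N (φ i) (g i) (0≤g i)) ⟩
  ∑ A g                                            ∎
  where
  open ≤-Reasoning
  0≤ : ∀ m i → 0ℚ ≤ 𝟙 (φ i ℕ.≟ m) * g i
  0≤ m i = 0≤* (0≤𝟙 (φ i ℕ.≟ m)) (0≤g i)
  pointwise : ∀ m → m ℕ.< N → f m ≤ ∑[ i < A ] 𝟙 (φ i ℕ.≟ m) * g i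
  pointwise m m<N with h m m<N
  ... | inj₁ fm≤0 = ≤-trans fm≤0 (∑-nonNeg A (0≤ m))
  ... | inj₂ (i , i<A , eq , fm≤) = ≤-trans fm≤ (≤-trans
    (≤-reflexive (sym (trans (cong (_* g i) (𝟙-yes (φ i ℕ.≟ m) eq)) (*-identityˡ (g i)))))
    (∑-term A _ (0≤ m) i<A))

∑-cover₂ : ∀ N f A B (φ : ℕ → ℕ → ℕ) (g : ℕ → ℕ → ℚ) → (∀ i j → 0ℚ ≤ g i j) →
  (∀ m → m ℕ.< N → f m ≤ 0ℚ ⊎ ∃ λ i → ∃ λ j → i ℕ.< A × j ℕ.< B × φ i j ≡ m × f m ≤ g i j) →
  ∑ N f ≤ ∑[ i < A ] ∑[ j < B ] g i j
∑-cover₂ N f A B φ g 0≤g h = begin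
  ∑ N f
    ≤⟨ ∑-mono N pointwise ⟩
  ∑[ m < N ] ∑[ i < A ] ∑[ j < B ] 𝟙 (φ i j ℕ.≟ m) * g i j
    ≡⟨ ∑-swap N A _ ⟩
  ∑[ i < A ] ∑[ m < N ] ∑[ j < B ] 𝟙 (φ i j ℕ.≟ m) * g i j
    ≡⟨ ∑-cong A (λ i → ∑-swap N B _) ⟩
  ∑[ i < A ] ∑[ j < B ] ∑[ m < N ] 𝟙 (φ i j ℕ.≟ m) * g i j
    ≤⟨ ∑-mono A (λ i _ → ∑-mono B (λ j _ → ∑-δ-const N (φ i j) (g i j) (0≤g i j))) ⟩
  ∑[ i < A ] ∑[ j < B ] g i j ∎
  where
  open ≤-Reasoning
  0≤ : ∀ m i j → 0ℚ ≤ 𝟙 (φ i j ℕ.≟ m) * g i j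
  0≤ m i j = 0≤* (0≤𝟙 (φ i j ℕ.≟ m)) (0≤g i j)
  pointwise : ∀ m → m ℕ.< N → f m ≤ ∑[ i < A ] ∑[ j < B ] 𝟙 (φ i j ℕ.≟ m) * g i j
  pointwise m m<N with h m m<N
  ... | inj₁ fm≤0 = ≤-trans fm≤0 (∑-nonNeg A (λ i → ∑-nonNeg B (0≤ m i)))
  ... | inj₂ (i , j , i<A , j<B , eq , fm≤) = ≤-trans fm≤ (≤-trans
    (≤-reflexive (sym (trans (cong (_* g i j) (𝟙-yes (φ i j ℕ.≟ m) eq)) (*-identityˡ (g i j)))))
    (≤-trans (∑-term B _ (0≤ m i) j<B)
             (∑-term A (λ i → ∑[ j < B ] 𝟙 (φ i j ℕ.≟ m) * g i j) (λ i → ∑-nonNeg B (0≤ m i)) i<A)))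

∑-cover₃ : ∀ N f A B C (φ : ℕ → ℕ → ℕ → ℕ) (g : ℕ → ℕ → ℕ → ℚ) → (∀ i j k → 0ℚ ≤ g i j k) →
  (∀ m → m ℕ.< N → f m ≤ 0ℚ ⊎ ∃ λ i → ∃ λ j → ∃ λ k → i ℕ.< A × j ℕ.< B × k ℕ.< C × φ i j k ≡ m × f m ≤ g i j k) →
  ∑ N f ≤ ∑[ i < A ] ∑[ j < B ] ∑[ k < C ] g i j k
∑-cover₃ N f A B C φ g 0≤g h = begin
  ∑ N f
    ≤⟨ ∑-mono N pointwise ⟩
  ∑[ m < N ] ∑[ i < A ] ∑[ j < B ] ∑[ k < C ] 𝟙 (φ i j k ℕ.≟ m) * g i j k
    ≡⟨ ∑-swap N A _ ⟩
  ∑[ i < A ] ∑[ m < N ] ∑[ j < B ] ∑[ k < C ] 𝟙 (φ i j k ℕ.≟ m) * g i j k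
    ≡⟨ ∑-cong A (λ i → trans (∑-swap N B _) (∑-cong B (λ j → ∑-swap N C _))) ⟩
  ∑[ i < A ] ∑[ j < B ] ∑[ k < C ] ∑[ m < N ] 𝟙 (φ i j k ℕ.≟ m) * g i j k
    ≤⟨ ∑-mono A (λ i _ → ∑-mono B (λ j _ → ∑-mono C (λ k _ → ∑-δ-const N (φ i j k) (g i j k) (0≤g i j k)))) ⟩
  ∑[ i < A ] ∑[ j < B ] ∑[ k < C ] g i j k ∎
  where
  open ≤-Reasoning
  0≤ : ∀ m i j k → 0ℚ ≤ 𝟙 (φ i j k ℕ.≟ m) * g i j k
  0≤ m i j k = 0≤* (0≤𝟙 (φ i j k ℕ.≟ m)) (0≤g i j k)
  0≤₁ : ∀ m i j → 0ℚ ≤ ∑[ k < C ] 𝟙 (φ i j k ℕ.≟ m) * g i j k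
  0≤₁ m i j = ∑-nonNeg C (0≤ m i j)
  0≤₂ : ∀ m i → 0ℚ ≤ ∑[ j < B ] ∑[ k < C ] 𝟙 (φ i j k ℕ.≟ m) * g i j k
  0≤₂ m i = ∑-nonNeg B (0≤₁ m i)
  pointwise : ∀ m → m ℕ.< N → f m ≤ ∑[ i < A ] ∑[ j < B ] ∑[ k < C ] 𝟙 (φ i j k ℕ.≟ m) * g i j k
  pointwise m m<N with h m m<N
  ... | inj₁ fm≤0 = ≤-trans fm≤0 (∑-nonNeg A (0≤₂ m))
  ... | inj₂ (i , j , k , i<A , j<B , k<C , eq , fm≤) = ≤-trans fm≤ (≤-trans
    (≤-reflexive (sym (trans (cong (_* g i j k) (𝟙-yes (φ i j k ℕ.≟ m) eq)) (*-identityˡ (g i j k)))))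
    (≤-trans (∑-term C _ (0≤ m i j) k<C) (≤-trans (∑-term B _ (0≤₁ m i) j<B) (∑-term A _ (0≤₂ m) i<A))))

∑-periodic : ∀ k n (f : ℕ → ℚ) → (∀ i → f (n ℕ.+ i) ≡ f i) → ∑ (k ℕ.* n) f ≡ ι k * ∑ n f
∑-periodic zero    n f per = sym (trans (cong (_* ∑ n f) ι-0) (*-zeroˡ (∑ n f)))
∑-periodic (suc k) n f per = trans (∑-split n (k ℕ.* n) f)
  (trans (cong (λ t → ∑ n f + t) (trans (∑-cong (k ℕ.* n) per) (∑-periodic k n f per)))
  (trans (solve 2 (λ s k → s :+ k :* s := (con 1ℚ :+ k) :* s) refl (∑ n f) (ι k)) (cong (_* ∑ n f) (sym (ι-suc k)))))

∑-front : ∀ n (g : ℕ → ℚ) → ∑ (suc n) g ≡ g 0 + (∑[ s < n ] g (suc s))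
∑-front n g = trans (∑-split 1 n g) (cong (_+ (∑[ s < n ] g (suc s))) (+-identityˡ (g 0)))

-- Moving the window by one place drops its first term and gains the term one period later, which is
-- equal to it.
∑-shift : ∀ n (f : ℕ → ℚ) → (∀ i → f (n ℕ.+ i) ≡ f i) → ∀ z → ∑[ s < n ] f (z ℕ.+ s) ≡ ∑ n f
∑-shift n f per zero    = refl
∑-shift n f per (suc z) = trans (trans (∑-cong n (λ s → cong f (sym (ℕ.+-suc z s)))) rotate) (∑-shift n f per z)
  where
  g : ℕ → ℚ
  g s = f (z ℕ.+ s)
  wrap : g n ≡ g 0
  wrap = trans (cong f (ℕ.+-comm z n)) (trans (per z) (cong f (sym (ℕ.+-identityʳ z))))
  rotate : ∑[ s < n ] g (suc s) ≡ ∑ n g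
  rotate = ∙-cancelˡ (g 0) (∑[ s < n ] g (suc s)) (∑ n g) (trans (sym (∑-front n g)) (trans (cong (λ t → ∑ n g + t) wrap) (+-comm (∑ n g) (g 0))))

-- The divisor sum of χ

χ-residue : ℕ → ℚ
χ-residue 1 = 1ℚ
χ-residue 3 = - 1ℚ
χ-residue _ = 0ℚ

-- The nontrivial Dirichlet character modulo 4.
χ : ℕ → ℚ
χ n = χ-residue (n % 4)

χ-* : ∀ m n → χ (m ℕ.* n) ≡ χ m * χ n
χ-* m n = trans (cong χ-residue (ℕ.%-distribˡ-* m n 4)) (table (m % 4) (n % 4) (ℕ.m%n<n m 4) (ℕ.m%n<n n 4))
  where
  table : ∀ a b → a ℕ.< 4 → b ℕ.< 4 → χ-residue ((a ℕ.* b) % 4) ≡ χ-residue a * χ-residue b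
  table 0 b _ _ = sym (*-zeroˡ (χ-residue b))
  table 1 0 _ _ = refl
  table 1 1 _ _ = refl
  table 1 2 _ _ = refl
  table 1 3 _ _ = refl
  table 2 0 _ _ = refl
  table 2 1 _ _ = refl
  table 2 2 _ _ = refl
  table 2 3 _ _ = refl
  table 3 0 _ _ = refl
  table 3 1 _ _ = refl
  table 3 2 _ _ = refl
  table 3 3 _ _ = refl
  table (suc (suc (suc (suc _)))) _ (s≤s (s≤s (s≤s (s≤s ())))) _
  table 1 (suc (suc (suc (suc _)))) _ (s≤s (s≤s (s≤s (s≤s ()))))
  table 2 (suc (suc (suc (suc _)))) _ (s≤s (s≤s (s≤s (s≤s ()))))
  table 3 (suc (suc (suc (suc _)))) _ (s≤s (s≤s (s≤s (s≤s ()))))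

χ-1mod4 : ∀ n → n % 4 ≡ 1 → χ n ≡ 1ℚ
χ-1mod4 n = cong χ-residue

χ-3mod4 : ∀ n → n % 4 ≡ 3 → χ n ≡ - 1ℚ
χ-3mod4 n = cong χ-residue

χ-even : ∀ n → n % 4 ≢ 1 → n % 4 ≢ 3 → χ n ≡ 0ℚ
χ-even n n≢1 n≢3 with %4-cases n
... | inj₁ h               = cong χ-residue h
... | inj₂ (inj₁ h)        = contradiction h n≢1
... | inj₂ (inj₂ (inj₁ h)) = cong χ-residue h
... | inj₂ (inj₂ (inj₂ h)) = contradiction h n≢3

χ≡1 : ∀ n → 0 ℕ.< n → (∀ p → Prime p → p ∣ n → p % 4 ≡ 1) → χ n ≡ 1ℚ
χ≡1 = <-rec _ step
  where
  step : ∀ n → (∀ {k} → k ℕ.< n → 0 ℕ.< k → (∀ p → Prime p → p ∣ k → p % 4 ≡ 1) → χ k ≡ 1ℚ) →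
         0 ℕ.< n → (∀ p → Prime p → p ∣ n → p % 4 ≡ 1) → χ n ≡ 1ℚ
  step 1 rec _ _ = refl
  step n@(suc (suc _)) rec _ all with prime-divisor n (s≤s (s≤s z≤n))
  ... | p , pp , divides zero ()
  ... | p , pp , divides k@(suc _) eq = trans (cong χ eq) (trans (χ-* k p) (trans
          (cong₂ _*_ (rec k<n (s≤s z≤n) (λ r pr r∣k → all r pr (∣-trans r∣k (divides p (trans eq (ℕ.*-comm k p))))))
                     (χ-1mod4 p (all p pp (divides k eq))))
          (*-identityˡ 1ℚ)))
    where
    k<n : k ℕ.< n
    k<n = subst (k ℕ.<_) (sym eq) (ℕ.m<m*n k p (prime⇒>1 pp))

∑-multiples : ∀ q Z (f : ℕ → ℚ) → 0 ℕ.< q → ∑[ d < Z ℕ.* q ] 𝟙 (q ∣? d) * f d ≡ ∑[ e < Z ] f (e ℕ.* q)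
∑-multiples q zero    f 0<q = refl
∑-multiples q (suc Z) f 0<q = begin
  ∑ (q ℕ.+ Z ℕ.* q) F                                      ≡⟨ cong (λ t → ∑ t F) (ℕ.+-comm q (Z ℕ.* q)) ⟩
  ∑ (Z ℕ.* q ℕ.+ q) F                                      ≡⟨ ∑-split (Z ℕ.* q) q F ⟩
  ∑ (Z ℕ.* q) F + (∑[ i < q ] F (Z ℕ.* q ℕ.+ i))           ≡⟨ cong₂ _+_ (∑-multiples q Z f 0<q) block ⟩
  ∑[ e < suc Z ] f (e ℕ.* q)                               ∎
  where
  open ≡-Reasoning
  F : ℕ → ℚ
  F d = 𝟙 (q ∣? d) * f d
  multiple⇒0 : ∀ i → i ℕ.< q → q ∣ Z ℕ.* q ℕ.+ i → 0 ≡ i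
  multiple⇒0 zero    _   _ = refl
  multiple⇒0 (suc i) i<q h = contradiction (∣⇒≤ (∣m+n∣m⇒∣n h (n∣m*n Z))) (ℕ.<⇒≱ i<q)
  block : ∑[ i < q ] F (Z ℕ.* q ℕ.+ i) ≡ f (Z ℕ.* q)
  block = trans (∑-cong< q (λ i i<q → cong (_* f (Z ℕ.* q ℕ.+ i))
      (𝟙-cong (q ∣? (Z ℕ.* q ℕ.+ i)) (0 ℕ.≟ i) (multiple⇒0 i i<q) (λ { refl → subst (q ∣_) (sym (ℕ.+-identityʳ (Z ℕ.* q))) (n∣m*n Z) }))))
    (trans (∑-δ q (λ i → f (Z ℕ.* q ℕ.+ i)) 0<q) (cong f (ℕ.+-identityʳ (Z ℕ.* q))))

-- r Y m = ∑_{d ∣ m} χ(d) as soon as 0 < m < Y.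
r : ℕ → ℕ → ℚ
r Y m = ∑[ d < Y ] 𝟙 (d ∣? m) * χ d

r-bound : ∀ {m Y} → 0 ℕ.< m → m ℕ.< Y → r Y m ≡ r (suc m) m
r-bound {m} {Y} 0<m m<Y = trans (cong (λ t → r t m) (sym (ℕ.m+[n∸m]≡n m<Y)))
  (trans (∑-split (suc m) (Y ℕ.∸ suc m) _) (trans (cong (λ t → r (suc m) m + t)
    (∑-zero (Y ℕ.∸ suc m) λ i _ → trans (cong (_* χ (suc m ℕ.+ i)) (𝟙-no (suc m ℕ.+ i ∣? m)
      (λ h → ℕ.<⇒≱ (s≤s (ℕ.m≤m+n m i)) (∣⇒≤ {{ℕ.>-nonZero 0<m}} h)))) (*-zeroˡ (χ (suc m ℕ.+ i)))))
    (+-identityʳ (r (suc m) m))))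

-- The divisors of m q that are multiples of q are the e q with e ∣ m, and together give χ(q) r(m).
-- The others are the divisors of m prime to q: r(m) minus the contribution of the e q ∣ m.
r-prime* : ∀ q m → Prime q → 0 ℕ.< m →
  r (suc (m ℕ.* q)) (m ℕ.* q) ≡ (1ℚ + χ q) * r (suc m) m - χ q * (∑[ e < suc m ] 𝟙 (e ℕ.* q ∣? m) * χ e)
r-prime* q m pq 0<m = begin
  r (suc (m ℕ.* q)) (m ℕ.* q)
    ≡⟨ r-bound 0<mq mq<Y ⟨
  r Y (m ℕ.* q)
    ≡⟨ ∑-cong Y pointwise ⟩
  ∑[ d < Y ] (F d + (𝟙 (d ∣? m) * χ d + (- 1ℚ) * G d))
    ≡⟨ ∑-+ Y F _ ⟩
  ∑ Y F + (∑[ d < Y ] (𝟙 (d ∣? m) * χ d + (- 1ℚ) * G d))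
    ≡⟨ cong (λ t → ∑ Y F + t) (∑-+ Y _ _) ⟩
  ∑ Y F + (r Y m + (∑[ d < Y ] (- 1ℚ) * G d))
    ≡⟨ cong₂ _+_ F≡ (cong₂ _+_ (r-bound 0<m m<Y) (trans (sym (∑-*ˡ Y (- 1ℚ) G)) (cong ((- 1ℚ) *_) G≡))) ⟩
  χ q * R + (R + (- 1ℚ) * (χ q * D))
    ≡⟨ solve 3 (λ c R D → c :* R :+ (R :+ (:- con 1ℚ) :* (c :* D)) := (con 1ℚ :+ c) :* R :- c :* D) refl (χ q) R D ⟩
  (1ℚ + χ q) * R - χ q * D ∎
  where
  open ≡-Reasoning
  Y : ℕ
  Y = suc m ℕ.* q
  R D : ℚ
  R = r (suc m) m
  D = ∑[ e < suc m ] 𝟙 (e ℕ.* q ∣? m) * χ e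
  F G : ℕ → ℚ
  F d = 𝟙 (q ∣? d) * (𝟙 (d ∣? m ℕ.* q) * χ d)
  G d = 𝟙 (q ∣? d) * (𝟙 (d ∣? m) * χ d)
  instance
    q≢0 : ℕ.NonZero q
    q≢0 = ℕ.>-nonZero (prime⇒>0 pq)
  0<mq : 0 ℕ.< m ℕ.* q
  0<mq = ℕ.*-mono-< 0<m (prime⇒>0 pq)
  mq<Y : m ℕ.* q ℕ.< Y
  mq<Y = ℕ.m<n+m (m ℕ.* q) (prime⇒>0 pq)
  m<Y : m ℕ.< Y
  m<Y = ℕ.≤-<-trans (ℕ.m≤m*n m q) mq<Y
  pointwise : ∀ d → 𝟙 (d ∣? m ℕ.* q) * χ d ≡ F d + (𝟙 (d ∣? m) * χ d + (- 1ℚ) * G d)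
  pointwise d with q ∣? d
  ... | yes _  = solve 2 (λ a b → a := con 1ℚ :* a :+ (b :+ (:- con 1ℚ) :* (con 1ℚ :* b))) refl (𝟙 (d ∣? m ℕ.* q) * χ d) (𝟙 (d ∣? m) * χ d)
  ... | no q∤d = trans (cong (_* χ d) (𝟙-cong (d ∣? m ℕ.* q) (d ∣? m)
      (λ h → coprime-divisor (Coprimality.sym (prime∤⇒coprime pq q∤d)) (subst (d ∣_) (ℕ.*-comm m q) h)) (∣m⇒∣m*n q)))
    (solve 2 (λ a b → b := con 0ℚ :* a :+ (b :+ (:- con 1ℚ) :* (con 0ℚ :* b))) refl (𝟙 (d ∣? m ℕ.* q) * χ d) (𝟙 (d ∣? m) * χ d))
  factor-χ : ∀ a e → a * χ (e ℕ.* q) ≡ χ q * (a * χ e)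
  factor-χ a e = trans (cong (a *_) (χ-* e q)) (solve 3 (λ a x y → a :* (x :* y) := y :* (a :* x)) refl a (χ e) (χ q))
  F≡ : ∑ Y F ≡ χ q * R
  F≡ = trans (∑-multiples q (suc m) (λ d → 𝟙 (d ∣? m ℕ.* q) * χ d) (prime⇒>0 pq))
    (trans (∑-cong (suc m) (λ e → trans (cong (_* χ (e ℕ.* q)) (𝟙-cong (e ℕ.* q ∣? m ℕ.* q) (e ∣? m) (*-cancelʳ-∣ q) (*-monoˡ-∣ q)))
      (factor-χ (𝟙 (e ∣? m)) e)))
    (sym (∑-*ˡ (suc m) (χ q) _)))
  G≡ : ∑ Y G ≡ χ q * D
  G≡ = trans (∑-multiples q (suc m) (λ d → 𝟙 (d ∣? m) * χ d) (prime⇒>0 pq))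
    (trans (∑-cong (suc m) (λ e → factor-χ (𝟙 (e ℕ.* q ∣? m)) e)) (sym (∑-*ˡ (suc m) (χ q) _)))

-- If all prime factors are 1 mod 4, every divisor contributes 1. Otherwise take a prime factor q
-- with χ(q) = 0 or -1: the recursion `r-prime*` gives r(k q) = r(k) in the first case, and r(k / q)
-- or 0 in the second, so induction applies without the multiplicativity of r.
r-nonNeg : ∀ m → 0 ℕ.< m → 0ℚ ≤ r (suc m) m
r-nonNeg = <-rec _ step
  where
  step : ∀ m → (∀ {k} → k ℕ.< m → 0 ℕ.< k → 0ℚ ≤ r (suc k) k) → 0 ℕ.< m → 0ℚ ≤ r (suc m) m
  step m rec 0<m with ℕ.anyUpTo? (λ p → prime? p ×-dec ((p ∣? m) ×-dec ¬? (p % 4 ℕ.≟ 1))) (suc m)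
  ... | no none = ∑-nonNeg (suc m) term
    where
    term : ∀ d → 0ℚ ≤ 𝟙 (d ∣? m) * χ d
    term d with d ∣? m
    ... | no  _   = ≤-reflexive (sym (*-zeroˡ (χ d)))
    ... | yes d∣m = subst (λ t → 0ℚ ≤ 1ℚ * t) (sym (χ≡1 d (ℕ.>-nonZero⁻¹ d {{d≢0}}) primes≡1)) 0≤1
      where
      d≢0 : ℕ.NonZero d
      d≢0 = ℕ.≢-nonZero λ { refl → ℕ.<⇒≢ 0<m (sym (0∣⇒≡0 d∣m)) }
      primes≡1 : ∀ p → Prime p → p ∣ d → p % 4 ≡ 1
      primes≡1 p pp p∣d with p % 4 ℕ.≟ 1
      ... | yes h = h
      ... | no  h = contradiction (p , s≤s (∣⇒≤ {{ℕ.>-nonZero 0<m}} (∣-trans p∣d d∣m)) , pp , ∣-trans p∣d d∣m , h) none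
  ... | yes (q , _ , pq , divides zero refl , _) = contradiction 0<m (ℕ.<-irrefl refl)
  ... | yes (q , _ , pq , divides k@(suc _) refl , q≢1) with q % 4 ℕ.≟ 3
  ...   | no q≢3 = subst (0ℚ ≤_) (sym (trans (r-prime* q k pq (s≤s z≤n)) (trans
            (cong (λ c → (1ℚ + c) * r (suc k) k - c * E) (χ-even q q≢1 q≢3))
            (solve 2 (λ R E → (con 1ℚ :+ con 0ℚ) :* R :- con 0ℚ :* E := R) refl (r (suc k) k) E))))
          (rec (ℕ.m<m*n k q (prime⇒>1 pq)) (s≤s z≤n))
    where
    E : ℚ
    E = ∑[ e < suc k ] 𝟙 (e ℕ.* q ∣? k) * χ e
  ...   | yes q≡3 = subst (0ℚ ≤_) (sym (trans (r-prime* q k pq (s≤s z≤n)) (trans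
            (cong (λ c → (1ℚ + c) * r (suc k) k - c * E) (χ-3mod4 q q≡3))
            (solve 2 (λ R E → (con 1ℚ :+ (:- con 1ℚ)) :* R :- (:- con 1ℚ) :* E := E) refl (r (suc k) k) E))))
          (E-nonNeg (q ∣? k))
    where
    E : ℚ
    E = ∑[ e < suc k ] 𝟙 (e ℕ.* q ∣? k) * χ e
    E-nonNeg : Dec (q ∣ k) → 0ℚ ≤ E
    E-nonNeg (no q∤k) = ≤-reflexive (sym (∑-zero (suc k) (λ e _ → trans
      (cong (_* χ e) (𝟙-no (e ℕ.* q ∣? k) (λ h → q∤k (∣-trans (n∣m*n e) h)))) (*-zeroˡ (χ e)))))
    E-nonNeg (yes (divides zero ()))
    E-nonNeg (yes (divides k′@(suc _) eq)) = subst (0ℚ ≤_) (sym E≡)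
        (rec (ℕ.≤-<-trans k′≤k (ℕ.m<m*n k q (prime⇒>1 pq))) (s≤s z≤n))
      where
      instance
        q≢0 : ℕ.NonZero q
        q≢0 = ℕ.>-nonZero (prime⇒>0 pq)
      k′≤k : k′ ℕ.≤ k
      k′≤k = subst (k′ ℕ.≤_) (sym eq) (ℕ.m≤m*n k′ q)
      E≡ : E ≡ r (suc k′) k′
      E≡ = trans (∑-cong (suc k) (λ e → cong (_* χ e) (𝟙-cong (e ℕ.* q ∣? k) (e ∣? k′)
             (λ h → *-cancelʳ-∣ q (subst (e ℕ.* q ∣_) eq h)) (λ h → subst (e ℕ.* q ∣_) (sym eq) (*-monoˡ-∣ q h)))))
           (r-bound (s≤s z≤n) (s≤s k′≤k))

-- Harmonic sums over restricted squarefree numbers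

One Three NotThree : ℕ → Set
One      p = p % 4 ≡ 1
Three    p = p % 4 ≡ 3
NotThree p = p % 4 ≢ 3

one? : ∀ n → Dec (SF One n)
one? = SF? (λ p → p % 4 ℕ.≟ 1)

notThree? : ∀ n → Dec (SF NotThree n)
notThree? = SF? (λ p → ¬? (p % 4 ℕ.≟ 3))

H S₁ Sₐ : ℕ → ℚ
H  x = ∑[ e < x ] inv e
S₁ x = ∑[ k < suc x ] 𝟙 (one? k) * inv k
Sₐ x = ∑[ k < suc x ] 𝟙 (notThree? k) * inv k

0≤term : ∀ {P : Set} (p? : Dec P) k → 0ℚ ≤ 𝟙 p? * inv k
0≤term p? k = 0≤* (0≤𝟙 p?) (0≤inv k)

χ-at : ∀ i j → χ (i ℕ.+ j ℕ.* 4) ≡ χ i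
χ-at i j = cong χ-residue (ℕ.[m+kn]%n≡m%n i j 4)

-- Partial sums of 1 - 1/3 + 1/5 - ..., the value of the L-series of χ at 1.
ℓ : ℕ → ℚ
ℓ T = ∑[ d < T ] χ d * inv d

ℓ-block : ∀ j → let b = suc (j ℕ.* 4) in
  ℓ (suc b) ≡ ℓ b + inv b × ℓ (2 ℕ.+ b) ≡ ℓ b + inv b × ℓ (3 ℕ.+ b) ≡ ℓ b + inv b - inv (2 ℕ.+ b) ×
  ℓ (4 ℕ.+ b) ≡ ℓ b + inv b - inv (2 ℕ.+ b)
ℓ-block j = e₁ , e₂ , e₃ , trans (cong₂ (λ s t → s + t * inv (3 ℕ.+ b)) e₃ (χ-at 4 j))
                                (solve 2 (λ s t → s :+ con 0ℚ :* t := s) refl (ℓ b + inv b - inv (2 ℕ.+ b)) (inv (3 ℕ.+ b)))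
  where
  b : ℕ
  b = suc (j ℕ.* 4)
  e₁ : ℓ (suc b) ≡ ℓ b + inv b
  e₁ = trans (cong (λ t → ℓ b + t * inv b) (χ-at 1 j)) (cong (λ t → ℓ b + t) (*-identityˡ (inv b)))
  e₂ : ℓ (2 ℕ.+ b) ≡ ℓ b + inv b
  e₂ = trans (cong₂ (λ s t → s + t * inv (suc b)) e₁ (χ-at 2 j))
         (solve 2 (λ s t → s :+ con 0ℚ :* t := s) refl (ℓ b + inv b) (inv (suc b)))
  e₃ : ℓ (3 ℕ.+ b) ≡ ℓ b + inv b - inv (2 ℕ.+ b)
  e₃ = trans (cong₂ (λ s t → s + t * inv (2 ℕ.+ b)) e₂ (χ-at 3 j))
         (solve 2 (λ s t → s :+ (:- con 1ℚ) :* t := s :- t) refl (ℓ b + inv b) (inv (2 ℕ.+ b)))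

-- The next positive term belongs to the invariant: passing to the next block of four removes 1/(4j
-- + 3) and adds the smaller 1/(4j + 5), so the quantity only decreases from its initial value 1.
ℓ-aligned : ∀ j → ℓ (suc (j ℕ.* 4)) + inv (suc (j ℕ.* 4)) ≤ 1ℚ
ℓ-aligned zero    = ≤-reflexive (trans (cong₂ (λ s t → 0ℚ + 0ℚ * s + t) inv-0 inv-1) refl)
ℓ-aligned (suc j) = let _ , _ , _ , e = ℓ-block j in
  ≤-trans (≤-reflexive (cong (_+ inv (4 ℕ.+ b)) e))
  (≤-trans (+-monoʳ-≤ (ℓ b + inv b - inv (2 ℕ.+ b)) (inv-anti {2 ℕ.+ b} (s≤s z≤n) (ℕ.m≤n+m (2 ℕ.+ b) 2)))
  (≤-trans (≤-reflexive (solve 2 (λ s t → s :- t :+ t := s) refl (ℓ b + inv b) (inv (2 ℕ.+ b)))) (ℓ-aligned j)))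
  where
  b : ℕ
  b = suc (j ℕ.* 4)

ℓ≤1 : ∀ T → ℓ T ≤ 1ℚ
ℓ≤1 zero    = 0≤1
ℓ≤1 (suc T) = subst (λ t → ℓ (suc t) ≤ 1ℚ) (sym (ℕ.m≡m%n+[m/n]*n T 4)) (cases (T % 4) (ℕ.m%n<n T 4))
  where
  j b : ℕ
  j = T ℕ./ 4
  b = suc (j ℕ.* 4)
  drop : ∀ {s} k → s ≡ ℓ b + inv b - inv k → s ≤ 1ℚ
  drop k refl = ≤-trans (≤-by (inv k) (0≤inv k) (solve 2 (λ s t → s := s :- t :+ t) refl (ℓ b + inv b) (inv k))) (ℓ-aligned j)
  cases : ∀ i → i ℕ.< 4 → ℓ (suc (i ℕ.+ j ℕ.* 4)) ≤ 1ℚ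
  cases 0 _ = ≤-trans (≤-+ʳ (0≤inv b)) (ℓ-aligned j)
  cases 1 _ = ≤-trans (≤-reflexive (proj₁ (ℓ-block j))) (ℓ-aligned j)
  cases 2 _ = ≤-trans (≤-reflexive (proj₁ (proj₂ (ℓ-block j)))) (ℓ-aligned j)
  cases 3 _ = drop (2 ℕ.+ b) (proj₁ (proj₂ (proj₂ (ℓ-block j))))
  cases (suc (suc (suc (suc _)))) (s≤s (s≤s (s≤s (s≤s ()))))

-- As χ changes sign, the condition d e < Y cannot simply be dropped from a sum over d. Being
-- downward closed, it cuts out a partial sum, to which `ℓ≤1` applies.
∑-initial : ∀ {P : ℕ → Set} (P? : ∀ d → Dec (P d)) → (∀ {d e} → d ℕ.≤ e → P e → P d) →
  ∀ (f : ℕ → ℚ) Y → ∃ λ T → ∑[ d < Y ] 𝟙 (P? d) * f d ≡ ∑ T f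
∑-initial P? down f zero = 0 , refl
∑-initial P? down f (suc Y) with P? Y
... | no  _  = let T , e = ∑-initial P? down f Y in T , trans (cong₂ _+_ e (*-zeroˡ (f Y))) (+-identityʳ (∑ T f))
... | yes PY = suc Y , cong₂ _+_
        (∑-cong< Y (λ d d<Y → trans (cong (_* f d) (𝟙-yes (P? d) (down (ℕ.<⇒≤ d<Y) PY))) (*-identityˡ (f d))))
        (*-identityˡ (f Y))

-- Opening the divisor sums yields ∑ χ(d) / (d e) over d e < Y. For fixed e, the sum over d is 1/e
-- times a partial sum `ℓ T`, hence at most 1/e.
∑r≤H : ∀ Y → ∑[ m < Y ] r Y m * inv m ≤ H Y
∑r≤H Y = begin
  ∑[ m < Y ] r Y m * inv m
    ≡⟨ ∑-cong< Y expand ⟩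
  ∑[ m < Y ] ∑[ d < Y ] ∑[ e < Y ] 𝟙 (d ℕ.* e ℕ.≟ m) * g d e
    ≡⟨ ∑-swap Y Y _ ⟩
  ∑[ d < Y ] ∑[ m < Y ] ∑[ e < Y ] 𝟙 (d ℕ.* e ℕ.≟ m) * g d e
    ≡⟨ ∑-cong Y (λ d → ∑-swap Y Y _) ⟩
  ∑[ d < Y ] ∑[ e < Y ] ∑[ m < Y ] 𝟙 (d ℕ.* e ℕ.≟ m) * g d e
    ≡⟨ ∑-cong Y (λ d → ∑-cong Y (λ e → collapse d e)) ⟩
  ∑[ d < Y ] ∑[ e < Y ] 𝟙 (d ℕ.* e ℕ.<? Y) * g d e
    ≡⟨ ∑-swap Y Y _ ⟩
  ∑[ e < Y ] ∑[ d < Y ] 𝟙 (d ℕ.* e ℕ.<? Y) * g d e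
    ≤⟨ ∑-mono Y (λ e _ → inner e) ⟩
  H Y ∎
  where
  open ≤-Reasoning
  g : ℕ → ℕ → ℚ
  g d e = χ d * inv d * inv e
  collapse : ∀ d e → ∑[ m < Y ] 𝟙 (d ℕ.* e ℕ.≟ m) * g d e ≡ 𝟙 (d ℕ.* e ℕ.<? Y) * g d e
  collapse d e with d ℕ.* e ℕ.<? Y
  ... | yes h = trans (∑-δ Y (λ _ → g d e) h) (sym (*-identityˡ (g d e)))
  ... | no  h = trans (∑-δ-out Y (d ℕ.* e) (λ _ → g d e) (ℕ.≮⇒≥ h)) (sym (*-zeroˡ (g d e)))
  inner : ∀ e → ∑[ d < Y ] 𝟙 (d ℕ.* e ℕ.<? Y) * g d e ≤ inv e
  inner e = let T , eq = ∑-initial (λ d → d ℕ.* e ℕ.<? Y) (λ d≤d′ h → ℕ.≤-<-trans (ℕ.*-monoˡ-≤ e d≤d′) h) (λ d → χ d * inv d) Y in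
    ≤-trans (≤-reflexive (trans (∑-cong Y (λ d → sym (*-assoc (𝟙 (d ℕ.* e ℕ.<? Y)) (χ d * inv d) (inv e))))
      (trans (sym (∑-*ʳ Y (inv e) _)) (cong (_* inv e) eq))))
    (≤-trans (*-monoʳ (0≤inv e) (ℓ≤1 T)) (≤-reflexive (*-identityˡ (inv e))))
  expand : ∀ m → m ℕ.< Y → r Y m * inv m ≡ ∑[ d < Y ] ∑[ e < Y ] 𝟙 (d ℕ.* e ℕ.≟ m) * g d e
  expand zero _ = trans (cong (r Y 0 *_) inv-0) (trans (*-zeroʳ (r Y 0)) (sym (∑-zero Y (λ d _ → ∑-zero Y (λ e _ → zero-term d e)))))
    where
    zero-term : ∀ d e → 𝟙 (d ℕ.* e ℕ.≟ 0) * g d e ≡ 0ℚ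
    zero-term d e with d ℕ.* e ℕ.≟ 0
    ... | no  _ = *-zeroˡ (g d e)
    ... | yes h with ℕ.m*n≡0⇒m≡0∨n≡0 d h
    ...   | inj₁ refl = trans (*-identityˡ (g 0 e)) (trans (cong (λ t → 0ℚ * t * inv e) inv-0) (*-zeroˡ (inv e)))
    ...   | inj₂ refl = trans (*-identityˡ (g d 0)) (trans (cong (χ d * inv d *_) inv-0) (*-zeroʳ (χ d * inv d)))
  expand m@(suc _) m<Y = trans (∑-*ʳ Y (inv m) _) (∑-cong Y term)
    where
    term : ∀ d → 𝟙 (d ∣? m) * χ d * inv m ≡ ∑[ e < Y ] 𝟙 (d ℕ.* e ℕ.≟ m) * g d e
    term d with d ∣? m
    ... | no d∤m = trans (cong (_* inv m) (*-zeroˡ (χ d))) (trans (*-zeroˡ (inv m)) (sym (∑-zero Y (λ e _ →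
            trans (cong (_* g d e) (𝟙-no (d ℕ.* e ℕ.≟ m) (λ h → d∤m (subst (d ∣_) h (m∣m*n e))))) (*-zeroˡ (g d e))))))
    ... | yes (divides k eq) = trans (trans (cong (_* inv m) (*-identityˡ (χ d)))
            (trans (cong (χ d *_) (trans (cong inv (trans eq (ℕ.*-comm k d))) (inv-* d k))) (sym (*-assoc (χ d) (inv d) (inv k)))))
          (sym (trans (∑-cong Y (λ e → cong (_* g d e) (𝟙-cong (d ℕ.* e ℕ.≟ m) (k ℕ.≟ e)
              (λ h → ℕ.*-cancelˡ-≡ k e d {{d≢0}} (trans (ℕ.*-comm d k) (trans (sym eq) (sym h))))
              (λ { refl → trans (ℕ.*-comm d k) (sym eq) })))) (∑-δ Y (g d) k<Y)))
      where
      d≢0 : ℕ.NonZero d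
      d≢0 = ℕ.≢-nonZero λ { refl → contradiction (trans eq (ℕ.*-zeroʳ k)) λ () }
      k<Y : k ℕ.< Y
      k<Y = ℕ.≤-<-trans (ℕ.≤-trans (ℕ.m≤m*n k d {{d≢0}}) (ℕ.≤-reflexive (sym eq))) m<Y

-- If some prime factor of m is not 1 mod 4, no pair contributes and `r-nonNeg` suffices. Otherwise
-- χ is 1 on all divisors of m, and k determines l.
convolution≤r : ∀ n Y m → n ℕ.≤ Y → 0 ℕ.< m → m ℕ.< Y →
  ∑[ k < n ] ∑[ l < n ] 𝟙 (k ℕ.* l ℕ.≟ m) * (𝟙 (one? k) * 𝟙 (one? l)) ≤ r Y m
convolution≤r n Y m n≤Y 0<m m<Y with ℕ.anyUpTo? (λ p → prime? p ×-dec ((p ∣? m) ×-dec ¬? (p % 4 ℕ.≟ 1))) (suc m)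
... | yes (p , _ , pp , p∣m , p≢1) = ≤-trans
    (≤-reflexive (∑-zero n (λ k _ → ∑-zero n (λ l _ → vanish k l))))
    (subst (0ℚ ≤_) (sym (r-bound 0<m m<Y)) (r-nonNeg m 0<m))
  where
  vanish : ∀ k l → 𝟙 (k ℕ.* l ℕ.≟ m) * (𝟙 (one? k) * 𝟙 (one? l)) ≡ 0ℚ
  vanish k l with k ℕ.* l ℕ.≟ m | one? k | one? l
  ... | no _    | k? | l?   = *-zeroˡ (𝟙 k? * 𝟙 l?)
  ... | yes _   | no _ | l? = trans (*-identityˡ (0ℚ * 𝟙 l?)) (*-zeroˡ (𝟙 l?))
  ... | yes _   | yes _ | no _ = refl
  ... | yes refl | yes sk | yes sl with euclidsLemma k l pp p∣m
  ...   | inj₁ h = contradiction (primes sk p pp h) p≢1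
  ...   | inj₂ h = contradiction (primes sl p pp h) p≢1
... | no none = ≤-trans (∑-mono n (λ k _ → bound k)) (∑-range (λ d → 𝟙 (d ∣? m) * χ d) 0≤ n≤Y)
  where
  primes≡1 : ∀ d → d ∣ m → ∀ p → Prime p → p ∣ d → p % 4 ≡ 1
  primes≡1 d d∣m p pp p∣d with p % 4 ℕ.≟ 1
  ... | yes h = h
  ... | no  h = contradiction (p , s≤s (∣⇒≤ {{ℕ.>-nonZero 0<m}} (∣-trans p∣d d∣m)) , pp , ∣-trans p∣d d∣m , h) none
  d≢0 : ∀ {d} → d ∣ m → ℕ.NonZero d
  d≢0 d∣m = ℕ.≢-nonZero λ { refl → ℕ.<⇒≢ 0<m (sym (0∣⇒≡0 d∣m)) }
  value : ∀ d → d ∣ m → 1ℚ * χ d ≡ 1ℚ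
  value d d∣m = cong (1ℚ *_) (χ≡1 d (ℕ.>-nonZero⁻¹ d {{d≢0 d∣m}}) (primes≡1 d d∣m))
  0≤ : ∀ d → 0ℚ ≤ 𝟙 (d ∣? m) * χ d
  0≤ d with d ∣? m
  ... | no  _   = ≤-reflexive (sym (*-zeroˡ (χ d)))
  ... | yes d∣m = subst (0ℚ ≤_) (sym (value d d∣m)) 0≤1
  bound : ∀ k → ∑[ l < n ] 𝟙 (k ℕ.* l ℕ.≟ m) * (𝟙 (one? k) * 𝟙 (one? l)) ≤ 𝟙 (k ∣? m) * χ k
  bound k with k ∣? m
  ... | no k∤m = ≤-reflexive (trans (∑-zero n (λ l _ → trans (cong (_* (𝟙 (one? k) * 𝟙 (one? l)))
          (𝟙-no (k ℕ.* l ℕ.≟ m) (λ h → k∤m (subst (k ∣_) h (m∣m*n l))))) (*-zeroˡ (𝟙 (one? k) * 𝟙 (one? l))))) (sym (*-zeroˡ (χ k))))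
  ... | yes k∣m@(divides e eq) = ≤-trans (∑-mono n (λ l _ → *-mono-nonNeg (0≤𝟙 (k ℕ.* l ℕ.≟ m)) (0≤* (0≤𝟙 (one? k)) (0≤𝟙 (one? l)))
            (𝟙-mono (k ℕ.* l ℕ.≟ m) (e ℕ.≟ l) (λ h → ℕ.*-cancelˡ-≡ e l k {{d≢0 k∣m}} (trans (ℕ.*-comm k e) (trans (sym eq) (sym h)))))
            (≤-trans (*-mono-nonNeg (0≤𝟙 (one? k)) (0≤𝟙 (one? l)) (𝟙≤1 (one? k)) (𝟙≤1 (one? l))) (≤-reflexive (*-identityˡ 1ℚ)))))
          (≤-trans (∑-δ-const n e 1ℚ 0≤1) (≤-reflexive (sym (value k k∣m))))

-- Expand the square and group the pairs (k, l) by their product m ≤ x²; the resulting coefficients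
-- are those compared with r in `convolution≤r`.
S₁²≤H : ∀ x → S₁ x * S₁ x ≤ H (suc (x ℕ.* x))
S₁²≤H zero = ≤-reflexive (trans (cong₂ _*_ S₁0 S₁0) (trans (*-zeroˡ 0ℚ) (sym (trans (cong (λ t → 0ℚ + t) inv-0) (+-identityˡ 0ℚ)))))
  where
  S₁0 : S₁ 0 ≡ 0ℚ
  S₁0 = trans (cong (λ t → 0ℚ + 𝟙 (one? 0) * t) inv-0) (trans (+-identityˡ (𝟙 (one? 0) * 0ℚ)) (*-zeroʳ (𝟙 (one? 0))))
S₁²≤H x@(suc _) = begin
  S₁ x * S₁ x
    ≡⟨ ∑-*ʳ n (S₁ x) _ ⟩
  ∑[ k < n ] a k * S₁ x
    ≡⟨ ∑-cong n (λ k → ∑-*ˡ n (a k) a) ⟩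
  ∑[ k < n ] ∑[ l < n ] a k * a l
    ≡⟨ ∑-cong< n (λ k k<n → ∑-cong< n (λ l l<n → spread k l k<n l<n)) ⟩
  ∑[ k < n ] ∑[ l < n ] ∑[ m < Y ] 𝟙 (k ℕ.* l ℕ.≟ m) * (𝟙 (one? k) * 𝟙 (one? l) * inv m)
    ≡⟨ ∑-cong n (λ k → ∑-swap n Y _) ⟩
  ∑[ k < n ] ∑[ m < Y ] ∑[ l < n ] 𝟙 (k ℕ.* l ℕ.≟ m) * (𝟙 (one? k) * 𝟙 (one? l) * inv m)
    ≡⟨ ∑-swap n Y _ ⟩
  ∑[ m < Y ] ∑[ k < n ] ∑[ l < n ] 𝟙 (k ℕ.* l ℕ.≟ m) * (𝟙 (one? k) * 𝟙 (one? l) * inv m)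
    ≡⟨ ∑-cong Y pull ⟩
  ∑[ m < Y ] conv m * inv m
    ≤⟨ ∑-mono Y compare ⟩
  ∑[ m < Y ] r Y m * inv m
    ≤⟨ ∑r≤H Y ⟩
  H Y ∎
  where
  open ≤-Reasoning
  n Y : ℕ
  n = suc x
  Y = suc (x ℕ.* x)
  a : ℕ → ℚ
  a k = 𝟙 (one? k) * inv k
  conv : ℕ → ℚ
  conv m = ∑[ k < n ] ∑[ l < n ] 𝟙 (k ℕ.* l ℕ.≟ m) * (𝟙 (one? k) * 𝟙 (one? l))
  spread : ∀ k l → k ℕ.< n → l ℕ.< n → a k * a l ≡ ∑[ m < Y ] 𝟙 (k ℕ.* l ℕ.≟ m) * (𝟙 (one? k) * 𝟙 (one? l) * inv m)
  spread k l k<n l<n = sym (trans (∑-δ Y (λ m → 𝟙 (one? k) * 𝟙 (one? l) * inv m) (s≤s (ℕ.*-mono-≤ (ℕ.s≤s⁻¹ k<n) (ℕ.s≤s⁻¹ l<n))))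
    (trans (cong (𝟙 (one? k) * 𝟙 (one? l) *_) (inv-* k l))
      (solve 4 (λ p q u v → p :* q :* (u :* v) := p :* u :* (q :* v)) refl (𝟙 (one? k)) (𝟙 (one? l)) (inv k) (inv l))))
  pull : ∀ m → ∑[ k < n ] ∑[ l < n ] 𝟙 (k ℕ.* l ℕ.≟ m) * (𝟙 (one? k) * 𝟙 (one? l) * inv m) ≡ conv m * inv m
  pull m = sym (trans (∑-*ʳ n (inv m) _) (∑-cong n (λ k → trans (∑-*ʳ n (inv m) _)
    (∑-cong n (λ l → *-assoc (𝟙 (k ℕ.* l ℕ.≟ m)) (𝟙 (one? k) * 𝟙 (one? l)) (inv m))))))
  compare : ∀ m → m ℕ.< Y → conv m * inv m ≤ r Y m * inv m
  compare zero    _   = ≤-reflexive (trans (cong (conv 0 *_) inv-0) (trans (*-zeroʳ (conv 0)) (sym (trans (cong (r Y 0 *_) inv-0) (*-zeroʳ (r Y 0))))))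
  compare (suc m) m<Y = *-monoʳ (0≤inv (suc m)) (convolution≤r n Y (suc m) (s≤s (ℕ.m≤m*n x x)) (s≤s z≤n) m<Y)

-- Logarithmic bounds

∑-𝟙≥ : ∀ {P : ℕ → Set} (P? : ∀ t → Dec (P t)) n T → n ℕ.≤ T → (∀ {t} → t ℕ.< n → P t) → ι n ≤ ∑[ t < T ] 𝟙 (P? t)
∑-𝟙≥ P? n T n≤T h = ≤-trans
  (≤-reflexive (sym (trans (∑-cong< n (λ t t<n → 𝟙-yes (P? t) (h t<n))) (trans (∑-const n 1ℚ) (*-identityʳ (ι n))))))
  (∑-range (λ t → 𝟙 (P? t)) (λ t → 0≤𝟙 (P? t)) n≤T)

count-≤ : ∀ {P : ℕ → Set} (P? : ∀ t → Dec (P t)) N {n x} → 0 ℕ.< n → (∀ {a} → P a → 0 ℕ.< a × a ℕ.* n ℕ.≤ x) →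
  ∑[ a < N ] 𝟙 (P? a) ≤ ι x * inv n
count-≤ {P} P? N {n} {x} 0<n h = begin
  ∑[ a < N ] 𝟙 (P? a)
    ≤⟨ ∑-cover N (λ a → 𝟙 (P? a)) (x ℕ./ n) suc (λ _ → 1ℚ) (λ _ → 0≤1) (λ a _ → cover a) ⟩
  ∑[ i < x ℕ./ n ] 1ℚ
    ≡⟨ trans (∑-const (x ℕ./ n) 1ℚ) (*-identityʳ (ι (x ℕ./ n))) ⟩
  ι (x ℕ./ n)
    ≤⟨ ι≤*inv 0<n (ℕ.m/n*n≤m x n) ⟩
  ι x * inv n ∎
  where
  open ≤-Reasoning
  instance
    n≢0 : ℕ.NonZero n
    n≢0 = ℕ.>-nonZero 0<n
  cover : ∀ a → 𝟙 (P? a) ≤ 0ℚ ⊎ ∃ λ i → i ℕ.< x ℕ./ n × suc i ≡ a × 𝟙 (P? a) ≤ 1ℚ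
  cover a with P? a
  ... | no  _  = inj₁ ≤-refl
  ... | yes Pa with a | h Pa
  ...   | suc i | _ , an≤x = inj₂ (i , subst (ℕ._≤ x ℕ./ n) (ℕ.m*n/n≡m (suc i) n) (ℕ./-monoˡ-≤ n an≤x) , refl , ≤-refl)

H-upper : ∀ l → H (2 ^ l) ≤ ι l
H-upper zero    = ≤-reflexive (trans (+-identityˡ (inv 0)) (trans inv-0 (sym ι-0)))
H-upper (suc l) = begin
  H (p ℕ.+ (p ℕ.+ 0))
    ≡⟨ cong (λ t → H (p ℕ.+ t)) (ℕ.+-identityʳ p) ⟩
  H (p ℕ.+ p)
    ≡⟨ ∑-split p p inv ⟩
  H p + (∑[ i < p ] inv (p ℕ.+ i))
    ≤⟨ +-mono-≤ (H-upper l) (∑-mono p (λ i _ → inv-anti 0<p (ℕ.m≤m+n p i))) ⟩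
  ι l + (∑[ i < p ] inv p)
    ≡⟨ cong (λ t → ι l + t) (trans (∑-const p (inv p)) (ι*inv 0<p)) ⟩
  ι l + 1ℚ
    ≡⟨ trans (+-comm (ι l) 1ℚ) (sym (ι-suc l)) ⟩
  ι (suc l) ∎
  where
  open ≤-Reasoning
  p : ℕ
  p = 2 ^ l
  0<p : 0 ℕ.< p
  0<p = ℕ.m^n>0 2 l

H-lower : ∀ l → ι l * inv 2 ≤ H (2 ^ l)
H-lower zero    = ≤-trans (≤-reflexive (trans (cong (_* inv 2) ι-0) (*-zeroˡ (inv 2)))) (∑-nonNeg 1 0≤inv)
H-lower (suc l) = begin
  ι (suc l) * inv 2
    ≡⟨ trans (cong (_* inv 2) (ι-suc l)) (solve 2 (λ a b → (con 1ℚ :+ a) :* b := a :* b :+ b) refl (ι l) (inv 2)) ⟩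
  ι l * inv 2 + inv 2
    ≡⟨ cong (λ t → ι l * inv 2 + t) half ⟩
  ι l * inv 2 + ι p * inv (2 ℕ.* p)
    ≤⟨ +-mono-≤ (H-lower l) (≤-trans (≤-reflexive (sym (∑-const p (inv (2 ℕ.* p)))))
         (∑-mono p (λ i i<p → inv-anti (ℕ.≤-trans 0<p (ℕ.m≤m+n p i))
           (ℕ.+-monoʳ-≤ p (ℕ.≤-trans (ℕ.<⇒≤ i<p) (ℕ.m≤m+n p 0)))))) ⟩
  H p + (∑[ i < p ] inv (p ℕ.+ i))
    ≡⟨ ∑-split p p inv ⟨
  H (p ℕ.+ p)
    ≡⟨ cong (λ t → H (p ℕ.+ t)) (ℕ.+-identityʳ p) ⟨
  H (p ℕ.+ (p ℕ.+ 0)) ∎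
  where
  open ≤-Reasoning
  p : ℕ
  p = 2 ^ l
  0<p : 0 ℕ.< p
  0<p = ℕ.m^n>0 2 l
  half : inv 2 ≡ ι p * inv (2 ℕ.* p)
  half = sym (trans (cong (ι p *_) (inv-* 2 p)) (trans (solve 3 (λ a b c → a :* (b :* c) := b :* (a :* c)) refl (ι p) (inv 2) (inv p))
    (trans (cong (inv 2 *_) (ι*inv 0<p)) (*-identityʳ (inv 2)))))

-- The numbers in question are k and 2k with all prime factors of k congruent to 1 mod 4; the
-- reciprocal of 2k is estimated by that of k, whence the factor 2.
Sₐ≤2S₁ : ∀ x → Sₐ x ≤ ι 2 * S₁ x
Sₐ≤2S₁ x = begin
  Sₐ x
    ≤⟨ ∑-cover₂ (suc x) _ 2 (suc x) (λ i k → suc i ℕ.* k)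
         (λ i k → 𝟙 (one? k) * inv k) (λ i k → 0≤term (one? k) k) cover ⟩
  ∑[ i < 2 ] S₁ x
    ≡⟨ ∑-const 2 (S₁ x) ⟩
  ι 2 * S₁ x ∎
  where
  open ≤-Reasoning
  even : ∀ p c → p ≡ 2 ℕ.+ c ℕ.* 4 → 2 ∣ p
  even p c refl = divides (1 ℕ.+ c ℕ.* 2) (form c)
    where
    form : ∀ c → 2 ℕ.+ c ℕ.* 4 ≡ (1 ℕ.+ c ℕ.* 2) ℕ.* 2
    form = solve-∀
  even₀ : ∀ p c → p ≡ c ℕ.* 4 → 2 ∣ p
  even₀ p c refl = divides (c ℕ.* 2) (form c)
    where
    form : ∀ c → c ℕ.* 4 ≡ c ℕ.* 2 ℕ.* 2
    form = solve-∀
  odd-part : ∀ {k} → ¬ 2 ∣ k → SF NotThree k → SF One k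
  odd-part {k} 2∤k = SF-⊆ one
    where
    one : ∀ {p} → Prime p → p ∣ k → NotThree p → One p
    one {p} pp p∣k p≢3 with %4-cases p
    ... | inj₁ h = contradiction (∣-trans (even₀ p (p ℕ./ 4) (trans (ℕ.m≡m%n+[m/n]*n p 4) (cong (ℕ._+ p ℕ./ 4 ℕ.* 4) h))) p∣k) 2∤k
    ... | inj₂ (inj₁ h) = h
    ... | inj₂ (inj₂ (inj₁ h)) = contradiction (∣-trans (even p (p ℕ./ 4) (trans (ℕ.m≡m%n+[m/n]*n p 4) (cong (ℕ._+ p ℕ./ 4 ℕ.* 4) h))) p∣k) 2∤k
    ... | inj₂ (inj₂ (inj₂ h)) = contradiction h p≢3
  bound : ∀ m k → 0 ℕ.< k → k ℕ.≤ m → SF One k → 1ℚ * inv m ≤ 𝟙 (one? k) * inv k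
  bound m k 0<k k≤m sk = subst (λ t → 1ℚ * inv m ≤ t * inv k) (sym (𝟙-yes (one? k) sk)) (*-monoˡ 0≤1 (inv-anti 0<k k≤m))
  cover : ∀ m → m ℕ.< suc x → 𝟙 (notThree? m) * inv m ≤ 0ℚ ⊎
    ∃ λ i → ∃ λ k → i ℕ.< 2 × k ℕ.< suc x × suc i ℕ.* k ≡ m × 𝟙 (notThree? m) * inv m ≤ 𝟙 (one? k) * inv k
  cover m m<x with notThree? m
  ... | no _ = inj₁ (≤-reflexive (*-zeroˡ (inv m)))
  ... | yes sm with 2 ∣? m
  ...   | no 2∤m = inj₂ (0 , m , s≤s z≤n , m<x , ℕ.+-identityʳ m , bound m m (SF⇒>0 sm) ℕ.≤-refl (odd-part 2∤m sm))
  ...   | yes (divides k refl) = inj₂ (1 , k , s≤s (s≤s z≤n) , ℕ.≤-<-trans k≤m m<x , ℕ.*-comm 2 k ,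
            bound (k ℕ.* 2) k (SF⇒>0 (SF-∣ (m∣m*n 2) sm)) k≤m
              (odd-part (SF-uncons prime[2] (subst (SF NotThree) (ℕ.*-comm k 2) sm)) (SF-∣ (m∣m*n 2) sm)))
    where
    k≤m : k ℕ.≤ k ℕ.* 2
    k≤m = ℕ.m≤m*n k 2

Sₐ-nonNeg : ∀ x → 0ℚ ≤ Sₐ x
Sₐ-nonNeg x = ∑-nonNeg (suc x) (λ k → 0≤term (notThree? k) k)

Sₐ-mono : ∀ {x y} → x ℕ.≤ y → Sₐ x ≤ Sₐ y
Sₐ-mono x≤y = ∑-range (λ k → 𝟙 (notThree? k) * inv k) (λ k → 0≤term (notThree? k) k) (s≤s x≤y)

1≤Sₐ : ∀ {x} → 0 ℕ.< x → 1ℚ ≤ Sₐ x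
1≤Sₐ {x} 0<x = ≤-trans (≤-reflexive (sym (cong₂ _*_ (𝟙-yes (notThree? 1) SF-1) inv-1)))
  (∑-term (suc x) _ (λ k → 0≤term (notThree? k) k) (s≤s 0<x))

Sₐ²≤ : ∀ x → Sₐ x * Sₐ x ≤ ι (8 ℕ.* len x)
Sₐ²≤ x = begin
  Sₐ x * Sₐ x
    ≤⟨ *-mono-nonNeg (Sₐ-nonNeg x) (Sₐ-nonNeg x) (Sₐ≤2S₁ x) (Sₐ≤2S₁ x) ⟩
  ι 2 * S₁ x * (ι 2 * S₁ x)
    ≡⟨ solve 2 (λ a s → a :* s :* (a :* s) := a :* a :* (s :* s)) refl (ι 2) (S₁ x) ⟩
  ι 2 * ι 2 * (S₁ x * S₁ x)
    ≤⟨ *-monoˡ (0≤* (0≤ι 2) (0≤ι 2)) (≤-trans (S₁²≤H x) (≤-trans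
         (∑-range inv 0≤inv (subst (x ℕ.* x ℕ.<_) (sym (ℕ.^-distribˡ-+-* 2 L L)) (ℕ.*-mono-< (n<2^len x) (n<2^len x))))
         (H-upper (L ℕ.+ L)))) ⟩
  ι 2 * ι 2 * ι (L ℕ.+ L)
    ≡⟨ trans (cong (_* ι (L ℕ.+ L)) (sym (ι-* 2 2))) (trans (sym (ι-* 4 (L ℕ.+ L))) (cong ι (form L))) ⟩
  ι (8 ℕ.* L) ∎
  where
  open ≤-Reasoning
  L : ℕ
  L = len x
  form : ∀ L → 4 ℕ.* (L ℕ.+ L) ≡ 8 ℕ.* L
  form = solve-∀

-- Sums of inverse squares and inverse powers of two

sq : ℕ → ℕ
sq i = suc i ℕ.* suc i

inv-telescope : ∀ n → 0 ℕ.< n → inv (sq n) + inv (suc n) ≤ inv n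
inv-telescope n 0<n = begin
  inv (sq n) + v
    ≡⟨ cong (_+ v) (inv-* (suc n) (suc n)) ⟩
  v * v + v
    ≤⟨ +-monoˡ-≤ v (*-monoʳ (0≤inv (suc n)) (inv-anti 0<n (ℕ.n≤1+n n))) ⟩
  u * v + v
    ≡⟨ cong (λ t → u * v + t) (sym (trans (cong (_* v) (ι*inv 0<n)) (*-identityˡ v))) ⟩
  u * v + ι n * u * v
    ≡⟨ solve 3 (λ n u v → u :* v :+ n :* u :* v := u :* ((con 1ℚ :+ n) :* v)) refl (ι n) u v ⟩
  u * ((1ℚ + ι n) * v)
    ≡⟨ cong (u *_) (trans (cong (_* v) (sym (ι-suc n))) (ι*inv (s≤s z≤n))) ⟩
  u * 1ℚ
    ≡⟨ *-identityʳ u ⟩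
  u ∎
  where
  open ≤-Reasoning
  u v : ℚ
  u = inv n
  v = inv (suc n)

∑inv-sq-tail : ∀ m n → ∑[ i < n ] 𝟙 (suc m ℕ.≤? suc i) * inv (sq i) ≤ ι 2 * inv (suc m)
∑inv-sq-tail m n = ≤-trans (∑-range t 0≤t (ℕ.m≤n+m n (suc m))) (≤-trans (≤-+ʳ (0≤inv (suc m ℕ.+ n))) (go n))
  where
  t : ℕ → ℚ
  t i = 𝟙 (suc m ℕ.≤? suc i) * inv (sq i)
  0≤t : ∀ i → 0ℚ ≤ t i
  0≤t i = 0≤term (suc m ℕ.≤? suc i) (sq i)
  two : ∀ a → a + a ≡ ι 2 * a
  two a = sym (trans (cong (_* a) (trans (ι-suc 1) (cong (λ t → 1ℚ + t) ι-1))) (solve 1 (λ a → (con 1ℚ :+ con 1ℚ) :* a := a :+ a) refl a))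
  go : ∀ k → ∑ (suc m ℕ.+ k) t + inv (suc m ℕ.+ k) ≤ ι 2 * inv (suc m)
  go zero = subst (λ s → ∑ s t + inv s ≤ ι 2 * inv (suc m)) (sym (ℕ.+-identityʳ (suc m)))
    (≤-trans (+-monoˡ-≤ (inv (suc m)) (≤-trans (≤-reflexive (trans (cong (_+ t m) (∑-zero m (λ i i<m →
        trans (cong (_* inv (sq i)) (𝟙-no (suc m ℕ.≤? suc i) (λ h → ℕ.<⇒≱ i<m (ℕ.s≤s⁻¹ h)))) (*-zeroˡ (inv (sq i)))))) (+-identityˡ (t m))))
      (≤-trans (𝟙*≤ (suc m ℕ.≤? suc m) (0≤inv (sq m))) (inv-anti (s≤s z≤n) (ℕ.m≤m*n (suc m) (suc m))))))
      (≤-reflexive (two (inv (suc m)))))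
  go (suc k) = subst (λ s → ∑ s t + inv s ≤ ι 2 * inv (suc m)) (sym (ℕ.+-suc (suc m) k)) (≤-trans
    (≤-reflexive (+-assoc (∑ j t) (t j) (inv (suc j))))
    (≤-trans (+-monoʳ-≤ (∑ j t) (≤-trans (+-monoˡ-≤ (inv (suc j)) (𝟙*≤ (suc m ℕ.≤? suc j) (0≤inv (sq j)))) (inv-telescope j (s≤s z≤n))))
      (go k)))
    where
    j : ℕ
    j = suc m ℕ.+ k

∑inv-sq≤2 : ∀ n → ∑[ i < n ] inv (sq i) ≤ ι 2
∑inv-sq≤2 n = ≤-trans (∑-mono n (λ i _ → ≤-reflexive (sym (trans (cong (_* inv (sq i)) (𝟙-yes (1 ℕ.≤? suc i) (s≤s z≤n))) (*-identityˡ (inv (sq i)))))))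
  (≤-trans (∑inv-sq-tail 0 n) (≤-reflexive (trans (cong (ι 2 *_) inv-1) (*-identityʳ (ι 2)))))

∑inv-2^≤2 : ∀ n → ∑[ t < n ] inv (2 ^ t) ≤ ι 2
∑inv-2^≤2 n = ≤-trans (≤-+ʳ (0≤* (0≤ι 2) (0≤inv (2 ^ n)))) (≤-reflexive (go n))
  where
  go : ∀ n → (∑[ t < n ] inv (2 ^ t)) + ι 2 * inv (2 ^ n) ≡ ι 2
  go zero    = trans (+-identityˡ (ι 2 * inv 1)) (trans (cong (ι 2 *_) inv-1) (*-identityʳ (ι 2)))
  go (suc n) = trans (cong (λ s → (∑[ t < n ] inv (2 ^ t)) + inv (2 ^ n) + s) halve)
    (trans (solve 2 (λ a b → a :+ b :+ b := a :+ (con 1ℚ :+ con 1ℚ) :* b) refl (∑[ t < n ] inv (2 ^ t)) (inv (2 ^ n)))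
    (trans (cong (λ s → (∑[ t < n ] inv (2 ^ t)) + s * inv (2 ^ n)) (sym (trans (ι-suc 1) (cong (λ t → 1ℚ + t) ι-1)))) (go n)))
    where
    halve : ι 2 * inv (2 ℕ.* 2 ^ n) ≡ inv (2 ^ n)
    halve = trans (cong (ι 2 *_) (inv-* 2 (2 ^ n))) (trans (sym (*-assoc (ι 2) (inv 2) (inv (2 ^ n))))
      (trans (cong (_* inv (2 ^ n)) (ι*inv (s≤s z≤n))) (*-identityˡ (inv (2 ^ n)))))

-- The length of i + 1 counts the t with 2^t ≤ i + 1. After exchanging the sums, the tail of inverse
-- squares from 2^t on is at most 2/2^t, and these add up to at most 4.
∑len-inv-sq≤4 : ∀ n → ∑[ i < n ] ι (len (suc i)) * inv (sq i) ≤ ι 4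
∑len-inv-sq≤4 n = begin
  ∑[ i < n ] ι (len (suc i)) * inv (sq i)
    ≤⟨ ∑-mono n (λ i i<n → *-monoʳ (0≤inv (sq i))
        (∑-𝟙≥ (λ t → 2 ^ t ℕ.≤? suc i) (len (suc i)) n (ℕ.≤-trans (len-≤-self (suc i)) i<n) (<len⇒2^≤ (suc i)))) ⟩
  ∑[ i < n ] ∑ n (λ t → 𝟙 (2 ^ t ℕ.≤? suc i)) * inv (sq i)
    ≡⟨ ∑-cong n (λ i → ∑-*ʳ n (inv (sq i)) _) ⟩
  ∑[ i < n ] ∑[ t < n ] 𝟙 (2 ^ t ℕ.≤? suc i) * inv (sq i)
    ≡⟨ ∑-swap n n _ ⟩
  ∑[ t < n ] ∑[ i < n ] 𝟙 (2 ^ t ℕ.≤? suc i) * inv (sq i)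
    ≤⟨ ∑-mono n (λ t _ → tail (2 ^ t) (ℕ.m^n>0 2 t)) ⟩
  ∑[ t < n ] ι 2 * inv (2 ^ t)
    ≡⟨ ∑-*ˡ n (ι 2) _ ⟨
  ι 2 * (∑[ t < n ] inv (2 ^ t))
    ≤⟨ *-monoˡ (0≤ι 2) (∑inv-2^≤2 n) ⟩
  ι 2 * ι 2
    ≡⟨ ι-* 2 2 ⟨
  ι 4 ∎
  where
  open ≤-Reasoning
  tail : ∀ m → 0 ℕ.< m → ∑[ i < n ] 𝟙 (m ℕ.≤? suc i) * inv (sq i) ≤ ι 2 * inv m
  tail (suc m) _ = ∑inv-sq-tail m n

-- Counting sums of two squares

primeWeight : ℕ → ℚ
primeWeight p = ι (primeLen p)

primeWeight-prime : ∀ p → Prime p → primeWeight p ≡ ι (len p)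
primeWeight-prime p pp with prime? p
... | yes _  = refl
... | no ¬pp = contradiction pp ¬pp

∑primeWeight : ∀ n → ∑ n primeWeight ≡ ι (θ n)
∑primeWeight zero    = sym ι-0
∑primeWeight (suc n) = trans (cong (_+ primeWeight n) (∑primeWeight n)) (sym (ι-+ (θ n) (primeLen n)))

-- Peel off one prime p at a time: `len` is subadditive on products, and squarefreeness keeps p out
-- of the cofactor, so its weight is added only once. The term 1 is the length of the number 1,
-- where the peeling ends.
len≤∑primes : ∀ {T} Y a → a ℕ.< Y → SF T a → ι (len a) ≤ 1ℚ + (∑[ p < Y ] 𝟙 (p ∣? a) * primeWeight p)
len≤∑primes {T} Y = <-rec _ step
  where
  W : ℕ → ℚ
  W a = ∑[ p < Y ] 𝟙 (p ∣? a) * primeWeight p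
  0≤term′ : ∀ a p → 0ℚ ≤ 𝟙 (p ∣? a) * primeWeight p
  0≤term′ a p = 0≤* (0≤𝟙 (p ∣? a)) (0≤ι (primeLen p))
  step : ∀ a → (∀ {k} → k ℕ.< a → k ℕ.< Y → SF T k → ι (len k) ≤ 1ℚ + W k) → a ℕ.< Y → SF T a → ι (len a) ≤ 1ℚ + W a
  step zero _ _ sf = contradiction (SF⇒>0 sf) (ℕ.<-irrefl refl)
  step 1    _ _ _  = ≤-trans (≤-reflexive ι-1) (≤-+ʳ (∑-nonNeg Y (0≤term′ 1)))
  step a@(suc (suc _)) rec a<Y sf with prime-divisor a (s≤s (s≤s z≤n))
  ... | p , pp , divides zero ()
  ... | p , pp , divides k@(suc _) eq = begin
    ι (len a)
      ≡⟨ cong (λ t → ι (len t)) eq ⟩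
    ι (len (k ℕ.* p))
      ≤⟨ ι-mono (len-* k p) ⟩
    ι (len k ℕ.+ len p)
      ≡⟨ ι-+ (len k) (len p) ⟩
    ι (len k) + ι (len p)
      ≤⟨ +-mono-≤ (rec k<a (ℕ.<-trans k<a a<Y) (SF-∣ k∣a sf)) (≤-reflexive (sym δ)) ⟩
    1ℚ + W k + (∑[ q < Y ] 𝟙 (p ℕ.≟ q) * primeWeight q)
      ≡⟨ +-assoc 1ℚ (W k) _ ⟩
    1ℚ + (W k + (∑[ q < Y ] 𝟙 (p ℕ.≟ q) * primeWeight q))
      ≡⟨ cong (λ t → 1ℚ + t) (∑-+ Y _ _) ⟨
    1ℚ + (∑[ q < Y ] (𝟙 (q ∣? k) * primeWeight q + 𝟙 (p ℕ.≟ q) * primeWeight q))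
      ≤⟨ +-monoʳ-≤ 1ℚ (∑-mono Y (λ q _ → merge q)) ⟩
    1ℚ + W a ∎
    where
    open ≤-Reasoning
    p∣a : p ∣ a
    p∣a = divides k eq
    k∣a : k ∣ a
    k∣a = divides p (trans eq (ℕ.*-comm k p))
    k<a : k ℕ.< a
    k<a = subst (k ℕ.<_) (sym eq) (ℕ.m<m*n k p (prime⇒>1 pp))
    δ : ∑[ q < Y ] 𝟙 (p ℕ.≟ q) * primeWeight q ≡ ι (len p)
    δ = trans (∑-δ Y primeWeight (ℕ.≤-<-trans (∣⇒≤ p∣a) a<Y)) (primeWeight-prime p pp)
    merge : ∀ q → 𝟙 (q ∣? k) * primeWeight q + 𝟙 (p ℕ.≟ q) * primeWeight q ≤ 𝟙 (q ∣? a) * primeWeight q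
    merge q with p ℕ.≟ q
    ... | no _ = ≤-trans (≤-reflexive (trans (cong (λ t → 𝟙 (q ∣? k) * primeWeight q + t) (*-zeroˡ (primeWeight q))) (+-identityʳ _)))
                   (*-monoʳ (0≤ι (primeLen q)) (𝟙-mono (q ∣? k) (q ∣? a) (λ h → ∣-trans h k∣a)))
    ... | yes refl = ≤-reflexive (trans (cong₂ (λ s t → s * primeWeight p + t) (𝟙-no (p ∣? k)
                       (SF-uncons pp (subst (SF T) (trans eq (ℕ.*-comm k p)) sf))) refl)
                     (trans (solve 1 (λ w → con 0ℚ :* w :+ con 1ℚ :* w := con 1ℚ :* w) refl (primeWeight p))
                       (cong (_* primeWeight p) (sym (𝟙-yes (p ∣? a) p∣a)))))

primeWeight-sum≤ : ∀ y l → 0 ℕ.< l → ∑[ p < suc y ] 𝟙 (p ℕ.* l ℕ.≤? y) * primeWeight p ≤ ι 6 * (ι y * inv l)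
primeWeight-sum≤ y l 0<l = begin
  ∑[ p < suc y ] 𝟙 (p ℕ.* l ℕ.≤? y) * primeWeight p
    ≤⟨ ∑-cover (suc y) _ (suc q) (λ p → p) primeWeight (λ p → 0≤ι (primeLen p)) (λ p _ → cover p) ⟩
  ∑ (suc q) primeWeight
    ≡⟨ ∑primeWeight (suc q) ⟩
  ι (θ (suc q))
    ≤⟨ ι-mono (chebyshev q) ⟩
  ι (6 ℕ.* q)
    ≡⟨ ι-* 6 q ⟩
  ι 6 * ι q
    ≤⟨ *-monoˡ (0≤ι 6) (ι≤*inv 0<l (ℕ.m/n*n≤m y l)) ⟩
  ι 6 * (ι y * inv l) ∎
  where
  open ≤-Reasoning
  instance
    l≢0 : ℕ.NonZero l
    l≢0 = ℕ.>-nonZero 0<l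
  q : ℕ
  q = y ℕ./ l
  cover : ∀ p → 𝟙 (p ℕ.* l ℕ.≤? y) * primeWeight p ≤ 0ℚ ⊎ ∃ λ i → i ℕ.< suc q × i ≡ p × 𝟙 (p ℕ.* l ℕ.≤? y) * primeWeight p ≤ primeWeight i
  cover p with p ℕ.* l ℕ.≤? y
  ... | no  _ = inj₁ (≤-reflexive (*-zeroˡ (primeWeight p)))
  ... | yes h = inj₂ (p , s≤s (subst (ℕ._≤ q) (ℕ.m*n/n≡m p l) (ℕ./-monoˡ-≤ l h)) , refl , ≤-reflexive (*-identityˡ (primeWeight p)))

-- Writing len a as a sum over the primes p ∣ a and a = p l, the sum over p is bounded by Chebyshev's estimate.
∑len≤ : ∀ y → ∑[ a < suc y ] 𝟙 (notThree? a) * ι (len a) ≤ ι y * (1ℚ + ι 6 * Sₐ y)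
∑len≤ y = begin
  ∑[ a < n ] A a * ι (len a)
    ≤⟨ ∑-mono n (λ a a<n → 𝟙*-mono (notThree? a) (len≤∑primes n a a<n)) ⟩
  ∑[ a < n ] A a * (1ℚ + ∑ n (w a))
    ≡⟨ ∑-cong n (λ a → trans (*-distribˡ-+ (A a) 1ℚ (∑ n (w a))) (cong₂ _+_ (*-identityʳ (A a)) (∑-*ˡ n (A a) (w a)))) ⟩
  ∑[ a < n ] (A a + (∑[ p < n ] A a * w a p))
    ≡⟨ ∑-+ n A _ ⟩
  ∑ n A + (∑[ a < n ] ∑[ p < n ] A a * w a p)
    ≤⟨ +-mono-≤ count hall ⟩
  ι y + ι 6 * ι y * Sₐ y
    ≡⟨ solve 3 (λ y s c → y :+ c :* y :* s := y :* (con 1ℚ :+ c :* s)) refl (ι y) (Sₐ y) (ι 6) ⟩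
  ι y * (1ℚ + ι 6 * Sₐ y) ∎
  where
  open ≤-Reasoning
  n : ℕ
  n = suc y
  A : ℕ → ℚ
  A a = 𝟙 (notThree? a)
  w : ℕ → ℕ → ℚ
  w a p = 𝟙 (p ∣? a) * primeWeight p
  count : ∑ n A ≤ ι y
  count = ≤-trans (≤-trans (≤-reflexive (∑-cong< n (λ a a<n → 𝟙-cong (notThree? a) (notThree? a ×-dec (a ℕ.* 1 ℕ.≤? y))
            (λ sa → sa , ℕ.≤-trans (ℕ.≤-reflexive (ℕ.*-identityʳ a)) (ℕ.s≤s⁻¹ a<n)) proj₁)))
            (count-≤ (λ a → notThree? a ×-dec (a ℕ.* 1 ℕ.≤? y)) n (s≤s z≤n) (λ (sa , h) → SF⇒>0 sa , h)))
          (≤-reflexive (trans (cong (ι y *_) inv-1) (*-identityʳ (ι y))))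
  swap-cover : ∀ p → ∑[ a < n ] A a * w a p ≤ ∑[ l < n ] A l * (𝟙 (p ℕ.* l ℕ.≤? y) * primeWeight p)
  swap-cover p = ∑-cover n _ n (λ l → p ℕ.* l) _ (λ l → 0≤* (0≤𝟙 (notThree? l)) (0≤* (0≤𝟙 (p ℕ.* l ℕ.≤? y)) (0≤ι (primeLen p)))) cover
    where
    cover : ∀ a → a ℕ.< n → A a * w a p ≤ 0ℚ ⊎ ∃ λ l → l ℕ.< n × p ℕ.* l ≡ a × A a * w a p ≤ A l * (𝟙 (p ℕ.* l ℕ.≤? y) * primeWeight p)
    cover a a<n with notThree? a | p ∣? a
    ... | no _   | p?   = inj₁ (≤-reflexive (*-zeroˡ (𝟙 p? * primeWeight p)))
    ... | yes _  | no _ = inj₁ (≤-reflexive (trans (*-identityˡ (0ℚ * primeWeight p)) (*-zeroˡ (primeWeight p))))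
    ... | yes sa | yes (divides l refl) = inj₂ (l , ℕ.≤-<-trans (∣⇒≤ {{ℕ.>-nonZero (SF⇒>0 sa)}} (m∣m*n p)) a<n , ℕ.*-comm p l ,
            ≤-reflexive (cong₂ (λ s t → s * (t * primeWeight p)) (sym (𝟙-yes (notThree? l) (SF-∣ (m∣m*n p) sa)))
              (sym (𝟙-yes (p ℕ.* l ℕ.≤? y) (subst (ℕ._≤ y) (ℕ.*-comm l p) (ℕ.s≤s⁻¹ a<n))))))
  hall : ∑[ a < n ] ∑[ p < n ] A a * w a p ≤ ι 6 * ι y * Sₐ y
  hall = begin
    ∑[ a < n ] ∑[ p < n ] A a * w a p
      ≡⟨ ∑-swap n n _ ⟩
    ∑[ p < n ] ∑[ a < n ] A a * w a p
      ≤⟨ ∑-mono n (λ p _ → swap-cover p) ⟩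
    ∑[ p < n ] ∑[ l < n ] A l * (𝟙 (p ℕ.* l ℕ.≤? y) * primeWeight p)
      ≡⟨ ∑-swap n n _ ⟩
    ∑[ l < n ] ∑[ p < n ] A l * (𝟙 (p ℕ.* l ℕ.≤? y) * primeWeight p)
      ≡⟨ ∑-cong n (λ l → ∑-*ˡ n (A l) _) ⟨
    ∑[ l < n ] A l * (∑[ p < n ] 𝟙 (p ℕ.* l ℕ.≤? y) * primeWeight p)
      ≤⟨ ∑-mono n (λ l _ → 𝟙*-mono (notThree? l) (λ sl → primeWeight-sum≤ y l (SF⇒>0 sl))) ⟩
    ∑[ l < n ] A l * (ι 6 * (ι y * inv l))
      ≡⟨ ∑-cong n (λ l → solve 4 (λ a b c d → a :* (b :* (c :* d)) := b :* c :* (a :* d)) refl (A l) (ι 6) (ι y) (inv l)) ⟩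
    ∑[ l < n ] ι 6 * ι y * (A l * inv l)
      ≡⟨ ∑-*ˡ n (ι 6 * ι y) _ ⟨
    ι 6 * ι y * Sₐ y ∎

-- The pairs (i, a) parametrise the numbers (i + 1)² a ≤ x, which include all sums of two squares up to x.
shape? : ∀ x i a → Dec (SF NotThree a × sq i ℕ.* a ℕ.≤ x)
shape? x i a = notThree? a ×-dec (sq i ℕ.* a ℕ.≤? x)

shapes : ℕ → ℚ
shapes x = ∑[ i < x ] ∑[ a < suc x ] 𝟙 (shape? x i a)

-- A substitute for log x = log m + log (x / m): the doublings of m that stay below x account for
-- the missing bits.
len≤len+∑ : ∀ x m → ι (len x) ≤ ι (len m) + (∑[ t < len x ] 𝟙 (m ℕ.* 2 ^ t ℕ.≤? x))
len≤len+∑ x m = ≤-trans (ι-mono (ℕ.m≤n+m∸n (len x) (len m))) (≤-trans (≤-reflexive (ι-+ (len m) (len x ℕ.∸ len m)))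
  (+-monoʳ-≤ (ι (len m)) (∑-𝟙≥ (λ t → m ℕ.* 2 ^ t ℕ.≤? x) (len x ℕ.∸ len m) (len x) (ℕ.m∸n≤m (len x) (len m)) below)))
  where
  below : ∀ {t} → t ℕ.< len x ℕ.∸ len m → m ℕ.* 2 ^ t ℕ.≤ x
  below {t} t< = ℕ.≤-trans (ℕ.*-monoˡ-≤ (2 ^ t) (ℕ.<⇒≤ (n<2^len m)))
    (subst (ℕ._≤ x) (ℕ.^-distribˡ-+-* 2 (len m) t) (<len⇒2^≤ x (ℕ.≰⇒> λ h → ℕ.<⇒≱ t< (ℕ.m≤n+o⇒m∸n≤o (len x) (len m) h))))

-- The logarithm of x is split along (i + 1)² a. The part of a is controlled by `∑len≤`; the parts
-- of (i + 1)² and of the remaining quotient cost only O(x), by the convergence of the sums over i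
-- and t. With s = `Sₐ x` ≥ 1 the total factor is 2 (1 + 6s) + 8 + 4 = 14 + 12s ≤ 26s.
len*shapes≤ : ∀ x → 0 ℕ.< x → ι (len x) * shapes x ≤ ι 26 * (ι x * Sₐ x)
len*shapes≤ x 0<x = begin
  ι L * shapes x
    ≡⟨ trans (∑-*ˡ x (ι L) _) (∑-cong x (λ i → trans (∑-*ˡ n (ι L) _) (∑-cong n (λ a → *-comm (ι L) (E i a))))) ⟩
  ∑[ i < x ] ∑[ a < n ] E i a * ι L
    ≤⟨ ∑-mono x (λ i _ → ∑-mono n (λ a _ → *-monoˡ (0≤𝟙 (shape? x i a)) (log-split i a))) ⟩
  ∑[ i < x ] ∑[ a < n ] E i a * (ι (len a) + ι 2 * d i + q i a)
    ≡⟨ ∑-cong x (λ i → ∑-cong n (λ a → distrib (E i a) (ι (len a)) (ι 2 * d i) (q i a))) ⟩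
  ∑[ i < x ] ∑[ a < n ] (E i a * ι (len a) + ι 2 * d i * E i a + E i a * q i a)
    ≡⟨ ∑-cong x (λ i → trans (∑-+ n _ _) (cong (_+ ∑ n (λ a → E i a * q i a)) (∑-+ n _ _))) ⟩
  ∑[ i < x ] (T₁ i + T₂ i + T₃ i)
    ≡⟨ trans (∑-+ x _ T₃) (cong (_+ ∑ x T₃) (∑-+ x T₁ T₂)) ⟩
  ∑ x T₁ + ∑ x T₂ + ∑ x T₃
    ≤⟨ +-mono-≤ (+-mono-≤ T₁≤ T₂≤) T₃≤ ⟩
  ι 2 * (X * (1ℚ + ι 6 * s)) + ι 8 * X + ι 4 * X
    ≡⟨ cong (λ u → ι 2 * (X * (1ℚ + ι 6 * s)) + u * X + ι 4 * X) (ι-+ 4 4) ⟩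
  ι 2 * (X * (1ℚ + ι 6 * s)) + (ι 4 + ι 4) * X + ι 4 * X
    ≤⟨ ≤-by _ (0≤* (0≤* (0≤ι 14) (0≤ι x)) (0≤-diff (1≤Sₐ 0<x))) final ⟩
  ι 26 * (X * s) ∎
  where
  open ≤-Reasoning
  n L : ℕ
  n = suc x
  L = len x
  X s : ℚ
  X = ι x
  s = Sₐ x
  E : ℕ → ℕ → ℚ
  E i a = 𝟙 (shape? x i a)
  d : ℕ → ℚ
  d i = ι (len (suc i))
  Q? : ∀ i a t → Dec (sq i ℕ.* a ℕ.* 2 ^ t ℕ.≤ x)
  Q? i a t = sq i ℕ.* a ℕ.* 2 ^ t ℕ.≤? x
  q : ℕ → ℕ → ℚ
  q i a = ∑[ t < L ] 𝟙 (Q? i a t)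
  T₁ T₂ T₃ : ℕ → ℚ
  T₁ i = ∑[ a < n ] E i a * ι (len a)
  T₂ i = ∑[ a < n ] ι 2 * d i * E i a
  T₃ i = ∑[ a < n ] E i a * q i a
  two≡ : ι 2 ≡ 1ℚ + 1ℚ
  two≡ = trans (ι-suc 1) (cong (λ t → 1ℚ + t) ι-1)
  final : ι 26 * (X * s) ≡ ι 2 * (X * (1ℚ + ι 6 * s)) + (ι 4 + ι 4) * X + ι 4 * X + ι 14 * X * (s - 1ℚ)
  final = trans (cong (_* (X * s)) (trans (ι-+ 14 12) (cong (λ t → ι 14 + t) (ι-* 2 6))))
    (trans (solve 6 (λ c₁₄ c₂ c₆ c₄ X s → (c₁₄ :+ c₂ :* c₆) :* (X :* s) :=
        c₂ :* (X :* (con 1ℚ :+ c₆ :* s)) :+ (c₁₄ :- c₂) :* X :+ c₁₄ :* X :* (s :- con 1ℚ)) refl (ι 14) (ι 2) (ι 6) (ι 4) X s)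
    (cong (_+ ι 14 * X * (s - 1ℚ)) (trans (cong (λ t → ι 2 * (X * (1ℚ + ι 6 * s)) + t * X) fourteen)
      (solve 3 (λ h c X → h :+ (c :+ c :+ c) :* X := h :+ (c :+ c) :* X :+ c :* X) refl (ι 2 * (X * (1ℚ + ι 6 * s))) (ι 4) X))))
    where
    fourteen : ι 14 - ι 2 ≡ ι 4 + ι 4 + ι 4
    fourteen = trans (cong (_- ι 2) (trans (ι-+ 12 2) (cong (_+ ι 2) (trans (ι-+ 8 4) (cong (_+ ι 4) (ι-+ 4 4))))))
      (solve 2 (λ a b → a :+ b :- b := a) refl (ι 4 + ι 4 + ι 4) (ι 2))
  distrib : ∀ e a b c → e * (a + b + c) ≡ e * a + b * e + e * c
  distrib = solve 4 (λ e a b c → e :* (a :+ b :+ c) := e :* a :+ b :* e :+ e :* c) refl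
  log-split : ∀ i a → ι L ≤ ι (len a) + ι 2 * d i + q i a
  log-split i a = ≤-trans (len≤len+∑ x (sq i ℕ.* a)) (+-monoˡ-≤ (q i a) (≤-trans
    (ι-mono (ℕ.≤-trans (len-* (sq i) a) (ℕ.+-monoˡ-≤ (len a) (len-* (suc i) (suc i)))))
    (≤-reflexive (trans (ι-+ (len (suc i) ℕ.+ len (suc i)) (len a)) (trans (cong (_+ ι (len a)) (ι-+ (len (suc i)) (len (suc i))))
      (trans (solve 2 (λ d a → d :+ d :+ a := a :+ (con 1ℚ :+ con 1ℚ) :* d) refl (d i) (ι (len a))) (cong (λ t → ι (len a) + t * d i) (sym two≡))))))))
  T₁≤ : ∑ x T₁ ≤ ι 2 * (X * (1ℚ + ι 6 * s))
  T₁≤ = begin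
    ∑ x T₁
      ≤⟨ ∑-mono x (λ i _ → row i) ⟩
    ∑[ i < x ] inv (sq i) * (X * (1ℚ + ι 6 * s))
      ≡⟨ ∑-*ʳ x (X * (1ℚ + ι 6 * s)) _ ⟨
    ∑ x (λ i → inv (sq i)) * (X * (1ℚ + ι 6 * s))
      ≤⟨ *-monoʳ (0≤* (0≤ι x) (0≤+ 0≤1 (0≤* (0≤ι 6) (Sₐ-nonNeg x)))) (∑inv-sq≤2 x) ⟩
    ι 2 * (X * (1ℚ + ι 6 * s)) ∎
    where
    row : ∀ i → T₁ i ≤ inv (sq i) * (X * (1ℚ + ι 6 * s))
    row i = begin
      T₁ i
        ≤⟨ ∑-cover n _ (suc y) (λ a → a) _ (λ a → 0≤* (0≤𝟙 (notThree? a)) (0≤ι (len a))) (λ a _ → cover a) ⟩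
      ∑[ a < suc y ] 𝟙 (notThree? a) * ι (len a)
        ≤⟨ ∑len≤ y ⟩
      ι y * (1ℚ + ι 6 * Sₐ y)
        ≤⟨ *-mono-nonNeg (0≤ι y) (0≤+ 0≤1 (0≤* (0≤ι 6) (Sₐ-nonNeg y))) (ι≤*inv (s≤s z≤n) (ℕ.m/n*n≤m x (sq i)))
            (+-monoʳ-≤ 1ℚ (*-monoˡ (0≤ι 6) (Sₐ-mono (ℕ.m/n≤m x (sq i))))) ⟩
      X * inv (sq i) * (1ℚ + ι 6 * s)
        ≡⟨ solve 3 (λ x v c → x :* v :* c := v :* (x :* c)) refl X (inv (sq i)) (1ℚ + ι 6 * s) ⟩
      inv (sq i) * (X * (1ℚ + ι 6 * s)) ∎
      where
      y : ℕ
      y = x ℕ./ sq i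
      cover : ∀ a → E i a * ι (len a) ≤ 0ℚ ⊎ ∃ λ b → b ℕ.< suc y × b ≡ a × E i a * ι (len a) ≤ 𝟙 (notThree? b) * ι (len b)
      cover a with shape? x i a
      ... | no _ = inj₁ (≤-reflexive (*-zeroˡ (ι (len a))))
      ... | yes (sa , h) = inj₂ (a , s≤s (subst (ℕ._≤ y) (ℕ.m*n/n≡m a (sq i)) (ℕ./-monoˡ-≤ (sq i) (subst (ℕ._≤ x) (ℕ.*-comm (sq i) a) h))) , refl ,
              ≤-reflexive (cong (_* ι (len a)) (sym (𝟙-yes (notThree? a) sa))))
  row-count : ∀ i → ∑[ a < n ] E i a ≤ X * inv (sq i)
  row-count i = count-≤ (shape? x i) n (s≤s z≤n) (λ {a} (sa , h) → SF⇒>0 sa , subst (ℕ._≤ x) (ℕ.*-comm (sq i) a) h)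
  T₂≤ : ∑ x T₂ ≤ ι 8 * X
  T₂≤ = begin
    ∑ x T₂
      ≡⟨ ∑-cong x (λ i → ∑-*ˡ n (ι 2 * d i) _) ⟨
    ∑[ i < x ] ι 2 * d i * ∑ n (E i)
      ≤⟨ ∑-mono x (λ i _ → *-monoˡ (0≤* (0≤ι 2) (0≤ι (len (suc i)))) (row-count i)) ⟩
    ∑[ i < x ] ι 2 * d i * (X * inv (sq i))
      ≡⟨ ∑-cong x (λ i → solve 4 (λ c d x v → c :* d :* (x :* v) := c :* x :* (d :* v)) refl (ι 2) (d i) X (inv (sq i))) ⟩
    ∑[ i < x ] ι 2 * X * (d i * inv (sq i))
      ≡⟨ ∑-*ˡ x (ι 2 * X) _ ⟨
    ι 2 * X * (∑[ i < x ] d i * inv (sq i))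
      ≤⟨ *-monoˡ (0≤* (0≤ι 2) (0≤ι x)) (∑len-inv-sq≤4 x) ⟩
    ι 2 * X * ι 4
      ≡⟨ solve 3 (λ a b c → a :* c :* b := a :* b :* c) refl (ι 2) (ι 4) X ⟩
    ι 2 * ι 4 * X
      ≡⟨ cong (_* X) (ι-* 2 4) ⟨
    ι 8 * X ∎
  T₃≤ : ∑ x T₃ ≤ ι 4 * X
  T₃≤ = begin
    ∑ x T₃
      ≡⟨ ∑-cong x (λ i → trans (∑-cong n (λ a → ∑-*ˡ L (E i a) _)) (∑-swap n L _)) ⟩
    ∑[ i < x ] ∑[ t < L ] ∑[ a < n ] E i a * 𝟙 (Q? i a t)
      ≤⟨ ∑-mono x (λ i _ → ∑-mono L (λ t _ → cell i t)) ⟩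
    ∑[ i < x ] ∑[ t < L ] X * inv (sq i) * inv (2 ^ t)
      ≡⟨ ∑-cong x (λ i → ∑-*ˡ L (X * inv (sq i)) _) ⟨
    ∑[ i < x ] X * inv (sq i) * (∑[ t < L ] inv (2 ^ t))
      ≤⟨ ∑-mono x (λ i _ → *-monoˡ (0≤* (0≤ι x) (0≤inv (sq i))) (∑inv-2^≤2 L)) ⟩
    ∑[ i < x ] X * inv (sq i) * ι 2
      ≡⟨ trans (sym (∑-*ʳ x (ι 2) _)) (cong (_* ι 2) (sym (∑-*ˡ x X _))) ⟩
    X * ∑ x (λ i → inv (sq i)) * ι 2
      ≤⟨ *-monoʳ (0≤ι 2) (*-monoˡ (0≤ι x) (∑inv-sq≤2 x)) ⟩
    X * ι 2 * ι 2
      ≡⟨ trans (*-assoc X (ι 2) (ι 2)) (trans (cong (X *_) (sym (ι-* 2 2))) (*-comm X (ι 4))) ⟩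
    ι 4 * X ∎
    where
    cell : ∀ i t → ∑[ a < n ] E i a * 𝟙 (Q? i a t) ≤ X * inv (sq i) * inv (2 ^ t)
    cell i t = begin
      ∑[ a < n ] E i a * 𝟙 (Q? i a t)
        ≤⟨ ∑-mono n (λ a _ → ≤-reflexive (𝟙-× (shape? x i a) (Q? i a t))) ⟩
      ∑[ a < n ] 𝟙 (shape? x i a ×-dec Q? i a t)
        ≤⟨ count-≤ (λ a → shape? x i a ×-dec Q? i a t) n {sq i ℕ.* 2 ^ t} (ℕ.*-mono-< {0} {sq i} (s≤s z≤n) (ℕ.m^n>0 2 t))
            (λ {a} ((sa , _) , h) → SF⇒>0 sa , subst (ℕ._≤ x) (form (sq i) a (2 ^ t)) h) ⟩
      X * inv (sq i ℕ.* 2 ^ t)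
        ≡⟨ trans (cong (X *_) (inv-* (sq i) (2 ^ t))) (sym (*-assoc X (inv (sq i)) (inv (2 ^ t)))) ⟩
      X * inv (sq i) * inv (2 ^ t) ∎
      where
      form : ∀ D a p → D ℕ.* a ℕ.* p ≡ a ℕ.* (D ℕ.* p)
      form = solve-∀

-- len x · shapes x ≪ x Sₐ x, and (Sₐ x)² ≪ len x.
shapes-bound : ∀ x r → r ℕ.* r ℕ.≤ len x → ι r * shapes x ≤ ι 74 * ι x
shapes-bound zero    r _  = ≤-trans (≤-reflexive (*-zeroʳ (ι r))) (0≤* (0≤ι 74) (0≤ι 0))
shapes-bound x@(suc _) r r²≤L = square-cancel-≤ (0≤* (0≤ι 74) (0≤ι x)) (begin
  ι r * K * (ι r * K)
    ≡⟨ solve 2 (λ r k → r :* k :* (r :* k) := r :* r :* (k :* k)) refl (ι r) K ⟩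
  ι r * ι r * (K * K)
    ≤⟨ *-monoʳ (0≤* 0≤K 0≤K) (≤-trans (≤-reflexive (sym (ι-* r r))) (ι-mono r²≤L)) ⟩
  L * (K * K)
    ≤⟨ LK²≤ ⟩
  ι 5408 * (X * X)
    -- 5408 = 8 · 26², and 74² = 5476 is the next square.
    ≤⟨ *-monoʳ (0≤* (0≤ι x) (0≤ι x)) (ι-mono (ℕ.m≤m+n 5408 68)) ⟩
  ι (74 ℕ.* 74) * (X * X)
    ≡⟨ trans (cong (_* (X * X)) (ι-* 74 74)) (solve 2 (λ c x → c :* c :* (x :* x) := c :* x :* (c :* x)) refl (ι 74) X) ⟩
  ι 74 * X * (ι 74 * X) ∎)
  where
  open ≤-Reasoning
  K L X s : ℚ
  K = shapes x
  L = ι (len x)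
  X = ι x
  s = Sₐ x
  0≤K : 0ℚ ≤ K
  0≤K = ∑-nonNeg x (λ i → ∑-nonNeg (suc x) (λ a → 0≤𝟙 (shape? x i a)))
  0<L : 0ℚ < L
  0<L = 0<ι (2^≤⇒<len x 0 (s≤s z≤n))
  LK²≤ : L * (K * K) ≤ ι 5408 * (X * X)
  LK²≤ = *-cancelˡ 0<L (begin
    L * (L * (K * K))
      ≡⟨ solve 2 (λ l k → l :* (l :* (k :* k)) := l :* k :* (l :* k)) refl L K ⟩
    L * K * (L * K)
      ≤⟨ *-mono-nonNeg 0≤LK 0≤LK (len*shapes≤ x (s≤s z≤n)) (len*shapes≤ x (s≤s z≤n)) ⟩
    ι 26 * (X * s) * (ι 26 * (X * s))
      ≡⟨ solve 3 (λ c x s → c :* (x :* s) :* (c :* (x :* s)) := c :* c :* (x :* x) :* (s :* s)) refl (ι 26) X s ⟩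
    ι 26 * ι 26 * (X * X) * (s * s)
      ≤⟨ *-monoˡ (0≤* (0≤* (0≤ι 26) (0≤ι 26)) (0≤* (0≤ι x) (0≤ι x))) (≤-trans (Sₐ²≤ x) (≤-reflexive (ι-* 8 (len x)))) ⟩
    ι 26 * ι 26 * (X * X) * (ι 8 * L)
      ≡⟨ solve 4 (λ c x e l → c :* c :* (x :* x) :* (e :* l) := l :* (c :* c :* e :* (x :* x))) refl (ι 26) X (ι 8) L ⟩
    L * (ι 26 * ι 26 * ι 8 * (X * X))
      ≡⟨ cong (λ c → L * (c * (X * X))) (trans (cong (_* ι 8) (sym (ι-* 26 26))) (sym (ι-* 676 8))) ⟩
    L * (ι 5408 * (X * X)) ∎)
    where
    0≤LK : 0ℚ ≤ L * K
    0≤LK = 0≤* (<⇒≤ 0<L) 0≤K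

-- Sums of two squares among the multiples of g

twoSquares? : ∀ m → Dec (0 ℕ.< m × IsSumOfTwoSquares m)
twoSquares? m = (0 ℕ.<? m) ×-dec map′ to from
  (ℕ.anyUpTo? (λ x → ℕ.anyUpTo? (λ y → m ℕ.≟ x ℕ.* x ℕ.+ y ℕ.* y) (suc m)) (suc m))
  where
  root≤ : ∀ x → x ℕ.≤ x ℕ.* x
  root≤ zero    = z≤n
  root≤ (suc x) = ℕ.m≤m*n (suc x) (suc x)
  to : (∃ λ x → x ℕ.< suc m × ∃ λ y → y ℕ.< suc m × m ≡ x ℕ.* x ℕ.+ y ℕ.* y) → IsSumOfTwoSquares m
  to (x , _ , y , _ , eq) = x , y , eq
  from : IsSumOfTwoSquares m → ∃ λ x → x ℕ.< suc m × ∃ λ y → y ℕ.< suc m × m ≡ x ℕ.* x ℕ.+ y ℕ.* y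
  from (x , y , eq) = x , s≤s (ℕ.≤-trans (root≤ x) (ℕ.≤-trans (ℕ.m≤m+n (x ℕ.* x) (y ℕ.* y)) (ℕ.≤-reflexive (sym eq)))) ,
                      y , s≤s (ℕ.≤-trans (root≤ y) (ℕ.≤-trans (ℕ.m≤n+m (y ℕ.* y) (x ℕ.* x)) (ℕ.≤-reflexive (sym eq)))) , eq

root-bounds : ∀ {i a m} → 0 ℕ.< m → m ≡ i ℕ.* i ℕ.* a → 0 ℕ.< i × i ℕ.≤ m × a ℕ.≤ m
root-bounds {zero}  0<m refl = contradiction 0<m (ℕ.<-irrefl refl)
root-bounds {suc i} {zero} 0<m refl = contradiction (subst (0 ℕ.<_) (ℕ.*-zeroʳ (suc i ℕ.* suc i)) 0<m) (ℕ.<-irrefl refl)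
root-bounds {suc i} {suc a} 0<m refl = s≤s z≤n , ℕ.≤-trans (ℕ.m≤m*n (suc i) (suc i)) (ℕ.m≤m*n (sq i) (suc a)) , ℕ.m≤n*m (suc a) (sq i)

twoSquares≤shapes : ∀ x → ∑[ m < suc x ] 𝟙 (twoSquares? m) ≤ shapes x
twoSquares≤shapes x = ∑-cover₂ (suc x) _ x (suc x) (λ i a → sq i ℕ.* a) (λ i a → 𝟙 (shape? x i a)) (λ i a → 0≤𝟙 (shape? x i a)) cover
  where
  cover : ∀ m → m ℕ.< suc x → 𝟙 (twoSquares? m) ≤ 0ℚ ⊎
    ∃ λ i → ∃ λ a → i ℕ.< x × a ℕ.< suc x × sq i ℕ.* a ≡ m × 𝟙 (twoSquares? m) ≤ 𝟙 (shape? x i a)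
  cover m m<x with twoSquares? m
  ... | no  _ = inj₁ ≤-refl
  ... | yes (0<m , s) with sumOfTwoSquares-shape m 0<m s
  ...   | zero  , a , eq , sa = contradiction 0<m (subst (λ t → ¬ 0 ℕ.< t) (sym eq) (ℕ.<-irrefl refl))
  ...   | suc i , a , eq , sa with root-bounds {suc i} 0<m eq
  ...     | _ , d≤m , a≤m = inj₂ (i , a , ℕ.≤-trans d≤m (ℕ.s≤s⁻¹ m<x) , ℕ.≤-<-trans a≤m m<x , sym eq ,
              ≤-reflexive (sym (𝟙-yes (shape? x i a) (sa , subst (ℕ._≤ x) eq (ℕ.s≤s⁻¹ m<x)))))

-- For a prime p ∣ g, the factor p² comes off m. The cofactor of p in g still divides what remains,
-- since squarefreeness of g makes it coprime to p.
three-descent : ∀ g m → SF Three g → g ∣ m → IsSumOfTwoSquares m → ∃ λ m′ → m ≡ g ℕ.* g ℕ.* m′ × IsSumOfTwoSquares m′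
three-descent = <-rec _ step
  where
  step : ∀ g → (∀ {k} → k ℕ.< g → ∀ m → SF Three k → k ∣ m → IsSumOfTwoSquares m → ∃ λ m′ → m ≡ k ℕ.* k ℕ.* m′ × IsSumOfTwoSquares m′) →
         ∀ m → SF Three g → g ∣ m → IsSumOfTwoSquares m → ∃ λ m′ → m ≡ g ℕ.* g ℕ.* m′ × IsSumOfTwoSquares m′
  step zero _ m sg _ _ = contradiction (SF⇒>0 sg) (ℕ.<-irrefl refl)
  step 1    _ m _  _ s = m , sym (ℕ.+-identityʳ m) , s
  step g@(suc (suc _)) rec m sg g∣m s with prime-divisor g (s≤s (s≤s z≤n))
  ... | p , pp , divides zero ()
  ... | p , pp , divides k@(suc _) eq with prime-3mod4-descent pp (primes sg p pp (divides k eq)) (∣-trans (divides k eq) g∣m) s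
  ...   | m₁ , refl , s₁ = conclude (rec k<g m₁ (SF-∣ k∣g sg) k∣m₁ s₁)
    where
    k∣g : k ∣ g
    k∣g = divides p (trans eq (ℕ.*-comm k p))
    k<g : k ℕ.< g
    k<g = subst (k ℕ.<_) (sym eq) (ℕ.m<m*n k p (prime⇒>1 pp))
    coprime : Coprime k p
    coprime = Coprimality.sym (prime∤⇒coprime pp (SF-uncons pp (subst (SF Three) (trans eq (ℕ.*-comm k p)) sg)))
    k∣m₁ : k ∣ m₁
    k∣m₁ = coprime-divisor coprime (coprime-divisor coprime (subst (k ∣_) (ℕ.*-assoc p p m₁) (∣-trans k∣g g∣m)))
    form : ∀ p k m → p ℕ.* p ℕ.* (k ℕ.* k ℕ.* m) ≡ k ℕ.* p ℕ.* (k ℕ.* p) ℕ.* m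
    form = solve-∀
    conclude : (∃ λ m₂ → m₁ ≡ k ℕ.* k ℕ.* m₂ × IsSumOfTwoSquares m₂) → ∃ λ m₂ → p ℕ.* p ℕ.* m₁ ≡ g ℕ.* g ℕ.* m₂ × IsSumOfTwoSquares m₂
    conclude (m₂ , eq₂ , s₂) = m₂ , trans (cong (p ℕ.* p ℕ.*_) eq₂) (trans (form p k m₂) (cong (λ t → t ℕ.* t ℕ.* m₂) (sym eq))) , s₂

-- The saving is 1/g² where a random set would give 1/g. The premise on r concerns y = ⌊x / g²⌋; it
-- is stated for all larger y as well so that the premise for M implies that for every g ∣ M.
twoSquares-multiples : ∀ x g r → SF Three g → (∀ y → x ℕ.< suc y ℕ.* (g ℕ.* g) → r ℕ.* r ℕ.≤ len y) →
  ι r * (∑[ m < suc x ] 𝟙 (twoSquares? m ×-dec (g ∣? m))) ≤ ι 74 * (ι x * (inv g * inv g))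
twoSquares-multiples x g r sg r²≤ = begin
  ι r * (∑[ m < suc x ] 𝟙 (twoSquares? m ×-dec (g ∣? m)))
    ≤⟨ *-monoˡ (0≤ι r) (≤-trans (∑-cover (suc x) _ (suc y) (λ m → g ℕ.* g ℕ.* m) _ (λ m → 0≤𝟙 (twoSquares? m)) cover)
     (twoSquares≤shapes y)) ⟩
  ι r * shapes y
    ≤⟨ shapes-bound y r (r²≤ y x<) ⟩
  ι 74 * ι y
    ≤⟨ *-monoˡ (0≤ι 74) (ι≤*inv 0<gg (ℕ.m/n*n≤m x (g ℕ.* g))) ⟩
  ι 74 * (ι x * inv (g ℕ.* g))
    ≡⟨ cong (λ t → ι 74 * (ι x * t)) (inv-* g g) ⟩
  ι 74 * (ι x * (inv g * inv g)) ∎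
  where
  open ≤-Reasoning
  0<gg : 0 ℕ.< g ℕ.* g
  0<gg = ℕ.*-mono-< (SF⇒>0 sg) (SF⇒>0 sg)
  instance
    gg≢0 : ℕ.NonZero (g ℕ.* g)
    gg≢0 = ℕ.>-nonZero 0<gg
  y : ℕ
  y = x ℕ./ (g ℕ.* g)
  x< : x ℕ.< suc y ℕ.* (g ℕ.* g)
  x< = subst (ℕ._< suc y ℕ.* (g ℕ.* g)) (sym (ℕ.m≡m%n+[m/n]*n x (g ℕ.* g))) (ℕ.+-monoˡ-< (y ℕ.* (g ℕ.* g)) (ℕ.m%n<n x (g ℕ.* g)))
  cover : ∀ m → m ℕ.< suc x → 𝟙 (twoSquares? m ×-dec (g ∣? m)) ≤ 0ℚ ⊎
    ∃ λ m′ → m′ ℕ.< suc y × g ℕ.* g ℕ.* m′ ≡ m × 𝟙 (twoSquares? m ×-dec (g ∣? m)) ≤ 𝟙 (twoSquares? m′)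
  cover m m<x with twoSquares? m ×-dec (g ∣? m)
  ... | no  _ = inj₁ ≤-refl
  ... | yes ((0<m , s) , g∣m) with three-descent g m sg g∣m s
  ...   | zero   , eq , _  = contradiction (trans eq (ℕ.*-zeroʳ (g ℕ.* g))) (λ m≡0 → ℕ.<⇒≢ 0<m (sym m≡0))
  ...   | m′@(suc _) , eq , s′ = inj₂ (m′ , s≤s (subst (ℕ._≤ y) (ℕ.m*n/n≡m m′ (g ℕ.* g)) (ℕ./-monoˡ-≤ (g ℕ.* g)
            (subst (ℕ._≤ x) (trans eq (ℕ.*-comm (g ℕ.* g) m′)) (ℕ.s≤s⁻¹ m<x)))) , sym eq , ≤-reflexive (sym (𝟙-yes (twoSquares? m′) (s≤s z≤n , s′))))

-- The density of the modulus

IsThreePrime : ℕ → Set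
IsThreePrime p = Prime p × Three p

threePrime? : ∀ p → Dec (IsThreePrime p)
threePrime? p = prime? p ×-dec (p % 4 ℕ.≟ 3)

modulus : ℕ → ℕ
modulus zero    = 1
modulus (suc y) with threePrime? y
... | yes _ = modulus y ℕ.* y
... | no  _ = modulus y

eulerProduct : ℕ → ℚ
eulerProduct zero    = 1ℚ
eulerProduct (suc y) with threePrime? y
... | yes _ = (1ℚ + inv y) * eulerProduct y
... | no  _ = eulerProduct y

Three< : ℕ → ℕ → Set
Three< y p = p % 4 ≡ 3 × p ℕ.< y

modulus-SF : ∀ y → SF (Three< y) (modulus y)
modulus-SF zero = SF-1
modulus-SF (suc y) with threePrime? y
... | no  _          = SF-⊆ (λ _ _ (t , p<y) → t , ℕ.m≤n⇒m≤1+n p<y) (modulus-SF y)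
... | yes (py , y≡3) = subst (SF (Three< (suc y))) (ℕ.*-comm y (modulus y))
        (SF-cons py (y≡3 , ℕ.≤-refl) (λ h → ℕ.<-irrefl refl (proj₂ (primes (modulus-SF y) y py h)))
          (SF-⊆ (λ _ _ (t , p<y) → t , ℕ.m≤n⇒m≤1+n p<y) (modulus-SF y)))

modulus-three : ∀ y → SF Three (modulus y)
modulus-three y = SF-⊆ (λ _ _ → proj₁) (modulus-SF y)

-- For squarefree M this is ∏ (p - 1 + 1/p) over the primes p ∣ M, by `gcdSum-*`.
gcdSum : ℕ → ℚ
gcdSum M = ∑[ s < M ] inv (gcd s M)

gcd-cong-∣ : ∀ {a b c d} → (∀ {e} → e ∣ a → e ∣ b → e ∣ c × e ∣ d) → (∀ {e} → e ∣ c → e ∣ d → e ∣ a × e ∣ b) → gcd a b ≡ gcd c d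
gcd-cong-∣ {a} {b} {c} {d} f g = ∣-antisym
  (let h , k = f (gcd[m,n]∣m a b) (gcd[m,n]∣n a b) in gcd-greatest h k)
  (let h , k = g (gcd[m,n]∣m c d) (gcd[m,n]∣n c d) in gcd-greatest h k)

-- The gcds of s with M p and with M differ only at the multiples s = e p, where they are p · gcd e
-- M and gcd e M. So a sum of period M is corrected at those s, in place of an appeal to the Chinese
-- remainder theorem.
gcdSum-* : ∀ p M → Prime p → ¬ p ∣ M → gcdSum (M ℕ.* p) ≡ (ι p - 1ℚ + inv p) * gcdSum M
gcdSum-* p M pp p∤M = begin
  ∑[ s < M ℕ.* p ] inv (gcd s (M ℕ.* p))
    ≡⟨ ∑-cong (M ℕ.* p) pointwise ⟩
  ∑[ s < M ℕ.* p ] (G s + 𝟙 (p ∣? s) * (inv (gcd s (M ℕ.* p)) - G s))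
    ≡⟨ ∑-+ (M ℕ.* p) G _ ⟩
  ∑ (M ℕ.* p) G + (∑[ s < M ℕ.* p ] 𝟙 (p ∣? s) * (inv (gcd s (M ℕ.* p)) - G s))
    ≡⟨ cong₂ _+_ (trans (cong (λ t → ∑ t G) (ℕ.*-comm M p)) (∑-periodic p M G G-periodic))
         (∑-multiples p M (λ s → inv (gcd s (M ℕ.* p)) - G s) (prime⇒>0 pp)) ⟩
  ι p * F + (∑[ e < M ] (inv (gcd (e ℕ.* p) (M ℕ.* p)) - G (e ℕ.* p)))
    ≡⟨ cong (λ t → ι p * F + t) (∑-cong M on-multiples) ⟩
  ι p * F + (∑[ e < M ] (inv p - 1ℚ) * G e)
    ≡⟨ cong (λ t → ι p * F + t) (∑-*ˡ M (inv p - 1ℚ) G) ⟨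
  ι p * F + (inv p - 1ℚ) * F
    ≡⟨ solve 3 (λ p v f → p :* f :+ (v :- con 1ℚ) :* f := (p :- con 1ℚ :+ v) :* f) refl (ι p) (inv p) F ⟩
  (ι p - 1ℚ + inv p) * F ∎
  where
  open ≡-Reasoning
  G : ℕ → ℚ
  G s = inv (gcd s M)
  F : ℚ
  F = gcdSum M
  G-periodic : ∀ i → G (M ℕ.+ i) ≡ G i
  G-periodic i = cong inv (gcd-cong-∣ {M ℕ.+ i} {M} {i} {M} (λ h k → ∣m+n∣m⇒∣n h k , k) (λ h k → ∣m∣n⇒∣m+n k h , k))
  pointwise : ∀ s → inv (gcd s (M ℕ.* p)) ≡ G s + 𝟙 (p ∣? s) * (inv (gcd s (M ℕ.* p)) - G s)
  pointwise s with p ∣? s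
  ... | yes _ = solve 2 (λ a b → a := b :+ con 1ℚ :* (a :- b)) refl (inv (gcd s (M ℕ.* p))) (G s)
  ... | no p∤s = trans (cong inv (gcd-cong-∣ {s} {M ℕ.* p} {s} {M}
      (λ {e} h k → h , coprime-divisor (Coprimality.sym (prime∤⇒coprime pp (λ p∣e → p∤s (∣-trans p∣e h)))) (subst (e ∣_) (ℕ.*-comm M p) k))
      (λ h k → h , ∣m⇒∣m*n p k)))
    (solve 2 (λ a b → b := b :+ con 0ℚ :* (a :- b)) refl (inv (gcd s (M ℕ.* p))) (G s))
  on-multiples : ∀ e → inv (gcd (e ℕ.* p) (M ℕ.* p)) - G (e ℕ.* p) ≡ (inv p - 1ℚ) * G e
  on-multiples e = trans (cong₂ (λ a b → inv a - inv b)
      (trans (trans (cong₂ gcd (ℕ.*-comm e p) (ℕ.*-comm M p)) (sym (c*gcd[m,n]≡gcd[cm,cn] p e M))) refl)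
      (gcd-cong-∣ {e ℕ.* p} {M} {e} {M}
        (λ {c} h k → coprime-divisor (Coprimality.sym (prime∤⇒coprime pp (λ p∣c → p∤M (∣-trans p∣c k)))) (subst (c ∣_) (ℕ.*-comm e p) h) , k)
        (λ h k → ∣m⇒∣m*n p h , k)))
    (trans (cong (_- G e) (inv-* p (gcd e M))) (solve 2 (λ v g → v :* g :- g := (v :- con 1ℚ) :* g) refl (inv p) (G e)))

eulerProduct-nonNeg : ∀ y → 0ℚ ≤ eulerProduct y
eulerProduct-nonNeg zero = 0≤1
eulerProduct-nonNeg (suc y) with threePrime? y
... | yes _ = 0≤* (0≤+ 0≤1 (0≤inv y)) (eulerProduct-nonNeg y)
... | no  _ = eulerProduct-nonNeg y

-- (1 - u + u²)² (1 + u) ≤ 1 for u = 1/p.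
local-factor : ∀ p → 2 ℕ.≤ p → (ι p - 1ℚ + inv p) * (ι p - 1ℚ + inv p) * (1ℚ + inv p) ≤ ι p * ι p
local-factor p 2≤p = begin
  (q - 1ℚ + u) * (q - 1ℚ + u) * (1ℚ + u)
    ≡⟨ cong (λ t → t * t * (1ℚ + u)) factor ⟩
  q * (1ℚ - u + u * u) * (q * (1ℚ - u + u * u)) * (1ℚ + u)
    -- The product is (1 - u + u²)(1 + u³), so the gap is u (1 - u - u² + u³ - u⁴) times q². Written
    -- in u and v = 1 - 2u, which is nonnegative as p ≥ 2, it has only nonnegative terms.
    ≤⟨ ≤-by (q * q * (u * (v + u * (v + u) + u * u * u * (v + u)))) 0≤gap expand ⟩
  q * q ∎
  where
  open ≤-Reasoning
  q u v : ℚ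
  q = ι p
  u = inv p
  v = 1ℚ - u - u
  qu : q * u ≡ 1ℚ
  qu = ι*inv (ℕ.<⇒≤ 2≤p)
  factor : q - 1ℚ + u ≡ q * (1ℚ - u + u * u)
  factor = sym (trans (solve 2 (λ q u → q :* (con 1ℚ :- u :+ u :* u) := q :- q :* u :+ q :* u :* u) refl q u)
    (trans (cong (λ t → q - t + t * u) qu) (solve 2 (λ q u → q :- con 1ℚ :+ con 1ℚ :* u := q :- con 1ℚ :+ u) refl q u)))
  0≤u : 0ℚ ≤ u
  0≤u = 0≤inv p
  0≤v : 0ℚ ≤ v
  0≤v = ≤-trans (0≤-diff (≤-trans (+-mono-≤ (inv-anti (s≤s z≤n) 2≤p) (inv-anti (s≤s z≤n) 2≤p)) (≤-reflexive
      (trans (solve 1 (λ h → h :+ h := (con 1ℚ :+ con 1ℚ) :* h) refl (inv 2))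
        (trans (cong (_* inv 2) (sym (trans (ι-suc 1) (cong (λ t → 1ℚ + t) ι-1)))) (ι*inv (s≤s z≤n)))))))
    (≤-reflexive (solve 1 (λ u → con 1ℚ :- (u :+ u) := con 1ℚ :- u :- u) refl u))
  0≤gap : 0ℚ ≤ q * q * (u * (v + u * (v + u) + u * u * u * (v + u)))
  0≤gap = 0≤* (0≤* (0≤ι p) (0≤ι p)) (0≤* 0≤u (0≤+ (0≤+ 0≤v (0≤* 0≤u (0≤+ 0≤v 0≤u))) (0≤* (0≤* (0≤* 0≤u 0≤u) 0≤u) (0≤+ 0≤v 0≤u))))
  expand : q * q ≡ q * (1ℚ - u + u * u) * (q * (1ℚ - u + u * u)) * (1ℚ + u) + q * q * (u * (v + u * (v + u) + u * u * u * (v + u)))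
  expand = solve 2 (λ q u → let w = con 1ℚ :- u :- u in
    q :* q := q :* (con 1ℚ :- u :+ u :* u) :* (q :* (con 1ℚ :- u :+ u :* u)) :* (con 1ℚ :+ u) :+ q :* q :* (u :* (w :+ u :* (w :+ u) :+ u :* u :* u :* (w :+ u)))) refl q u

gcdSum-nonNeg : ∀ M → 0ℚ ≤ gcdSum M
gcdSum-nonNeg M = ∑-nonNeg M (λ s → 0≤inv (gcd s M))

-- The local bounds multiply up to show that `gcdSum` M / M is at most the inverse square root of
-- the Euler product. The first power would not do: (1 - u + u²)(1 + u) = 1 + u³ exceeds 1.
gcdSum²*eulerProduct≤ : ∀ y → gcdSum (modulus y) * gcdSum (modulus y) * eulerProduct y ≤ ι (modulus y) * ι (modulus y)
gcdSum²*eulerProduct≤ zero = ≤-reflexive (trans (cong₂ (λ a b → (0ℚ + a) * (0ℚ + b) * 1ℚ) inv-1 inv-1) (sym (trans (cong₂ _*_ ι-1 ι-1) refl)))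
gcdSum²*eulerProduct≤ (suc y) with threePrime? y
... | no  _        = gcdSum²*eulerProduct≤ y
... | yes (py , _) = begin
  gcdSum (M ℕ.* y) * gcdSum (M ℕ.* y) * ((1ℚ + inv y) * E)
    ≡⟨ cong (λ t → t * t * ((1ℚ + inv y) * E)) (gcdSum-* y M py (λ h → ℕ.<-irrefl refl (proj₂ (primes (modulus-SF y) y py h)))) ⟩
  c * F * (c * F) * ((1ℚ + inv y) * E)
    ≡⟨ solve 4 (λ c f w e → c :* f :* (c :* f) :* (w :* e) := c :* c :* w :* (f :* f :* e)) refl c F (1ℚ + inv y) E ⟩
  c * c * (1ℚ + inv y) * (F * F * E)
    ≤⟨ *-mono-nonNeg 0≤ccw (0≤* (0≤* (gcdSum-nonNeg M) (gcdSum-nonNeg M)) (eulerProduct-nonNeg y))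
          (local-factor y (prime⇒>1 py)) (gcdSum²*eulerProduct≤ y) ⟩
  ι y * ι y * (ι M * ι M)
    ≡⟨ solve 2 (λ a b → a :* a :* (b :* b) := b :* a :* (b :* a)) refl (ι y) (ι M) ⟩
  ι M * ι y * (ι M * ι y)
    ≡⟨ cong (λ t → t * t) (ι-* M y) ⟨
  ι (M ℕ.* y) * ι (M ℕ.* y) ∎
  where
  open ≤-Reasoning
  M : ℕ
  M = modulus y
  F E c : ℚ
  F = gcdSum M
  E = eulerProduct y
  c = ι y - 1ℚ + inv y
  0≤c : 0ℚ ≤ c
  0≤c = 0≤+ (0≤-diff (1≤ι (prime⇒>0 py))) (0≤inv y)
  0≤ccw : 0ℚ ≤ c * c * (1ℚ + inv y)
  0≤ccw = 0≤* (0≤* 0≤c 0≤c) (0≤+ 0≤1 (0≤inv y))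

-- Divergence of the product over the primes 3 mod 4

three<? : ∀ y n → Dec (SF (Three< y) n)
three<? y = SF? (λ p → (p % 4 ℕ.≟ 3) ×-dec (p ℕ.<? y))

-- This expands the product: when y is itself a prime 3 mod 4, a squarefree l either avoids y or is
-- y times a number avoiding it, which accounts for the two summands of 1 + 1/y.
∑three≤eulerProduct : ∀ y n → ∑[ l < n ] 𝟙 (three<? y l) * inv l ≤ eulerProduct y
∑three≤eulerProduct zero n = ≤-trans (∑-mono n (λ l _ → only-1 l)) (≤-trans (∑-δ-const n 1 1ℚ 0≤1) ≤-refl)
  where
  only-1 : ∀ l → 𝟙 (three<? 0 l) * inv l ≤ 𝟙 (1 ℕ.≟ l) * 1ℚ
  only-1 l with three<? 0 l
  ... | no  _  = ≤-trans (≤-reflexive (*-zeroˡ (inv l))) (0≤* (0≤𝟙 (1 ℕ.≟ l)) 0≤1)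
  ... | yes sl with 1 ℕ.≟ l
  ...   | yes refl = ≤-reflexive (cong (1ℚ *_) inv-1)
  ...   | no  1≢l  = let p , pp , p∣l = prime-divisor l (ℕ.≤∧≢⇒< (SF⇒>0 sl) 1≢l) in contradiction (proj₂ (primes sl p pp p∣l)) λ ()
∑three≤eulerProduct (suc y) n with threePrime? y
... | no ¬three = ≤-trans (∑-mono n (λ l _ → *-monoʳ (0≤inv l) (𝟙-mono (three<? (suc y) l) (three<? y l) (SF-⊆ smaller)))) (∑three≤eulerProduct y n)
  where
  smaller : ∀ {p l} → Prime p → p ∣ l → Three< (suc y) p → Three< y p
  smaller pp _ (p≡3 , p≤y) = p≡3 , ℕ.≤∧≢⇒< (ℕ.s≤s⁻¹ p≤y) (λ { refl → ¬three (pp , p≡3) })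
... | yes (py , y≡3) = begin
  ∑[ l < n ] 𝟙 (three<? (suc y) l) * inv l
    ≤⟨ ∑-cover₂ n _ 2 n φ g 0≤g cover ⟩
  0ℚ + ∑ n (g 0) + ∑ n (g 1)
    ≡⟨ cong (λ t → 0ℚ + ∑ n (g 0) + t) (sym (∑-*ˡ n (inv y) (g 0))) ⟩
  0ℚ + ∑ n (g 0) + inv y * ∑ n (g 0)
    ≡⟨ solve 2 (λ s v → con 0ℚ :+ s :+ v :* s := (con 1ℚ :+ v) :* s) refl (∑ n (g 0)) (inv y) ⟩
  (1ℚ + inv y) * ∑ n (g 0)
    ≤⟨ *-monoˡ (0≤+ 0≤1 (0≤inv y)) (∑three≤eulerProduct y n) ⟩
  (1ℚ + inv y) * eulerProduct y ∎
  where
  open ≤-Reasoning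
  φ : ℕ → ℕ → ℕ
  φ zero    l = l
  φ (suc _) l = y ℕ.* l
  g : ℕ → ℕ → ℚ
  g zero    l = 𝟙 (three<? y l) * inv l
  g (suc _) l = inv y * (𝟙 (three<? y l) * inv l)
  0≤g : ∀ i l → 0ℚ ≤ g i l
  0≤g zero    l = 0≤term (three<? y l) l
  0≤g (suc _) l = 0≤* (0≤inv y) (0≤term (three<? y l) l)
  without-y : ∀ {l} → ¬ y ∣ l → SF (Three< (suc y)) l → SF (Three< y) l
  without-y {l} y∤l = SF-⊆ (λ {p} _ p∣l (p≡3 , p≤y) → p≡3 , ℕ.≤∧≢⇒< (ℕ.s≤s⁻¹ p≤y) (λ { refl → y∤l p∣l }))
  cover : ∀ m → m ℕ.< n → 𝟙 (three<? (suc y) m) * inv m ≤ 0ℚ ⊎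
    ∃ λ i → ∃ λ l → i ℕ.< 2 × l ℕ.< n × φ i l ≡ m × 𝟙 (three<? (suc y) m) * inv m ≤ g i l
  cover m m<n with three<? (suc y) m
  ... | no  _  = inj₁ (≤-reflexive (*-zeroˡ (inv m)))
  ... | yes sm with y ∣? m
  ...   | no y∤m = inj₂ (0 , m , s≤s z≤n , m<n , refl , ≤-reflexive (cong (_* inv m) (sym (𝟙-yes (three<? y m) (without-y y∤m sm)))))
  ...   | yes (divides l refl) = inj₂ (1 , l , s≤s (s≤s z≤n) , ℕ.≤-<-trans (ℕ.m≤m*n l y {{ℕ.>-nonZero (prime⇒>0 py)}}) m<n , ℕ.*-comm y l ,
            ≤-reflexive (trans (*-identityˡ (inv (l ℕ.* y))) (trans (inv-* l y) (trans (*-comm (inv l) (inv y))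
              (cong (inv y *_) (sym (trans (cong (_* inv l) (𝟙-yes (three<? y l) sl)) (*-identityˡ (inv l)))))))))
    where
    sl : SF (Three< y) l
    sl = without-y (SF-uncons py (subst (SF (Three< (suc y))) (ℕ.*-comm l y) sm)) (SF-∣ (m∣m*n y) sm)

-- Every m ≥ 1 is (i + 1)² a b with a and b squarefree, b composed of the primes 3 mod 4 and a of the others.
H≤ : ∀ x → H (suc x) ≤ ι 2 * (Sₐ x * eulerProduct (suc x))
H≤ x = begin
  H n
    ≤⟨ ∑-cover₃ n inv n n n (λ i a b → sq i ℕ.* (a ℕ.* b)) g 0≤g cover ⟩
  ∑[ i < n ] ∑[ a < n ] ∑[ b < n ] inv (sq i) * (A a * B b)
    ≡⟨ ∑-cong n (λ i → trans (∑-cong n (λ a → trans (sym (∑-*ˡ n (inv (sq i)) _)) (cong (inv (sq i) *_) (sym (∑-*ˡ n (A a) B))))) (sym (∑-*ˡ n (inv (sq i)) _))) ⟩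
  ∑[ i < n ] inv (sq i) * (∑[ a < n ] A a * ∑ n B)
    ≡⟨ trans (∑-cong n (λ i → cong (inv (sq i) *_) (sym (∑-*ʳ n (∑ n B) A)))) (sym (∑-*ʳ n (∑ n A * ∑ n B) _)) ⟩
  ∑ n (λ i → inv (sq i)) * (Sₐ x * ∑ n B)
    ≤⟨ *-mono-nonNeg (∑-nonNeg n (λ i → 0≤inv (sq i))) (0≤* (Sₐ-nonNeg x) (∑-nonNeg n (λ b → 0≤term (three<? n b) b)))
        (∑inv-sq≤2 n) (*-monoˡ (Sₐ-nonNeg x) (∑three≤eulerProduct n n)) ⟩
  ι 2 * (Sₐ x * eulerProduct n) ∎
  where
  open ≤-Reasoning
  n : ℕ
  n = suc x
  A B : ℕ → ℚ
  A a = 𝟙 (notThree? a) * inv a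
  B b = 𝟙 (three<? n b) * inv b
  g : ℕ → ℕ → ℕ → ℚ
  g i a b = inv (sq i) * (A a * B b)
  0≤g : ∀ i a b → 0ℚ ≤ g i a b
  0≤g i a b = 0≤* (0≤inv (sq i)) (0≤* (0≤term (notThree? a) a) (0≤term (three<? n b) b))
  cover : ∀ m → m ℕ.< n → inv m ≤ 0ℚ ⊎ ∃ λ i → ∃ λ a → ∃ λ b → i ℕ.< n × a ℕ.< n × b ℕ.< n × sq i ℕ.* (a ℕ.* b) ≡ m × inv m ≤ g i a b
  cover zero _ = inj₁ (≤-reflexive inv-0)
  cover m@(suc _) m<n with squarefree-split (λ p → ¬? (p % 4 ℕ.≟ 3)) m (s≤s z≤n)
  ... | zero  , a , b , () , _
  ... | suc i , a , b , eq , sa , sb = inj₂ (i , a , b , ℕ.<-trans (ℕ.n<1+n i) (below d≤m) , below (ℕ.≤-trans (ℕ.m≤m*n a b {{ℕ.>-nonZero (SF⇒>0 sb)}}) ab≤m) ,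
          below (ℕ.≤-trans (ℕ.m≤n*m b a {{ℕ.>-nonZero (SF⇒>0 sa)}}) ab≤m) , sym eq , ≤-reflexive (trans (cong inv eq) (trans (inv-* (sq i) (a ℕ.* b))
          (cong (inv (sq i) *_) (trans (inv-* a b) (cong₂ _*_ (sym (trans (cong (_* inv a) (𝟙-yes (notThree? a) sa)) (*-identityˡ (inv a))))
            (sym (trans (cong (_* inv b) (𝟙-yes (three<? n b) sb′)) (*-identityˡ (inv b))))))))))
    where
    d≤m : suc i ℕ.≤ m
    d≤m = proj₁ (proj₂ (root-bounds {suc i} (s≤s z≤n) eq))
    ab≤m : a ℕ.* b ℕ.≤ m
    ab≤m = proj₂ (proj₂ (root-bounds {suc i} (s≤s z≤n) eq))
    below : ∀ {k} → k ℕ.≤ m → k ℕ.< n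
    below k≤m = ℕ.≤-<-trans k≤m m<n
    sb′ : SF (Three< n) b
    sb′ = SF-⊆ three sb
      where
      three : ∀ {p} → Prime p → p ∣ b → ¬ (p % 4 ≢ 3) → Three< n p
      three {p} pp p∣b ¬¬3 with p % 4 ℕ.≟ 3
      ... | yes h = h , below (ℕ.≤-trans (∣⇒≤ {{ℕ.>-nonZero (SF⇒>0 sb)}} p∣b) (ℕ.≤-trans (ℕ.m≤n*m b a {{ℕ.>-nonZero (SF⇒>0 sa)}}) ab≤m))
      ... | no  h = contradiction h ¬¬3

-- For x = 2^l and s = `Sₐ x`, the bounds on H give l/2 ≤ 2 s E, and s² ≤ 8 len x ≤ 16 l. Hence l² ≤
-- 16 s² E² ≤ 16 · 16 l E², and one l cancels.
eulerProduct²≥ : ∀ l → 0 ℕ.< l → let E = eulerProduct (suc (2 ^ l)) in ι l ≤ ι 256 * (E * E)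
eulerProduct²≥ l 0<l = *-cancelˡ (0<ι 0<l) main
  where
  open ≤-Reasoning
  x : ℕ
  x = 2 ^ l
  E s : ℚ
  E = eulerProduct (suc x)
  s = Sₐ x
  l≤ : ι l ≤ ι 4 * (s * E)
  l≤ = begin
    ι l
      ≡⟨ sym (trans (solve 3 (λ t l h → t :* (l :* h) := l :* (t :* h)) refl (ι 2) (ι l) (inv 2)) (trans (cong (ι l *_) (ι*inv (s≤s z≤n))) (*-identityʳ (ι l)))) ⟩
    ι 2 * (ι l * inv 2)
      ≤⟨ *-monoˡ (0≤ι 2) (≤-trans (H-lower l) (≤-trans (≤-+ʳ (0≤inv x)) (H≤ x))) ⟩
    ι 2 * (ι 2 * (s * E))
      ≡⟨ trans (sym (*-assoc (ι 2) (ι 2) (s * E))) (cong (_* (s * E)) (sym (ι-* 2 2))) ⟩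
    ι 4 * (s * E) ∎
  lenx≤ : 8 ℕ.* len x ℕ.≤ 16 ℕ.* l
  lenx≤ = ℕ.≤-trans (ℕ.*-monoʳ-≤ 8 (ℕ.≤-trans (len-≤ x (suc l) (ℕ.^-monoʳ-< 2 (s≤s (s≤s z≤n)) (ℕ.n<1+n l))) (ℕ.+-monoˡ-≤ l 0<l)))
    (ℕ.≤-reflexive (form l))
    where
    form : ∀ l → 8 ℕ.* (l ℕ.+ l) ≡ 16 ℕ.* l
    form = solve-∀
  main : ι l * ι l ≤ ι l * (ι 256 * (E * E))
  main = begin
    ι l * ι l
      ≤⟨ *-mono-nonNeg (0≤ι l) (0≤ι l) l≤ l≤ ⟩
    ι 4 * (s * E) * (ι 4 * (s * E))
      ≡⟨ solve 3 (λ c s e → c :* (s :* e) :* (c :* (s :* e)) := c :* c :* (s :* s) :* (e :* e)) refl (ι 4) s E ⟩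
    ι 4 * ι 4 * (s * s) * (E * E)
      ≤⟨ *-monoʳ (0≤* (eulerProduct-nonNeg (suc x)) (eulerProduct-nonNeg (suc x)))
           (*-monoˡ (0≤* (0≤ι 4) (0≤ι 4)) (≤-trans (Sₐ²≤ x) (≤-trans (ι-mono lenx≤) (≤-reflexive (ι-* 16 l))))) ⟩
    ι 4 * ι 4 * (ι 16 * ι l) * (E * E)
      ≡⟨ solve 4 (λ c d l e → c :* c :* (d :* l) :* (e :* e) := l :* (c :* c :* d :* (e :* e))) refl (ι 4) (ι 16) (ι l) E ⟩
    ι l * (ι 4 * ι 4 * ι 16 * (E * E))
      ≡⟨ cong (λ t → ι l * (t * (E * E))) (trans (cong (_* ι 16) (sym (ι-* 4 4))) (sym (ι-* 16 16))) ⟩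
    ι l * (ι 256 * (E * E)) ∎

eulerProduct-unbounded : ∀ n → 0 ℕ.< n → ∃ λ y → ι n ≤ eulerProduct y
eulerProduct-unbounded n 0<n = at (256 ℕ.* (n ℕ.* n)) refl
  where
  open ≤-Reasoning
  0<256 : 0 ℕ.< 256
  0<256 = s≤s z≤n
  at : ∀ l → l ≡ 256 ℕ.* (n ℕ.* n) → ∃ λ y → ι n ≤ eulerProduct y
  at l l≡ = suc (2 ^ l) , square-cancel-≤ (eulerProduct-nonNeg (suc (2 ^ l))) (*-cancelˡ (0<ι 0<256) (begin
    ι 256 * (ι n * ι n)
      ≡⟨ trans (cong (ι 256 *_) (sym (ι-* n n))) (trans (sym (ι-* 256 (n ℕ.* n))) (cong ι (sym l≡))) ⟩
    ι l
      ≤⟨ eulerProduct²≥ l (subst (0 ℕ.<_) (sym l≡) (ℕ.*-mono-< 0<256 (ℕ.*-mono-< 0<n 0<n))) ⟩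
    ι 256 * (E * E) ∎))
    where
    E : ℚ
    E = eulerProduct (suc (2 ^ l))

abstract
  -- With F = `gcdSum M`, an Euler product E ≥ K² gives (K F)² ≤ F² E ≤ M².
  gcdSum-small : ∀ K → 0 ℕ.< K → ∃ λ M → SF Three M × ι K * gcdSum M ≤ ι M
  gcdSum-small K 0<K = small (eulerProduct-unbounded (K ℕ.* K) (ℕ.*-mono-< 0<K 0<K))
    where
    open ≤-Reasoning
    small : (∃ λ y → ι (K ℕ.* K) ≤ eulerProduct y) → ∃ λ M → SF Three M × ι K * gcdSum M ≤ ι M
    small (y , K²≤E) = M , modulus-three y , square-cancel-≤ (0≤ι M) (begin
      ι K * F * (ι K * F)
        ≡⟨ solve 2 (λ k f → k :* f :* (k :* f) := f :* f :* (k :* k)) refl (ι K) F ⟩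
      F * F * (ι K * ι K)
        ≤⟨ *-monoˡ (0≤* (gcdSum-nonNeg M) (gcdSum-nonNeg M)) (≤-trans (≤-reflexive (sym (ι-* K K))) K²≤E) ⟩
      F * F * eulerProduct y
        ≤⟨ gcdSum²*eulerProduct≤ y ⟩
      ι M * ι M ∎)
      where
      M : ℕ
      M = modulus y
      F : ℚ
      F = gcdSum M

-- Counting in residue classes

module _ {M : ℕ} {{M≢0 : ℕ.NonZero M}} where

  %≡⇒ : ∀ {a b} → a % M ≡ b % M → ∃ λ i → ∃ λ j → a ℕ.+ i ℕ.* M ≡ b ℕ.+ j ℕ.* M
  %≡⇒ {a} {b} h = b ℕ./ M , a ℕ./ M , (begin
    a ℕ.+ b ℕ./ M ℕ.* M                            ≡⟨ cong (ℕ._+ b ℕ./ M ℕ.* M) (ℕ.m≡m%n+[m/n]*n a M) ⟩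
    a % M ℕ.+ a ℕ./ M ℕ.* M ℕ.+ b ℕ./ M ℕ.* M      ≡⟨ cong (λ t → t ℕ.+ a ℕ./ M ℕ.* M ℕ.+ b ℕ./ M ℕ.* M) h ⟩
    b % M ℕ.+ a ℕ./ M ℕ.* M ℕ.+ b ℕ./ M ℕ.* M      ≡⟨ form (b % M) (a ℕ./ M ℕ.* M) (b ℕ./ M ℕ.* M) ⟩
    b % M ℕ.+ b ℕ./ M ℕ.* M ℕ.+ a ℕ./ M ℕ.* M      ≡⟨ cong (ℕ._+ a ℕ./ M ℕ.* M) (ℕ.m≡m%n+[m/n]*n b M) ⟨
    b ℕ.+ a ℕ./ M ℕ.* M                            ∎)
    where
    open ≡-Reasoning
    form : ∀ r p q → r ℕ.+ p ℕ.+ q ≡ r ℕ.+ q ℕ.+ p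
    form = solve-∀

  ⇒%≡ : ∀ a b i j → a ℕ.+ i ℕ.* M ≡ b ℕ.+ j ℕ.* M → a % M ≡ b % M
  ⇒%≡ a b i j h = trans (sym (ℕ.[m+kn]%n≡m%n a i M)) (trans (cong (_% M) h) (ℕ.[m+kn]%n≡m%n b j M))

≤⇒∃+ : ∀ {a b} → a ℕ.≤ b → ∃ λ k → b ≡ a ℕ.+ k
≤⇒∃+ {a} {b} a≤b = b ℕ.∸ a , sym (ℕ.m+[n∸m]≡n a≤b)

module _ (M g M′ s′ m : ℕ) {{M≢0 : ℕ.NonZero M}} {{g≢0 : ℕ.NonZero g}} {{M′≢0 : ℕ.NonZero M′}}
         (2∤M : ¬ 2 ∣ M) (M≡ : M ≡ g ℕ.* M′) (coprime : Coprime M′ s′) where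

  private
    s : ℕ
    s = g ℕ.* s′

    Sol : ℕ → Set
    Sol z = (m ℕ.+ z ℕ.* z) % M ≡ (z ℕ.+ s) ℕ.* (z ℕ.+ s) % M

    sol? : ∀ z → Dec (Sol z)
    sol? z = (m ℕ.+ z ℕ.* z) % M ℕ.≟ (z ℕ.+ s) ℕ.* (z ℕ.+ s) % M

    expand : ∀ z → Sol z → ∃ λ i → ∃ λ j → m ℕ.+ i ℕ.* M ≡ s ℕ.* (s ℕ.+ 2 ℕ.* z) ℕ.+ j ℕ.* M
    expand z h = let i , j , eq = %≡⇒ {a = m ℕ.+ z ℕ.* z} h in
      i , j , ℕ.+-cancelˡ-≡ (z ℕ.* z) _ _ (trans (left m z (i ℕ.* M)) (trans eq (right z s (j ℕ.* M))))
      where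
      left : ∀ m z i → z ℕ.* z ℕ.+ (m ℕ.+ i) ≡ m ℕ.+ z ℕ.* z ℕ.+ i
      left = solve-∀
      right : ∀ z s j → (z ℕ.+ s) ℕ.* (z ℕ.+ s) ℕ.+ j ≡ z ℕ.* z ℕ.+ (s ℕ.* (s ℕ.+ 2 ℕ.* z) ℕ.+ j)
      right = solve-∀

    g∣M : g ∣ M
    g∣M = subst (g ∣_) (sym M≡) (m∣m*n M′)

    -- Subtracting the congruences m ≡ s (s + 2z) for z and for z + δ leaves M ∣ 2 s δ. The 2 goes
    -- because M is odd, then g cancels, and s′ is coprime to M′.
    difference : ∀ z δ → Sol z → Sol (z ℕ.+ δ) → M′ ∣ δ
    difference z δ h h′ = coprime-divisor coprime
      (*-cancelˡ-∣ g (subst₂ _∣_ M≡ (ℕ.*-assoc g s′ δ)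
        (coprime-divisor (Coprimality.sym (prime∤⇒coprime prime[2] 2∤M)) M∣2sδ)))
      where
      M∣2sδ : M ∣ 2 ℕ.* (s ℕ.* δ)
      M∣2sδ with expand z h | expand (z ℕ.+ δ) h′
      ... | i , j , eq | i′ , j′ , eq′ = ∣m+n∣m⇒∣n
        (subst (M ∣_) (ℕ.+-cancelˡ-≡ (s ℕ.* (s ℕ.+ 2 ℕ.* z)) _ _ (begin
          s ℕ.* (s ℕ.+ 2 ℕ.* z) ℕ.+ (j ℕ.+ i′) ℕ.* M
            ≡⟨ f₁ (s ℕ.* (s ℕ.+ 2 ℕ.* z)) j i′ M ⟩
          s ℕ.* (s ℕ.+ 2 ℕ.* z) ℕ.+ j ℕ.* M ℕ.+ i′ ℕ.* M
            ≡⟨ cong (ℕ._+ i′ ℕ.* M) eq ⟨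
          m ℕ.+ i ℕ.* M ℕ.+ i′ ℕ.* M
            ≡⟨ f₂ m (i ℕ.* M) (i′ ℕ.* M) ⟩
          m ℕ.+ i′ ℕ.* M ℕ.+ i ℕ.* M
            ≡⟨ cong (ℕ._+ i ℕ.* M) eq′ ⟩
          s ℕ.* (s ℕ.+ 2 ℕ.* (z ℕ.+ δ)) ℕ.+ j′ ℕ.* M ℕ.+ i ℕ.* M
            ≡⟨ f₃ s z δ j′ i M ⟩
          s ℕ.* (s ℕ.+ 2 ℕ.* z) ℕ.+ ((j′ ℕ.+ i) ℕ.* M ℕ.+ 2 ℕ.* (s ℕ.* δ)) ∎)) (n∣m*n (j ℕ.+ i′)))
        (n∣m*n (j′ ℕ.+ i))
        where
        open ≡-Reasoning
        f₁ : ∀ a j i M → a ℕ.+ (j ℕ.+ i) ℕ.* M ≡ a ℕ.+ j ℕ.* M ℕ.+ i ℕ.* M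
        f₁ = solve-∀
        f₂ : ∀ a b c → a ℕ.+ b ℕ.+ c ≡ a ℕ.+ c ℕ.+ b
        f₂ = solve-∀
        f₃ : ∀ s z δ j i M → s ℕ.* (s ℕ.+ 2 ℕ.* (z ℕ.+ δ)) ℕ.+ j ℕ.* M ℕ.+ i ℕ.* M ≡ s ℕ.* (s ℕ.+ 2 ℕ.* z) ℕ.+ ((j ℕ.+ i) ℕ.* M ℕ.+ 2 ℕ.* (s ℕ.* δ))
        f₃ = solve-∀

    shift-residue : ∀ z {δ} → M′ ∣ δ → z % M′ ≡ (z ℕ.+ δ) % M′
    shift-residue z (divides k refl) = sym (ℕ.[m+kn]%n≡m%n z k M′)

    same-residue-+ : ∀ {z z′} → (∃ λ δ → z′ ≡ z ℕ.+ δ) → Sol z → Sol z′ → z % M′ ≡ z′ % M′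
    same-residue-+ {z} (δ , refl) h h′ = shift-residue z (difference z δ h h′)

    same-residue : ∀ z z′ → Sol z → Sol z′ → z % M′ ≡ z′ % M′
    same-residue z z′ h h′ with ℕ.≤-total z z′
    ... | inj₁ z≤z′ = same-residue-+ (≤⇒∃+ z≤z′) h h′
    ... | inj₂ z′≤z = sym (same-residue-+ (≤⇒∃+ z′≤z) h′ h)

    residue-count : ∀ c → ∑[ z < M ] 𝟙 (z % M′ ℕ.≟ c) ≤ ι g
    residue-count c = ≤-trans (≤-reflexive (trans (cong (λ t → ∑ t (λ z → 𝟙 (z % M′ ℕ.≟ c))) M≡)
        (∑-periodic g M′ (λ z → 𝟙 (z % M′ ℕ.≟ c)) (λ z → cong (λ t → 𝟙 (t ℕ.≟ c)) (trans (cong (_% M′) (ℕ.+-comm M′ z)) (ℕ.[m+n]%n≡m%n z M′))))))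
      (≤-trans (*-monoˡ (0≤ι g) (≤-trans (≤-reflexive (∑-cong< M′ (λ z z<M′ → trans (𝟙-cong (z % M′ ℕ.≟ c) (c ℕ.≟ z)
          (λ h → trans (sym h) (ℕ.m<n⇒m%n≡m z<M′)) (λ { refl → ℕ.m<n⇒m%n≡m z<M′ })) (sym (*-identityʳ (𝟙 (c ℕ.≟ z)))))))
        (∑-δ-const M′ c 1ℚ 0≤1))) (≤-reflexive (*-identityʳ (ι g))))

  -- m ≡ s (s + 2z) (mod M) forces gcd(s, M) ∣ m and determines z modulo M / gcd(s, M).
  solution-count : ∑[ z < M ] 𝟙 ((m ℕ.+ z ℕ.* z) % M ℕ.≟ (z ℕ.+ s) ℕ.* (z ℕ.+ s) % M) ≤ ι g * 𝟙 (g ∣? m)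
  solution-count = count (ℕ.anyUpTo? sol? M)
    where
    count : Dec (∃ λ z → z ℕ.< M × Sol z) → ∑[ z < M ] 𝟙 (sol? z) ≤ ι g * 𝟙 (g ∣? m)
    count (no none) = ≤-trans (≤-reflexive (∑-zero M (λ z z<M → 𝟙-no (sol? z) (λ h → none (z , z<M , h))))) (0≤* (0≤ι g) (0≤𝟙 (g ∣? m)))
    count (yes (z₀ , _ , h₀)) = ≤-trans (∑-mono M (λ z _ → 𝟙-mono (sol? z) (z % M′ ℕ.≟ z₀ % M′) (λ h → same-residue z z₀ h h₀)))
          (≤-trans (residue-count (z₀ % M′)) (≤-reflexive (sym (trans (cong (ι g *_) (𝟙-yes (g ∣? m) g∣m)) (*-identityʳ (ι g))))))
      where
      g∣m : g ∣ m
      g∣m = let i , j , eq = expand z₀ h₀ in ∣m+n∣m⇒∣n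
        (subst (g ∣_) (trans (sym eq) (ℕ.+-comm m (i ℕ.* M))) (∣m∣n⇒∣m+n (∣m⇒∣m*n (s ℕ.+ 2 ℕ.* z₀) (m∣m*n s′)) (∣n⇒∣m*n j g∣M)))
        (∣n⇒∣m*n i g∣M)

square-difference-count : ∀ M s m {{_ : ℕ.NonZero M}} → ¬ 2 ∣ M →
  ∑[ z < M ] 𝟙 ((m ℕ.+ z ℕ.* z) % M ℕ.≟ (z ℕ.+ s) ℕ.* (z ℕ.+ s) % M) ≤ ι (gcd s M) * 𝟙 (gcd s M ∣? m)
square-difference-count M s m 2∤M = at (gcd s M) (gcd[m,n]∣m s M) (gcd[m,n]∣n s M) (Coprimality.coprime-/gcd s M)
  where
  at : ∀ g → (g∣s : g ∣ s) → (g∣M : g ∣ M) → (∀ {{_ : ℕ.NonZero g}} → Coprime (s ℕ./ g) (M ℕ./ g)) →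
    ∑[ z < M ] 𝟙 ((m ℕ.+ z ℕ.* z) % M ℕ.≟ (z ℕ.+ s) ℕ.* (z ℕ.+ s) % M) ≤ ι g * 𝟙 (g ∣? m)
  at zero    g∣s g∣M coprime = contradiction (0∣⇒≡0 g∣M) (ℕ.≢-nonZero⁻¹ M)
  at g@(suc _) g∣s g∣M coprime = subst (λ s → ∑[ z < M ] 𝟙 ((m ℕ.+ z ℕ.* z) % M ℕ.≟ (z ℕ.+ s) ℕ.* (z ℕ.+ s) % M) ≤ ι g * 𝟙 (g ∣? m)) (sym s≡)
    (solution-count M g (M ℕ./ g) (s ℕ./ g) m {{M′≢0 = M/g≢0}} 2∤M M≡ (Coprimality.sym coprime))
    where
    M≡ : M ≡ g ℕ.* (M ℕ./ g)
    M≡ = sym (trans (ℕ.*-comm g (M ℕ./ g)) (ℕ.m/n*n≡m g∣M))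
    s≡ : s ≡ g ℕ.* (s ℕ./ g)
    s≡ = sym (trans (ℕ.*-comm g (s ℕ./ g)) (ℕ.m/n*n≡m g∣s))
    M/g≢0 : ℕ.NonZero (M ℕ./ g)
    M/g≢0 = ℕ.≢-nonZero (λ h → ℕ.≢-nonZero⁻¹ M (trans M≡ (trans (cong (g ℕ.*_) h) (ℕ.*-zeroʳ g))))

-- The inverse is ((M + 1) / 2)³, since (M + 1)³ = 1 + (3 + 3M + M²) M.
odd⇒8-invertible : ∀ {M} → ¬ 2 ∣ M → ∃ λ e → ∃ λ f → 8 ℕ.* e ≡ 1 ℕ.+ f ℕ.* M
odd⇒8-invertible {M} 2∤M with even-or-odd M
... | h , inj₁ refl = contradiction (m∣m*n h) 2∤M
... | h , inj₂ refl = (1 ℕ.+ h) ℕ.* (1 ℕ.+ h) ℕ.* (1 ℕ.+ h) , 3 ℕ.+ 3 ℕ.* suc (2 ℕ.* h) ℕ.+ suc (2 ℕ.* h) ℕ.* suc (2 ℕ.* h) , form h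
  where
  form : ∀ h → 8 ℕ.* ((1 ℕ.+ h) ℕ.* (1 ℕ.+ h) ℕ.* (1 ℕ.+ h)) ≡ 1 ℕ.+ (3 ℕ.+ 3 ℕ.* suc (2 ℕ.* h) ℕ.+ suc (2 ℕ.* h) ℕ.* suc (2 ℕ.* h)) ℕ.* suc (2 ℕ.* h)
  form = solve-∀

progression-hits : ∀ {M} {{_ : ℕ.NonZero M}} → ¬ 2 ∣ M → ∀ base v → ∃ λ t → t ℕ.< M × (base ℕ.+ 8 ℕ.* t) % M ≡ v % M
progression-hits {M@(suc M-1)} 2∤M base v = hit (odd⇒8-invertible 2∤M)
  where
  hit : (∃ λ e → ∃ λ f → 8 ℕ.* e ≡ 1 ℕ.+ f ℕ.* M) → ∃ λ t → t ℕ.< M × (base ℕ.+ 8 ℕ.* t) % M ≡ v % M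
  -- The solution is t ≡ e (v - base), with (M - 1) base in place of -base.
  hit (e , f , 8e≡) = t , ℕ.m%n<n w M , ⇒%≡ (base ℕ.+ 8 ℕ.* t) v (8 ℕ.* (w ℕ./ M)) (base ℕ.+ f ℕ.* (v ℕ.+ M-1 ℕ.* base)) (begin
    base ℕ.+ 8 ℕ.* t ℕ.+ 8 ℕ.* (w ℕ./ M) ℕ.* M               ≡⟨ f₁ base t (w ℕ./ M) M ⟩
    base ℕ.+ 8 ℕ.* (t ℕ.+ w ℕ./ M ℕ.* M)                     ≡⟨ cong (λ x → base ℕ.+ 8 ℕ.* x) (ℕ.m≡m%n+[m/n]*n w M) ⟨
    base ℕ.+ 8 ℕ.* (e ℕ.* (v ℕ.+ M-1 ℕ.* base))              ≡⟨ cong (base ℕ.+_) (ℕ.*-assoc 8 e (v ℕ.+ M-1 ℕ.* base)) ⟨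
    base ℕ.+ 8 ℕ.* e ℕ.* (v ℕ.+ M-1 ℕ.* base)                ≡⟨ cong (λ x → base ℕ.+ x ℕ.* (v ℕ.+ M-1 ℕ.* base)) 8e≡ ⟩
    base ℕ.+ (1 ℕ.+ f ℕ.* M) ℕ.* (v ℕ.+ M-1 ℕ.* base)        ≡⟨ f₂ base f M-1 v ⟩
    v ℕ.+ (base ℕ.+ f ℕ.* (v ℕ.+ M-1 ℕ.* base)) ℕ.* M        ∎)
    where
    open ≡-Reasoning
    w t : ℕ
    w = e ℕ.* (v ℕ.+ M-1 ℕ.* base)
    t = w % M
    f₁ : ∀ b t q M → b ℕ.+ 8 ℕ.* t ℕ.+ 8 ℕ.* q ℕ.* M ≡ b ℕ.+ 8 ℕ.* (t ℕ.+ q ℕ.* M)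
    f₁ = solve-∀
    f₂ : ∀ b f k v → b ℕ.+ (1 ℕ.+ f ℕ.* suc k) ℕ.* (v ℕ.+ k ℕ.* b) ≡ v ℕ.+ (b ℕ.+ f ℕ.* (v ℕ.+ k ℕ.* b)) ℕ.* suc k
    f₂ = solve-∀

-- The weighted count in an arithmetic progression

module _ (M base J Q x r : ℕ) {{M≢0 : ℕ.NonZero M}} (sfM : SF Three M) where

  private
    T : ℕ
    T = J ℕ.* M

    n : ℕ → ℕ
    n t = base ℕ.+ 8 ℕ.* t

    weight : ℕ → ℚ
    weight k = ∑[ u < M ] 𝟙 (k % M ℕ.≟ u ℕ.* u % M)

    0≤weight : ∀ k → 0ℚ ≤ weight k
    0≤weight k = ∑-nonNeg M (λ u → 0≤𝟙 (k % M ℕ.≟ u ℕ.* u % M))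

    weight-cong : ∀ {k l} → k % M ≡ l % M → weight k ≡ weight l
    weight-cong h = ∑-cong M (λ u → cong (λ t → 𝟙 (t ℕ.≟ u ℕ.* u % M)) h)

    2∤M : ¬ 2 ∣ M
    2∤M h = contradiction (primes sfM 2 prime[2] h) λ ()

  Represents : ℕ → ℕ → Set
  Represents k z = z ℕ.* z ℕ.≤ k × 0 ℕ.< k ℕ.∸ z ℕ.* z × IsSumOfTwoSquares (k ℕ.∸ z ℕ.* z)

  represents? : ∀ k z → Dec (Represents k z)
  represents? k z = (z ℕ.* z ℕ.≤? k) ×-dec twoSquares? (k ℕ.∸ z ℕ.* z)

  -- The range of z is a whole number of periods modulo M, so that `residues` can reduce it to one
  -- period.
  Represented : ℕ → Set
  Represented k = ∃ λ z → z ℕ.< Q ℕ.* M × Represents k z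

  represented? : ∀ k → Dec (Represented k)
  represented? k = ℕ.anyUpTo? (represents? k) (Q ℕ.* M)

  unrepresented : ℚ
  unrepresented = ∑[ t < T ] 𝟙 (¬? (represented? (n t)))

  private
    -- As 8 is invertible modulo M, any M consecutive terms of the progression meet the residue of
    -- u²; each u therefore contributes at least J.
    total-weight : ι J * ι M ≤ ∑[ t < T ] weight (n t)
    total-weight = begin
      ι J * ι M                                                    ≡⟨ *-comm (ι J) (ι M) ⟩
      ι M * ι J                                                    ≡⟨ ∑-const M (ι J) ⟨
      ∑[ u < M ] ι J                                               ≤⟨ ∑-mono M (λ u _ → hits u) ⟩
      ∑[ u < M ] ∑[ t < T ] 𝟙 (n t % M ℕ.≟ u ℕ.* u % M)            ≡⟨ ∑-swap M T _ ⟩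
      ∑[ t < T ] weight (n t)                                      ∎
      where
      open ≤-Reasoning
      periodic : ∀ t → n (M ℕ.+ t) % M ≡ n t % M
      periodic t = trans (cong (_% M) (form base M t)) (ℕ.[m+kn]%n≡m%n (n t) 8 M)
        where
        form : ∀ b M t → b ℕ.+ 8 ℕ.* (M ℕ.+ t) ≡ b ℕ.+ 8 ℕ.* t ℕ.+ 8 ℕ.* M
        form = solve-∀
      hits : ∀ u → ι J ≤ ∑[ t < T ] 𝟙 (n t % M ℕ.≟ u ℕ.* u % M)
      hits u = let t , t<M , eq = progression-hits 2∤M base (u ℕ.* u) in begin
        ι J
          ≡⟨ *-identityʳ (ι J) ⟨
        ι J * 1ℚ
          ≡⟨ cong (ι J *_) (𝟙-yes (n t % M ℕ.≟ u ℕ.* u % M) eq) ⟨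
        ι J * 𝟙 (n t % M ℕ.≟ u ℕ.* u % M)
          ≤⟨ *-monoˡ (0≤ι J) (∑-term M _ (λ t → 0≤𝟙 (n t % M ℕ.≟ u ℕ.* u % M)) t<M) ⟩
        ι J * (∑[ t < M ] 𝟙 (n t % M ℕ.≟ u ℕ.* u % M))
          ≡⟨ ∑-periodic J M _ (λ t → cong (λ s → 𝟙 (s ℕ.≟ u ℕ.* u % M)) (periodic t)) ⟨
        ∑[ t < T ] 𝟙 (n t % M ℕ.≟ u ℕ.* u % M) ∎

    weight≤M : ∀ k → weight k ≤ ι M
    weight≤M k = ≤-trans (∑-mono M (λ u _ → 𝟙≤1 (k % M ℕ.≟ u ℕ.* u % M))) (≤-reflexive (trans (∑-const M 1ℚ) (*-identityʳ (ι M))))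

    -- An unrepresented k receives the trivial bound M, which is where the density loses a factor M.
    -- A represented k occurs for at least one z, and counting it for several is harmless.
    weight-split : ∀ k → weight k ≤ 𝟙 (¬? (represented? k)) * ι M + (∑[ z < Q ℕ.* M ] 𝟙 (represents? k z) * weight k)
    weight-split k = split (represented? k)
      where
      rest : ℚ
      rest = ∑[ z < Q ℕ.* M ] 𝟙 (represents? k z) * weight k
      0≤rest : ∀ z → 0ℚ ≤ 𝟙 (represents? k z) * weight k
      0≤rest z = 0≤* (0≤𝟙 (represents? k z)) (0≤weight k)
      split : (d : Dec (Represented k)) → weight k ≤ 𝟙 (¬? d) * ι M + rest
      split (no  _) = ≤-trans (weight≤M k) (≤-trans (≤-reflexive (sym (*-identityˡ (ι M)))) (≤-+ʳ (∑-nonNeg (Q ℕ.* M) 0≤rest)))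
      split (yes (z , z<QM , h)) = ≤-trans (≤-reflexive (sym (trans (cong (_* weight k) (𝟙-yes (represents? k z) h)) (*-identityˡ (weight k)))))
        (≤-trans (∑-term (Q ℕ.* M) _ 0≤rest z<QM) (≤-+ˡ (≤-reflexive (sym (*-zeroˡ (ι M))))))

    -- Substituting u = z + s, as u runs over a full period, brings the pairs (z, u) into the form
    -- of `square-difference-count`.
    residues : ∀ m → ∑[ z < Q ℕ.* M ] weight (m ℕ.+ z ℕ.* z) ≤ ι Q * (∑[ s < M ] ι (gcd s M) * 𝟙 (gcd s M ∣? m))
    residues m = begin
      ∑[ z < Q ℕ.* M ] weight (m ℕ.+ z ℕ.* z)
        ≡⟨ ∑-periodic Q M _ (λ z → weight-cong (periodic z)) ⟩
      ι Q * (∑[ z < M ] weight (m ℕ.+ z ℕ.* z))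
        ≡⟨ cong (ι Q *_) (trans (∑-cong M (λ z → sym (shift z))) (∑-swap M M _)) ⟩
      ι Q * (∑[ s < M ] ∑[ z < M ] 𝟙 ((m ℕ.+ z ℕ.* z) % M ℕ.≟ (z ℕ.+ s) ℕ.* (z ℕ.+ s) % M))
        ≤⟨ *-monoˡ (0≤ι Q) (∑-mono M (λ s _ → square-difference-count M s m 2∤M)) ⟩
      ι Q * (∑[ s < M ] ι (gcd s M) * 𝟙 (gcd s M ∣? m)) ∎
      where
      open ≤-Reasoning
      periodic : ∀ z → (m ℕ.+ (M ℕ.+ z) ℕ.* (M ℕ.+ z)) % M ≡ (m ℕ.+ z ℕ.* z) % M
      periodic z = trans (cong (_% M) (form m M z)) (ℕ.[m+kn]%n≡m%n (m ℕ.+ z ℕ.* z) (M ℕ.+ 2 ℕ.* z) M)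
        where
        form : ∀ m M z → m ℕ.+ (M ℕ.+ z) ℕ.* (M ℕ.+ z) ≡ m ℕ.+ z ℕ.* z ℕ.+ (M ℕ.+ 2 ℕ.* z) ℕ.* M
        form = solve-∀
      shift : ∀ z → ∑[ s < M ] 𝟙 ((m ℕ.+ z ℕ.* z) % M ℕ.≟ (z ℕ.+ s) ℕ.* (z ℕ.+ s) % M) ≡ weight (m ℕ.+ z ℕ.* z)
      shift z = ∑-shift M (λ u → 𝟙 ((m ℕ.+ z ℕ.* z) % M ℕ.≟ u ℕ.* u % M))
        (λ u → cong (λ t → 𝟙 ((m ℕ.+ z ℕ.* z) % M ℕ.≟ t)) (trans (cong (_% M) (form M u)) (ℕ.[m+kn]%n≡m%n (u ℕ.* u) (M ℕ.+ 2 ℕ.* u) M))) z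
        where
        form : ∀ M u → (M ℕ.+ u) ℕ.* (M ℕ.+ u) ≡ u ℕ.* u ℕ.+ (M ℕ.+ 2 ℕ.* u) ℕ.* M
        form = solve-∀

    module _ (in-range : base ℕ.+ 8 ℕ.* T ℕ.≤ x) where

      -- Change of variable from t to m = n t - z², with inverse t = (m + z² - base) / 8. The bound
      -- then runs over all m ≤ x, without the condition modulo 8.
      represented-weight : ∀ z → ∑[ t < T ] 𝟙 (represents? (n t) z) * weight (n t) ≤ ∑[ m < suc x ] 𝟙 (twoSquares? m) * weight (m ℕ.+ z ℕ.* z)
      represented-weight z = ∑-cover T _ (suc x) (λ m → (m ℕ.+ z ℕ.* z ℕ.∸ base) ℕ./ 8) _ (λ m → 0≤* (0≤𝟙 (twoSquares? m)) (0≤weight (m ℕ.+ z ℕ.* z))) cover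
        where
        cover : ∀ t → t ℕ.< T → 𝟙 (represents? (n t) z) * weight (n t) ≤ 0ℚ ⊎
          ∃ λ m → m ℕ.< suc x × (m ℕ.+ z ℕ.* z ℕ.∸ base) ℕ./ 8 ≡ t × 𝟙 (represents? (n t) z) * weight (n t) ≤ 𝟙 (twoSquares? m) * weight (m ℕ.+ z ℕ.* z)
        cover t t<T = by (represents? (n t) z)
          where
          m : ℕ
          m = n t ℕ.∸ z ℕ.* z
          by : (d : Dec (Represents (n t) z)) → 𝟙 d * weight (n t) ≤ 0ℚ ⊎
            ∃ λ m → m ℕ.< suc x × (m ℕ.+ z ℕ.* z ℕ.∸ base) ℕ./ 8 ≡ t × 𝟙 d * weight (n t) ≤ 𝟙 (twoSquares? m) * weight (m ℕ.+ z ℕ.* z)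
          by (no  _) = inj₁ (≤-reflexive (*-zeroˡ (weight (n t))))
          by (yes (z²≤n , h)) = inj₂ (m ,
              s≤s (ℕ.≤-trans (ℕ.m∸n≤m (n t) (z ℕ.* z)) (ℕ.≤-trans (ℕ.+-monoʳ-≤ base (ℕ.*-monoʳ-≤ 8 (ℕ.<⇒≤ t<T))) in-range)) ,
              trans (cong (λ k → (k ℕ.∸ base) ℕ./ 8) m+z²) (trans (cong (ℕ._/ 8) (trans (ℕ.m+n∸m≡n base (8 ℕ.* t)) (ℕ.*-comm 8 t))) (ℕ.m*n/n≡m t 8)) ,
              ≤-reflexive (cong₂ _*_ (sym (𝟙-yes (twoSquares? m) h)) (cong weight (sym m+z²))))
            where
            m+z² : m ℕ.+ z ℕ.* z ≡ n t
            m+z² = ℕ.m∸n+n≡m z²≤n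

      module _ (r²≤ : ∀ y → x ℕ.< suc y ℕ.* (M ℕ.* M) → r ℕ.* r ℕ.≤ len y) where

        -- The factor g for the solutions z meets the 1/g² of `twoSquares-multiples`, leaving 1/g.
        by-gcd : ∀ s → ι r * (∑[ m < suc x ] 𝟙 (twoSquares? m) * (ι (gcd s M) * 𝟙 (gcd s M ∣? m))) ≤ ι 74 * ι x * inv (gcd s M)
        by-gcd s = begin
          ι r * (∑[ m < suc x ] 𝟙 (twoSquares? m) * (ι g * 𝟙 (g ∣? m)))
            ≡⟨ cong (ι r *_) (trans (∑-cong (suc x) (λ m → trans
                 (solve 3 (λ a b c → a :* (b :* c) := b :* (a :* c)) refl (𝟙 (twoSquares? m)) (ι g) (𝟙 (g ∣? m)))
                 (cong (ι g *_) (𝟙-× (twoSquares? m) (g ∣? m))))) (sym (∑-*ˡ (suc x) (ι g) _))) ⟩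
          ι r * (ι g * B)
            ≡⟨ solve 3 (λ a b c → a :* (b :* c) := b :* (a :* c)) refl (ι r) (ι g) B ⟩
          ι g * (ι r * B)
            ≤⟨ *-monoˡ (0≤ι g) (twoSquares-multiples x g r (SF-∣ g∣M sfM)
                 (λ y h → r²≤ y (ℕ.<-≤-trans h (ℕ.*-monoʳ-≤ (suc y) (ℕ.*-mono-≤ g≤M g≤M))))) ⟩
          ι g * (ι 74 * (ι x * (inv g * inv g)))
            ≡⟨ solve 4 (λ g c x v → g :* (c :* (x :* (v :* v))) := g :* v :* (c :* x :* v)) refl (ι g) (ι 74) (ι x) (inv g) ⟩
          ι g * inv g * (ι 74 * ι x * inv g)
            ≡⟨ trans (cong (_* (ι 74 * ι x * inv g)) (ι*inv 0<g)) (*-identityˡ (ι 74 * ι x * inv g)) ⟩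
          ι 74 * ι x * inv g ∎
          where
          open ≤-Reasoning
          g : ℕ
          g = gcd s M
          B : ℚ
          B = ∑[ m < suc x ] 𝟙 (twoSquares? m ×-dec (g ∣? m))
          g∣M : g ∣ M
          g∣M = gcd[m,n]∣n s M
          g≤M : g ℕ.≤ M
          g≤M = ∣⇒≤ g∣M
          0<g : 0 ℕ.< g
          0<g = SF⇒>0 (SF-∣ g∣M sfM)

        all-represented-weight : ι r * (∑[ t < T ] ∑[ z < Q ℕ.* M ] 𝟙 (represents? (n t) z) * weight (n t)) ≤ ι Q * (ι 74 * ι x * gcdSum M)
        all-represented-weight = begin
          ι r * (∑[ t < T ] ∑[ z < Q ℕ.* M ] 𝟙 (represents? (n t) z) * weight (n t))
            ≤⟨ *-monoˡ (0≤ι r) (≤-trans (≤-reflexive (∑-swap T (Q ℕ.* M) _)) (≤-trans (∑-mono (Q ℕ.* M) (λ z _ → represented-weight z)) (≤-reflexive (∑-swap (Q ℕ.* M) (suc x) _)))) ⟩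
          ι r * (∑[ m < suc x ] ∑[ z < Q ℕ.* M ] 𝟙 (twoSquares? m) * weight (m ℕ.+ z ℕ.* z))
            ≤⟨ *-monoˡ (0≤ι r) (∑-mono (suc x) (λ m _ → ≤-trans (≤-reflexive (sym (∑-*ˡ (Q ℕ.* M) (𝟙 (twoSquares? m)) _))) (*-monoˡ (0≤𝟙 (twoSquares? m)) (residues m)))) ⟩
          ι r * (∑[ m < suc x ] 𝟙 (twoSquares? m) * (ι Q * (∑[ s < M ] c s m)))
            ≡⟨ cong (ι r *_) (trans (∑-cong (suc x) (λ m → solve 3 (λ a b c → a :* (b :* c) := b :* (a :* c)) refl (𝟙 (twoSquares? m)) (ι Q) (∑ M (λ s → c s m)))) (sym (∑-*ˡ (suc x) (ι Q) _))) ⟩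
          ι r * (ι Q * (∑[ m < suc x ] 𝟙 (twoSquares? m) * (∑[ s < M ] c s m)))
            ≡⟨ solve 3 (λ a b c → a :* (b :* c) := b :* (a :* c)) refl (ι r) (ι Q) _ ⟩
          ι Q * (ι r * (∑[ m < suc x ] 𝟙 (twoSquares? m) * (∑[ s < M ] c s m)))
            ≡⟨ cong (λ t → ι Q * (ι r * t)) (trans (∑-cong (suc x) (λ m → ∑-*ˡ M (𝟙 (twoSquares? m)) _)) (∑-swap (suc x) M _)) ⟩
          ι Q * (ι r * (∑[ s < M ] ∑[ m < suc x ] 𝟙 (twoSquares? m) * c s m))
            ≡⟨ cong (ι Q *_) (∑-*ˡ M (ι r) _) ⟩
          ι Q * (∑[ s < M ] ι r * (∑[ m < suc x ] 𝟙 (twoSquares? m) * c s m))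
            ≤⟨ *-monoˡ (0≤ι Q) (∑-mono M (λ s _ → by-gcd s)) ⟩
          ι Q * (∑[ s < M ] ι 74 * ι x * inv (gcd s M))
            ≡⟨ cong (ι Q *_) (∑-*ˡ M (ι 74 * ι x) _) ⟨
          ι Q * (ι 74 * ι x * gcdSum M) ∎
          where
          open ≤-Reasoning
          c : ℕ → ℕ → ℚ
          c s m = ι (gcd s M) * 𝟙 (gcd s M ∣? m)

  weighted-count : base ℕ.+ 8 ℕ.* T ℕ.≤ x → (∀ y → x ℕ.< suc y ℕ.* (M ℕ.* M) → r ℕ.* r ℕ.≤ len y) →
    ι r * (ι J * ι M) ≤ ι r * (unrepresented * ι M) + ι Q * (ι 74 * ι x * gcdSum M)
  weighted-count in-range r²≤ = begin
    ι r * (ι J * ι M)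
      ≤⟨ *-monoˡ (0≤ι r) (≤-trans total-weight (∑-mono T (λ t _ → weight-split (n t)))) ⟩
    ι r * (∑[ t < T ] (𝟙 (¬? (represented? (n t))) * ι M + S t))
      ≡⟨ cong (ι r *_) (trans (∑-+ T _ S) (cong (_+ ∑ T S) (sym (∑-*ʳ T (ι M) _)))) ⟩
    ι r * (unrepresented * ι M + ∑ T S)
      ≡⟨ *-distribˡ-+ (ι r) (unrepresented * ι M) (∑ T S) ⟩
    ι r * (unrepresented * ι M) + ι r * ∑ T S
      ≤⟨ +-monoʳ-≤ (ι r * (unrepresented * ι M)) (all-represented-weight in-range r²≤) ⟩
    ι r * (unrepresented * ι M) + ι Q * (ι 74 * ι x * gcdSum M) ∎
    where
    open ≤-Reasoning
    S : ℕ → ℚ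
    S t = ∑[ z < Q ℕ.* M ] 𝟙 (represents? (n t) z) * weight (n t)

  -- With F = `gcdSum M`, twice the error term of `weighted-count` is 148 Q x F ≤ K r J F ≤ r J M.
  -- So the represented terms carry at most half of the guaranteed weight, and the unrepresented
  -- ones carry the other half.
  half-unrepresented : ∀ K → 0 ℕ.< r → ι K * gcdSum M ≤ ι M → 148 ℕ.* (Q ℕ.* x) ℕ.≤ K ℕ.* (r ℕ.* J) →
    base ℕ.+ 8 ℕ.* T ℕ.≤ x → (∀ y → x ℕ.< suc y ℕ.* (M ℕ.* M) → r ℕ.* r ℕ.≤ len y) → ι J ≤ ι 2 * unrepresented
  half-unrepresented K 0<r KF≤M bound in-range r²≤ = *-cancelˡ (0<* (0<ι 0<r) (0<ι (SF⇒>0 sfM))) (begin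
    ι r * ι M * ι J
      ≤⟨ ≤-by _ (0≤-diff twice) (solve 2 (λ a b → b := a :+ (a :+ b :- (a :+ a))) refl A (B + B)) ⟩
    B + B
      ≡⟨ trans (solve 3 (λ r g m → r :* (g :* m) :+ r :* (g :* m) := r :* m :* ((con 1ℚ :+ con 1ℚ) :* g)) refl (ι r) unrepresented (ι M))
          (cong (λ t → ι r * ι M * (t * unrepresented)) (sym (trans (ι-suc 1) (cong (λ t → 1ℚ + t) ι-1)))) ⟩
    ι r * ι M * (ι 2 * unrepresented) ∎)
    where
    open ≤-Reasoning
    F A B E : ℚ
    F = gcdSum M
    A = ι r * ι M * ι J
    B = ι r * (unrepresented * ι M)
    E = ι Q * (ι 74 * ι x * F)
    A≤ : A ≤ B + E
    A≤ = ≤-trans (≤-reflexive (solve 3 (λ r m j → r :* m :* j := r :* (j :* m)) refl (ι r) (ι M) (ι J))) (weighted-count in-range r²≤)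
    E+E≤ : E + E ≤ A
    E+E≤ = begin
      E + E
        ≡⟨ solve 4 (λ q c x f → q :* (c :* x :* f) :+ q :* (c :* x :* f) := (c :+ c) :* (q :* x) :* f) refl (ι Q) (ι 74) (ι x) F ⟩
      (ι 74 + ι 74) * (ι Q * ι x) * F
        ≡⟨ cong (_* F) (trans (cong₂ _*_ (sym (ι-+ 74 74)) (sym (ι-* Q x))) (sym (ι-* 148 (Q ℕ.* x)))) ⟩
      ι (148 ℕ.* (Q ℕ.* x)) * F
        ≤⟨ *-monoʳ (gcdSum-nonNeg M) (ι-mono bound) ⟩
      ι (K ℕ.* (r ℕ.* J)) * F
        ≡⟨ trans (cong (_* F) (trans (ι-* K (r ℕ.* J)) (cong (ι K *_) (ι-* r J))))
            (solve 4 (λ k r j f → k :* (r :* j) :* f := r :* j :* (k :* f)) refl (ι K) (ι r) (ι J) F) ⟩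
      ι r * ι J * (ι K * F)
        ≤⟨ *-monoˡ (0≤* (0≤ι r) (0≤ι J)) KF≤M ⟩
      ι r * ι J * ι M
        ≡⟨ solve 3 (λ r j m → r :* j :* m := r :* m :* j) refl (ι r) (ι J) (ι M) ⟩
      A ∎
    twice : A + A ≤ A + (B + B)
    twice = begin
      A + A                  ≤⟨ +-mono-≤ A≤ A≤ ⟩
      B + E + (B + E)        ≡⟨ solve 2 (λ b e → b :+ e :+ (b :+ e) := e :+ e :+ (b :+ b)) refl B E ⟩
      E + E + (B + B)        ≤⟨ +-monoˡ-≤ (B + B) E+E≤ ⟩
      A + (B + B)            ∎

-- Unrepresentable numbers

collect : ∀ {P : ℕ → Set} (P? : ∀ k → Dec (P k)) (n : ℕ → ℕ) → (∀ {s t} → s ℕ.< t → n s ℕ.< n t) → ∀ T →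
  ∃ λ ks → Unique ks × All (λ k → ∃ λ t → t ℕ.< T × k ≡ n t × P k) ks × ι (length ks) ≡ ∑[ t < T ] 𝟙 (P? (n t))
collect P? n mono zero = [] , [] , [] , ι-0
collect P? n mono (suc T) with P? (n T) | collect P? n mono T
... | no  _  | ks , u , all , eq = ks , u , All.map (λ (t , t<T , h) → t , ℕ.m≤n⇒m≤1+n t<T , h) all , trans eq (sym (+-identityʳ _))
... | yes PT | ks , u , all , eq = n T ∷ ks , All.map (λ (t , t<T , k≡ , _) nT≡k → ℕ.<⇒≢ (mono t<T) (sym (trans nT≡k k≡))) all ∷ u ,
        (T , ℕ.≤-refl , refl , PT) ∷ All.map (λ (t , t<T , h) → t , ℕ.m≤n⇒m≤1+n t<T , h) all ,
        trans (ι-suc (length ks)) (trans (+-comm 1ℚ (ι (length ks))) (cong (_+ 1ℚ) eq))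

isqrt : ∀ n → ∃ λ r → r ℕ.* r ℕ.≤ n × n ℕ.< suc r ℕ.* suc r
isqrt zero = 0 , z≤n , s≤s z≤n
isqrt (suc n) with isqrt n
... | r , r²≤n , n< with suc n ℕ.<? suc r ℕ.* suc r
...   | yes h = r , ℕ.m≤n⇒m≤1+n r²≤n , h
...   | no  h = suc r , ℕ.≮⇒≥ h , ℕ.≤-<-trans n< (ℕ.*-mono-< (ℕ.n<1+n (suc r)) (ℕ.n<1+n (suc r)))

square-≤-cancel : ∀ {a b} → a ℕ.* a ℕ.≤ b ℕ.* b → a ℕ.≤ b
square-≤-cancel h = ℕ.≮⇒≥ λ b<a → ℕ.<⇒≱ (ℕ.*-mono-< b<a b<a) h

square≤2^ : ∀ n → (4 ℕ.+ n) ℕ.* (4 ℕ.+ n) ℕ.≤ 2 ^ (4 ℕ.+ n)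
square≤2^ zero    = ℕ.≤-refl
square≤2^ (suc n) = ℕ.≤-trans (ℕ.≤-trans (ℕ.m≤m+n _ (7 ℕ.+ 6 ℕ.* n ℕ.+ n ℕ.* n)) (ℕ.≤-reflexive (form n))) (ℕ.*-monoʳ-≤ 2 (square≤2^ n))
  where
  form : ∀ n → (5 ℕ.+ n) ℕ.* (5 ℕ.+ n) ℕ.+ (7 ℕ.+ 6 ℕ.* n ℕ.+ n ℕ.* n) ≡ 2 ℕ.* ((4 ℕ.+ n) ℕ.* (4 ℕ.+ n))
  form = solve-∀

len²≤ : ∀ y → 4 ℕ.≤ len y → len y ℕ.* len y ℕ.≤ 2 ℕ.* y
len²≤ y 4≤L = at (len y) 4≤L (<len⇒2^≤ y)
  where
  at : ∀ L → 4 ℕ.≤ L → (∀ {i} → i ℕ.< L → 2 ^ i ℕ.≤ y) → L ℕ.* L ℕ.≤ 2 ℕ.* y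
  at (suc (suc (suc (suc n)))) _ h = ℕ.≤-trans (square≤2^ n) (ℕ.*-monoʳ-≤ 2 (h ℕ.≤-refl))
  at 1 (s≤s ()) _
  at 2 (s≤s (s≤s ())) _
  at 3 (s≤s (s≤s (s≤s ()))) _

len-suc : ∀ y → len (suc y) ℕ.≤ suc (len y)
len-suc y = len-≤ (suc y) (suc (len y)) (ℕ.≤-trans (s≤s (n<2^len y))
  (ℕ.≤-trans (ℕ.+-monoˡ-≤ (2 ^ len y) (ℕ.m^n>0 2 (len y))) (ℕ.≤-reflexive (cong (2 ^ len y ℕ.+_) (sym (ℕ.+-identityʳ (2 ^ len y)))))))

<[1+/]* : ∀ a b {{_ : ℕ.NonZero b}} → a ℕ.< suc (a ℕ./ b) ℕ.* b
<[1+/]* a b = subst (ℕ._< suc (a ℕ./ b) ℕ.* b) (sym (ℕ.m≡m%n+[m/n]*n a b)) (ℕ.+-monoˡ-< (a ℕ./ b ℕ.* b) (ℕ.m%n<n a b))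

-- An integer form of the condition: ρ replaces √(log n) and c replaces C. The margin 2 makes c (ρ +
-- 2) large enough for `C√log-≤` when ρ is the integer square root of `len n`.
Unrepresentable : ℕ → ℕ → Set
Unrepresentable c n = ∀ ρ z → ρ ℕ.* ρ ℕ.≤ len n → z ℕ.≤ c ℕ.* (ρ ℕ.+ 2) → ∀ x y → n ≢ x ℕ.* x ℕ.+ y ℕ.* y ℕ.+ z ℕ.* z

-- Sums of two squares divisible by g ∣ M are counted up to 2N / g², at worst up to y = ⌊2N / M²⌋;
-- hence r is the integer square root of `len y`. As M ≤ r, this loses almost nothing against `len`
-- of 2N, see `len-x`.
module _ (c M N a₀ y r K : ℕ) {{M≢0 : ℕ.NonZero M}} (sfM : SF Three M) (KF≤M : ι K * gcdSum M ≤ ι M)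
  (K≡ : K ≡ 9472 ℕ.* (3 ℕ.* c ℕ.+ 1)) (a₀<8 : a₀ ℕ.< 8) (64M≤N : 64 ℕ.* M ℕ.≤ N) (54≤N : 54 ℕ.≤ N)
  (yM²≤2N : y ℕ.* (M ℕ.* M) ℕ.≤ 2 ℕ.* N) (2N<yM² : 2 ℕ.* N ℕ.< suc y ℕ.* (M ℕ.* M))
  (r²≤ : r ℕ.* r ℕ.≤ len y) (<[1+r]² : len y ℕ.< suc r ℕ.* suc r)
  (M≤r : M ℕ.≤ r) (2≤r : 2 ℕ.≤ r) (c≤r : 4 ℕ.* ((3 ℕ.* c ℕ.+ 1) ℕ.* (3 ℕ.* c ℕ.+ 1)) ℕ.≤ r) where

  private
    b : ℕ
    b = 3 ℕ.* c ℕ.+ 1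

    instance
      16M≢0 : ℕ.NonZero (16 ℕ.* M)
      16M≢0 = ℕ.m*n≢0 16 M

    -- The J M terms of difference 8 occupy at most N/2 of the interval up to 2N. Q M exceeds 3 c r,
    -- hence every admissible z. The + 2 in `base` puts the progression at or beyond N + 2.
    J Q base T x : ℕ
    J = N ℕ./ (16 ℕ.* M)
    Q = suc (3 ℕ.* c ℕ.* r ℕ./ M)
    base = 8 ℕ.* (N ℕ./ 8 ℕ.+ 2) ℕ.+ a₀
    T = J ℕ.* M
    x = 2 ℕ.* N

    16T≤N : 16 ℕ.* T ℕ.≤ N
    16T≤N = ℕ.≤-trans (ℕ.≤-reflexive (form J M)) (ℕ.m/n*n≤m N (16 ℕ.* M))
      where
      form : ∀ J M → 16 ℕ.* (J ℕ.* M) ≡ J ℕ.* (16 ℕ.* M)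
      form = solve-∀

    N≤32T : N ℕ.≤ 32 ℕ.* T
    N≤32T = at J 1≤J (<[1+/]* N (16 ℕ.* M))
      where
      1≤J : 1 ℕ.≤ J
      1≤J = ℕ.m≥n⇒m/n>0 (ℕ.≤-trans (ℕ.*-monoˡ-≤ M (ℕ.m≤m+n 16 48)) 64M≤N)
      at : ∀ J → 1 ℕ.≤ J → N ℕ.< suc J ℕ.* (16 ℕ.* M) → N ℕ.≤ 32 ℕ.* (J ℕ.* M)
      at (suc j) _ h = ℕ.≤-trans (ℕ.<⇒≤ h) (ℕ.≤-trans (ℕ.m≤m+n _ (16 ℕ.* (j ℕ.* M))) (ℕ.≤-reflexive (form j M)))
        where
        form : ∀ j M → suc (suc j) ℕ.* (16 ℕ.* M) ℕ.+ 16 ℕ.* (j ℕ.* M) ≡ 32 ℕ.* (suc j ℕ.* M)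
        form = solve-∀

    base≤ : base ℕ.≤ N ℕ.+ 23
    base≤ = ℕ.≤-trans (ℕ.+-mono-≤ (ℕ.≤-trans (ℕ.≤-reflexive (form (N ℕ./ 8))) (ℕ.+-monoˡ-≤ 16 (ℕ.m/n*n≤m N 8))) (ℕ.s≤s⁻¹ a₀<8))
      (ℕ.≤-reflexive (ℕ.+-assoc N 16 7))
      where
      form : ∀ q → 8 ℕ.* (q ℕ.+ 2) ≡ q ℕ.* 8 ℕ.+ 16
      form = solve-∀

    ≤base : N ℕ.+ 2 ℕ.≤ base
    ≤base = ℕ.≤-trans (ℕ.+-monoˡ-≤ 2 (ℕ.<⇒≤ (<[1+/]* N 8))) (ℕ.≤-trans (ℕ.m≤m+n _ (6 ℕ.+ a₀)) (ℕ.≤-reflexive (form (N ℕ./ 8) a₀)))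
      where
      form : ∀ q a → suc q ℕ.* 8 ℕ.+ 2 ℕ.+ (6 ℕ.+ a) ≡ 8 ℕ.* (q ℕ.+ 2) ℕ.+ a
      form = solve-∀

    -- Doubled, the left side is at most 2 (N + 23) + 8 + N = 3N + 54, whence the premise 54 ≤ N.
    in-range+4 : base ℕ.+ 8 ℕ.* T ℕ.+ 4 ℕ.≤ x
    in-range+4 = ℕ.*-cancelˡ-≤ 2 (ℕ.≤-trans (ℕ.≤-reflexive (form base T)) (ℕ.≤-trans
      (ℕ.+-mono-≤ (ℕ.+-monoˡ-≤ 8 (ℕ.*-monoʳ-≤ 2 base≤)) 16T≤N) (ℕ.≤-trans (ℕ.≤-reflexive (form′ N)) (ℕ.≤-trans (ℕ.+-monoʳ-≤ (3 ℕ.* N) 54≤N) (ℕ.≤-reflexive (form″ N))))))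
      where
      form : ∀ b T → 2 ℕ.* (b ℕ.+ 8 ℕ.* T ℕ.+ 4) ≡ 2 ℕ.* b ℕ.+ 8 ℕ.+ 16 ℕ.* T
      form = solve-∀
      form′ : ∀ N → 2 ℕ.* (N ℕ.+ 23) ℕ.+ 8 ℕ.+ N ≡ 3 ℕ.* N ℕ.+ 54
      form′ = solve-∀
      form″ : ∀ N → 3 ℕ.* N ℕ.+ N ≡ 2 ℕ.* (2 ℕ.* N)
      form″ = solve-∀

    QM≤ : Q ℕ.* M ℕ.≤ b ℕ.* r
    QM≤ = ℕ.≤-trans (ℕ.+-mono-≤ M≤r (ℕ.m/n*n≤m (3 ℕ.* c ℕ.* r) M)) (ℕ.≤-reflexive (form c r))
      where
      form : ∀ c r → r ℕ.+ 3 ℕ.* c ℕ.* r ≡ (3 ℕ.* c ℕ.+ 1) ℕ.* r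
      form = solve-∀

    -- 9472 = 148 · 2 · 32, from x = 2N and N ≤ 32 J M.
    bound : 148 ℕ.* (Q ℕ.* x) ℕ.≤ K ℕ.* (r ℕ.* J)
    bound = ℕ.*-cancelʳ-≤ (148 ℕ.* (Q ℕ.* x)) (K ℕ.* (r ℕ.* J)) M (begin
      148 ℕ.* (Q ℕ.* x) ℕ.* M                      ≡⟨ form₁ Q N M ⟩
      296 ℕ.* (Q ℕ.* M ℕ.* N)                      ≤⟨ ℕ.*-monoʳ-≤ 296 (ℕ.*-mono-≤ QM≤ N≤32T) ⟩
      296 ℕ.* (b ℕ.* r ℕ.* (32 ℕ.* (J ℕ.* M)))     ≡⟨ form₂ b r J M ⟩
      9472 ℕ.* b ℕ.* (r ℕ.* J) ℕ.* M               ≡⟨ cong (λ k → k ℕ.* (r ℕ.* J) ℕ.* M) K≡ ⟨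
      K ℕ.* (r ℕ.* J) ℕ.* M                        ∎)
      where
      open ℕ.≤-Reasoning
      form₁ : ∀ Q N M → 148 ℕ.* (Q ℕ.* (2 ℕ.* N)) ℕ.* M ≡ 296 ℕ.* (Q ℕ.* M ℕ.* N)
      form₁ = solve-∀
      form₂ : ∀ b r J M → 296 ℕ.* (b ℕ.* r ℕ.* (32 ℕ.* (J ℕ.* M))) ≡ 9472 ℕ.* b ℕ.* (r ℕ.* J) ℕ.* M
      form₂ = solve-∀

    -- Going from y to 2N costs a factor M² and so 2 len M + 1 bits, of which len M ≤ M ≤ r.
    len-x : len x ℕ.≤ (r ℕ.+ 2) ℕ.* (r ℕ.+ 2)
    len-x = begin
      len x
        ≤⟨ len-mono (ℕ.<⇒≤ 2N<yM²) ⟩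
      len (suc y ℕ.* (M ℕ.* M))
        ≤⟨ ℕ.≤-trans (len-* (suc y) (M ℕ.* M)) (ℕ.+-mono-≤ (len-suc y) (len-* M M)) ⟩
      suc (len y) ℕ.+ (len M ℕ.+ len M)
        ≤⟨ ℕ.+-mono-≤ <[1+r]² (ℕ.+-mono-≤ len-M≤r len-M≤r) ⟩
      suc r ℕ.* suc r ℕ.+ (r ℕ.+ r)
        ≤⟨ ℕ.m≤m+n _ 3 ⟩
      suc r ℕ.* suc r ℕ.+ (r ℕ.+ r) ℕ.+ 3
        ≡⟨ form r ⟩
      (r ℕ.+ 2) ℕ.* (r ℕ.+ 2) ∎
      where
      open ℕ.≤-Reasoning
      len-M≤r : len M ℕ.≤ r
      len-M≤r = ℕ.≤-trans (len-≤-self M) M≤r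
      form : ∀ r → suc r ℕ.* suc r ℕ.+ (r ℕ.+ r) ℕ.+ 3 ≡ (r ℕ.+ 2) ℕ.* (r ℕ.+ 2)
      form = solve-∀

    z≤3cr : ∀ {n ρ z} → n ℕ.≤ x → ρ ℕ.* ρ ℕ.≤ len n → z ℕ.≤ c ℕ.* (ρ ℕ.+ 2) → z ℕ.≤ 3 ℕ.* c ℕ.* r
    z≤3cr {n} {ρ} {z} n≤x ρ²≤ z≤ = begin
      z
        ≤⟨ z≤ ⟩
      c ℕ.* (ρ ℕ.+ 2)
        ≤⟨ ℕ.*-monoʳ-≤ c (ℕ.+-monoˡ-≤ 2 (square-≤-cancel (ℕ.≤-trans ρ²≤ (ℕ.≤-trans (len-mono n≤x) len-x)))) ⟩
      c ℕ.* (r ℕ.+ 2 ℕ.+ 2)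
        ≤⟨ ℕ.*-monoʳ-≤ c (ℕ.+-mono-≤ (ℕ.+-monoʳ-≤ r 2≤r) 2≤r) ⟩
      c ℕ.* (r ℕ.+ r ℕ.+ r)
        ≡⟨ form c r ⟩
      3 ℕ.* c ℕ.* r ∎
      where
      open ℕ.≤-Reasoning
      form : ∀ c r → c ℕ.* (r ℕ.+ r ℕ.+ r) ≡ 3 ℕ.* c ℕ.* r
      form = solve-∀

    -- This keeps k - z² positive. The chain is 4z² ≤ 4b² r² ≤ r · len y ≤ (len y)² ≤ 2y ≤ 4N.
    z²≤N : ∀ {z} → z ℕ.≤ 3 ℕ.* c ℕ.* r → z ℕ.* z ℕ.≤ N
    z²≤N {z} z≤ = ℕ.*-cancelˡ-≤ 4 (begin
      4 ℕ.* (z ℕ.* z)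
        ≤⟨ ℕ.*-monoʳ-≤ 4 (ℕ.*-mono-≤ z≤br z≤br) ⟩
      4 ℕ.* (b ℕ.* r ℕ.* (b ℕ.* r))
        ≡⟨ form b r ⟩
      4 ℕ.* (b ℕ.* b) ℕ.* (r ℕ.* r)
        ≤⟨ ℕ.*-mono-≤ c≤r r²≤ ⟩
      r ℕ.* len y
        ≤⟨ ℕ.*-monoˡ-≤ (len y) (ℕ.≤-trans (ℕ.m≤m*n r r {{ℕ.>-nonZero (ℕ.<⇒≤ 2≤r)}}) r²≤) ⟩
      len y ℕ.* len y
        ≤⟨ len²≤ y (ℕ.≤-trans (ℕ.*-mono-≤ 2≤r 2≤r) r²≤) ⟩
      2 ℕ.* y
        ≤⟨ ℕ.*-monoʳ-≤ 2 (ℕ.≤-trans (ℕ.m≤m*n y (M ℕ.* M) {{ℕ.m*n≢0 M M}}) yM²≤2N) ⟩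
      2 ℕ.* (2 ℕ.* N)
        ≡⟨ ℕ.*-assoc 2 2 N ⟨
      4 ℕ.* N ∎)
      where
      open ℕ.≤-Reasoning
      z≤br : z ℕ.≤ b ℕ.* r
      z≤br = ℕ.≤-trans z≤ (ℕ.*-monoˡ-≤ r (ℕ.m≤m+n (3 ℕ.* c) 1))
      form : ∀ b r → 4 ℕ.* (b ℕ.* r ℕ.* (b ℕ.* r)) ≡ 4 ℕ.* (b ℕ.* b) ℕ.* (r ℕ.* r)
      form = solve-∀

    n : ℕ → ℕ
    n t = base ℕ.+ 8 ℕ.* t

    Bad : ℕ → Set
    Bad = Represented M base J Q x r sfM

    bad? : ∀ k → Dec (Bad k)
    bad? = represented? M base J Q x r sfM

    Good : ℕ → Set
    Good k = N ℕ.+ 2 ℕ.≤ k × k ℕ.+ 4 ℕ.≤ 2 ℕ.* N × k % 8 ≡ a₀ × Unrepresentable c k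

    good : ∀ {k} → (∃ λ t → t ℕ.< T × k ≡ n t × ¬ Bad k) → Good k
    good (t , t<T , refl , ¬bad) = N+2≤ , n+4≤ , residue , unrep
      where
      N+2≤ : N ℕ.+ 2 ℕ.≤ n t
      N+2≤ = ℕ.≤-trans ≤base (ℕ.m≤m+n base (8 ℕ.* t))
      n+4≤ : n t ℕ.+ 4 ℕ.≤ x
      n+4≤ = ℕ.≤-trans (ℕ.+-monoˡ-≤ 4 (ℕ.+-monoʳ-≤ base (ℕ.*-monoʳ-≤ 8 (ℕ.<⇒≤ t<T)))) in-range+4
      residue : n t % 8 ≡ a₀
      residue = trans (cong (_% 8) (form (N ℕ./ 8) a₀ t)) (trans (ℕ.[m+kn]%n≡m%n a₀ (N ℕ./ 8 ℕ.+ 2 ℕ.+ t) 8) (ℕ.m<n⇒m%n≡m a₀<8))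
        where
        form : ∀ q a t → 8 ℕ.* (q ℕ.+ 2) ℕ.+ a ℕ.+ 8 ℕ.* t ≡ a ℕ.+ (q ℕ.+ 2 ℕ.+ t) ℕ.* 8
        form = solve-∀
      unrep : Unrepresentable c (n t)
      unrep ρ z ρ²≤ z≤ u v eq = ¬bad (z , ℕ.≤-<-trans z≤′ (<[1+/]* (3 ℕ.* c ℕ.* r) M) , ℕ.<⇒≤ z²<n , ℕ.m<n⇒0<n∸m z²<n ,
          u , v , trans (cong (ℕ._∸ z ℕ.* z) eq) (ℕ.m+n∸n≡m (u ℕ.* u ℕ.+ v ℕ.* v) (z ℕ.* z)))
        where
        z≤′ : z ℕ.≤ 3 ℕ.* c ℕ.* r
        z≤′ = z≤3cr (ℕ.≤-trans (ℕ.m≤m+n (n t) 4) n+4≤) ρ²≤ z≤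
        z²<n : z ℕ.* z ℕ.< n t
        z²<n = ℕ.<-≤-trans (s≤s (z²≤N z≤′)) (ℕ.≤-trans (ℕ.≤-trans (ℕ.≤-reflexive (ℕ.+-comm 1 N)) (ℕ.+-monoʳ-≤ N (s≤s z≤n))) N+2≤)

  -- At least J / 2 terms are unrepresented, and N ≤ 32 J M; a further factor 2 pays for `suc N` in
  -- place of N.
  many-unrepresentable : ∃ λ ks → Unique ks × All Good ks × suc N ℕ.≤ 128 ℕ.* M ℕ.* length ks
  many-unrepresentable = conclude (collect (λ k → ¬? (bad? k)) n (λ s<t → ℕ.+-monoʳ-< base (ℕ.*-monoʳ-< 8 s<t)) T)
    where
    J≤2G : ι J ≤ ι 2 * unrepresented M base J Q x r sfM
    J≤2G = half-unrepresented M base J Q x r sfM K (ℕ.<⇒≤ 2≤r) KF≤M bound (ℕ.≤-trans (ℕ.m≤m+n _ 4) in-range+4)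
      (λ y′ h → ℕ.≤-trans r²≤ (len-mono (ℕ.s≤s⁻¹ (ℕ.*-cancelʳ-< (M ℕ.* M) y (suc y′) (ℕ.≤-<-trans yM²≤2N h)))))
    conclude : (∃ λ ks → Unique ks × All (λ k → ∃ λ t → t ℕ.< T × k ≡ n t × ¬ Bad k) ks × ι (length ks) ≡ unrepresented M base J Q x r sfM) →
      ∃ λ ks → Unique ks × All Good ks × suc N ℕ.≤ 128 ℕ.* M ℕ.* length ks
    conclude (ks , u , all , eq) = ks , u , All.map good all , (begin
      suc N                                  ≤⟨ ℕ.+-monoˡ-≤ N (ℕ.≤-trans (s≤s z≤n) 54≤N) ⟩
      N ℕ.+ N                                ≤⟨ ℕ.+-mono-≤ N≤32T N≤32T ⟩
      32 ℕ.* T ℕ.+ 32 ℕ.* T                  ≡⟨ form J M ⟩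
      64 ℕ.* M ℕ.* J                         ≤⟨ ℕ.*-monoʳ-≤ (64 ℕ.* M) J≤2len ⟩
      64 ℕ.* M ℕ.* (2 ℕ.* length ks)         ≡⟨ form′ M (length ks) ⟩
      128 ℕ.* M ℕ.* length ks                ∎)
      where
      open ℕ.≤-Reasoning
      J≤2len : J ℕ.≤ 2 ℕ.* length ks
      J≤2len = ι-cancel (≤-trans J≤2G (≤-reflexive (trans (cong (ι 2 *_) (sym eq)) (sym (ι-* 2 (length ks))))))
      form : ∀ J M → 32 ℕ.* (J ℕ.* M) ℕ.+ 32 ℕ.* (J ℕ.* M) ≡ 64 ℕ.* M ℕ.* J
      form = solve-∀
      form′ : ∀ M l → 64 ℕ.* M ℕ.* (2 ℕ.* l) ≡ 128 ℕ.* M ℕ.* l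
      form′ = solve-∀

-- Real numbers

open import Data.Integer using (∣_∣)
open ℝ

Suitable : ℕ → ℕ → ℕ → ℕ → Set
Suitable c a₀ N k = N ℕ.+ 2 ℕ.≤ k × k ℕ.+ 4 ℕ.≤ 2 ℕ.* N × k % 8 ≡ a₀ × Unrepresentable c k

Density : ℕ → Set
Density c = ∃ λ D → 0 ℕ.< D × ∃ λ N₀ → ∀ N → N₀ ℕ.≤ N → ∀ a₀ → a₀ ℕ.< 8 →
  ∃ λ ks → Unique ks × All (Suitable c a₀ N) ks × suc N ℕ.≤ D ℕ.* length ks

unrepresentable-density : ∀ c → Density c
unrepresentable-density c = at (9472 ℕ.* b) refl
  where
  b : ℕ
  b = 3 ℕ.* c ℕ.+ 1
  for-modulus : ∀ K → K ≡ 9472 ℕ.* b → (∃ λ M → SF Three M × ι K * gcdSum M ≤ ι M) → Density c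
  for-modulus K K≡ (M , sfM , KF≤M) = 128 ℕ.* M , ℕ.*-mono-< {0} {128} (s≤s z≤n) (SF⇒>0 sfM) , N₀ , for-N
    where
    instance
      M≢0 : ℕ.NonZero M
      M≢0 = ℕ.>-nonZero (SF⇒>0 sfM)
      M²≢0 : ℕ.NonZero (M ℕ.* M)
      M²≢0 = ℕ.m*n≢0 M M
    -- r₀ collects the three lower bounds demanded of r, and N ≥ N₀ gives y ≥ 2^(r₀²), so that
    -- `len y` > r₀² and r ≥ r₀.
    r₀ N₀ : ℕ
    r₀ = M ℕ.+ 2 ℕ.+ 4 ℕ.* (b ℕ.* b)
    N₀ = 2 ^ (r₀ ℕ.* r₀) ℕ.* (M ℕ.* M) ℕ.+ (64 ℕ.* M ℕ.+ 54)
    for-N : ∀ N → N₀ ℕ.≤ N → ∀ a₀ → a₀ ℕ.< 8 → ∃ λ ks → Unique ks × All (Suitable c a₀ N) ks × suc N ℕ.≤ 128 ℕ.* M ℕ.* length ks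
    for-N N N₀≤N a₀ a₀<8 = for-root (isqrt (len y))
      where
      y : ℕ
      y = 2 ℕ.* N ℕ./ (M ℕ.* M)
      large : 64 ℕ.* M ℕ.+ 54 ℕ.≤ N
      large = ℕ.≤-trans (ℕ.m≤n+m _ (2 ^ (r₀ ℕ.* r₀) ℕ.* (M ℕ.* M))) N₀≤N
      2^≤y : 2 ^ (r₀ ℕ.* r₀) ℕ.≤ y
      2^≤y = subst (ℕ._≤ y) (ℕ.m*n/n≡m (2 ^ (r₀ ℕ.* r₀)) (M ℕ.* M)) (ℕ./-monoˡ-≤ (M ℕ.* M)
        (ℕ.≤-trans (ℕ.≤-trans (ℕ.m≤m+n _ (64 ℕ.* M ℕ.+ 54)) N₀≤N) (ℕ.m≤m+n N (N ℕ.+ 0))))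
      for-root : (∃ λ r → r ℕ.* r ℕ.≤ len y × len y ℕ.< suc r ℕ.* suc r) →
        ∃ λ ks → Unique ks × All (Suitable c a₀ N) ks × suc N ℕ.≤ 128 ℕ.* M ℕ.* length ks
      for-root (r , r²≤ , <[1+r]²) = many-unrepresentable c M N a₀ y r K sfM KF≤M K≡ a₀<8
        (ℕ.≤-trans (ℕ.m≤m+n _ 54) large) (ℕ.≤-trans (ℕ.m≤n+m 54 (64 ℕ.* M)) large)
        (ℕ.m/n*n≤m (2 ℕ.* N) (M ℕ.* M)) (<[1+/]* (2 ℕ.* N) (M ℕ.* M)) r²≤ <[1+r]²
        (ℕ.≤-trans (ℕ.≤-trans (ℕ.m≤m+n M 2) (ℕ.m≤m+n (M ℕ.+ 2) (4 ℕ.* (b ℕ.* b)))) r₀≤r)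
        (ℕ.≤-trans (ℕ.≤-trans (ℕ.m≤n+m 2 M) (ℕ.m≤m+n (M ℕ.+ 2) (4 ℕ.* (b ℕ.* b)))) r₀≤r)
        (ℕ.≤-trans (ℕ.m≤n+m (4 ℕ.* (b ℕ.* b)) (M ℕ.+ 2)) r₀≤r)
        where
        r₀≤r : r₀ ℕ.≤ r
        r₀≤r = ℕ.≮⇒≥ λ r<r₀ → ℕ.<⇒≱ <[1+r]² (ℕ.≤-trans (ℕ.*-mono-≤ r<r₀ r<r₀) (ℕ.<⇒≤ (2^≤⇒<len y (r₀ ℕ.* r₀) 2^≤y)))
  at : ∀ K → K ≡ 9472 ℕ.* b → Density c
  at zero    K≡ = contradiction (trans K≡ (trans (ℕ.*-distribˡ-+ 9472 (3 ℕ.* c) 1) (ℕ.+-comm (9472 ℕ.* (3 ℕ.* c)) 9472))) λ ()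
  at (suc K) K≡ = for-modulus (suc K) K≡ (gcdSum-small (suc K) (s≤s z≤n))

recipSum≡∑ : ∀ a k → recipSum a k ≡ ∑[ i < k ] inv (suc (a ℕ.+ i))
recipSum≡∑ a zero    = refl
recipSum≡∑ a (suc k) = trans (cong (recipSum a) (ℕ.+-comm 1 k)) (trans (recipSum-+ a k 1)
  (cong₂ _+_ (recipSum≡∑ a k) (trans (+-identityʳ _) (sym (inv-def (a ℕ.+ k))))))

-- With mesh 1 the Riemann sum is 1 + 1/2 + ... + 1/(n - 1), which the dyadic bound `H-upper`
-- covers.
upperSum≤len : ∀ n → upperSum n 0 ≤ ι (len n)
upperSum≤len n = ≤-trans (≤-reflexive (trans (recipSum≡∑ 0 k) (trans (sym (+-identityˡ _)) (trans (cong (_+ (∑[ i < k ] inv (suc i))) (sym inv-0)) (sym (∑-front k inv))))))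
  (≤-trans (∑-range inv 0≤inv (k<2^ n)) (H-upper (len n)))
  where
  k : ℕ
  k = (n ℕ.∸ 1) ℕ.* 1
  k<2^ : ∀ n → suc ((n ℕ.∸ 1) ℕ.* 1) ℕ.≤ 2 ^ len n
  k<2^ zero    = s≤s z≤n
  k<2^ (suc n) = ℕ.≤-trans (ℕ.≤-reflexive (cong suc (ℕ.*-identityʳ n))) (ℕ.<⇒≤ (n<2^len (suc n)))

-- The upper cut of C √(log n) contains every q > c (ρ + 2), because log n ≤ len n < (ρ + 1)².
C√log-≤ : ∀ C c n ρ z → fromℕ 0 <ᴿ C → U C (ι c) → len n ℕ.< suc ρ ℕ.* suc ρ → fromℕ z ≤ᴿ C *ᴿ √ (log n) → z ℕ.≤ c ℕ.* (ρ ℕ.+ 2)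
C√log-≤ C c n ρ z (a , 0<a , La) Uc n< z≤ = ℕ.≮⇒≥ λ c<z → absurd (<-dense (ι-mono-< c<z))
  where
  d : ℚ
  d = ι (ρ ℕ.+ 2)
  Ud : U (√ (log n)) d
  Ud = ι (suc ρ) , ι-mono-< (ℕ.≤-reflexive (ℕ.+-comm 2 ρ)) , 0≤ι (suc ρ) , 0 ,
    ≤-<-trans (upperSum≤len n) (<-≤-trans (ι-mono-< n<) (≤-reflexive (ι-* (suc ρ) (suc ρ))))
  negate : ∀ {t} → 0ℚ ≤ t → t * (- 1ℚ) ≤ 0ℚ
  negate {t} 0≤t = ≤-by t 0≤t (solve 1 (λ t → con 0ℚ := t :* (:- con 1ℚ) :+ t) refl t)
  absurd : (∃ λ q → ι (c ℕ.* (ρ ℕ.+ 2)) < q × q < ι z) → ⊥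
  -- The box is [a, c] × [-1, d], where -1 is the lower bound that `L-inh` provides for the root.
  -- The two corners at -1 are at most 0 and hence below q.
  absurd (q , cd<q , q<z) = mul-disjoint C (√ (log n)) (z≤ q (subst (q <_) (ι-def z) q<z))
    (mulU {a = a} {b = ι c} {c = - 1ℚ} {d = d} La Uc (proj₂ (L-inh (√ (log n)))) Ud
      (≤-<-trans (negate (<⇒≤ 0<a)) 0<q)
      (≤-<-trans (*-monoʳ (0≤ι (ρ ℕ.+ 2)) (<⇒≤ (L<U C La Uc))) bd<q)
      (≤-<-trans (negate (0≤ι c)) 0<q)
      bd<q)
    where
    bd<q : ι c * d < q
    bd<q = subst (_< q) (ι-* c (ρ ℕ.+ 2)) cd<q
    0<q : 0ℚ < q
    0<q = ≤-<-trans (0≤ι (c ℕ.* (ρ ℕ.+ 2))) cd<q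

ι-upper : ∀ x → ∃ λ k → U x (ι k)
ι-upper x = let u , Uu = U-inh x in ℤ.∣ ↥ u ∣ , subst (U x) (sym (ι-def ℤ.∣ ↥ u ∣)) (U-closed≤ x (≤-fromℕ u) Uu)

≤ᴿ⇒L : ∀ x {m n} → m ℕ.< n → fromℕ n ≤ᴿ x → L x (ι m)
≤ᴿ⇒L x {m} {n} m<n n≤x = n≤x (ι m) (subst (ι m <_) (ι-def n) (ι-mono-< m<n))

-- Walk down from an upper bound, asking each time whether j < x or x < j + 1. Locatedness decides
-- only such overlapping alternatives, so the bracket has width 2.
integer-bracket : ∀ x → L x (ι 1) → ∃ λ N → L x (ι N) × U x (ι (2 ℕ.+ N))
integer-bracket x L1 = let k , Uk = ι-upper x in go k Uk
  where
  go : ∀ k → U x (ι k) → ∃ λ N → L x (ι N) × U x (ι (2 ℕ.+ N))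
  go zero          Uk = ⊥-elim (disjoint x L1 (U-closed≤ x (ι-mono z≤n) Uk))
  go (suc zero)    Uk = ⊥-elim (disjoint x L1 Uk)
  go (suc (suc j)) Uk = [ (λ Lj → j , Lj , Uk) , go (suc j) ]′ (located x (ι-mono-< (ℕ.n<1+n j)))

square-abs : ∀ i → i ℤ.* i ≡ + (∣ i ∣ ℕ.* ∣ i ∣)
square-abs (+ k)    = sym (ℤ.pos-* k k)
square-abs -[1+ k ] = refl

-- From N < X < N + 2 and suitability for N + 1: n ≥ N + 3 > X and n ≤ 2N - 2 < 2X. The margins in
-- `Suitable` are chosen for this bracket of width 2.
Suitable⇒𝓔 : ∀ C c a₀ X N n → fromℕ 0 <ᴿ C → U C (ι c) → L X (ι N) → U X (ι (2 ℕ.+ N)) → Suitable c a₀ (suc N) n → 𝓔 C a₀ X n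
Suitable⇒𝓔 C c a₀ X N n 0<C Uc LN UN (N< , n≤ , residue , unrep) = X<n , n≤2X , residue , not-represented
  where
  X<n : X <ᴿ fromℕ n
  X<n = ι (2 ℕ.+ N) , UN , subst (ι (2 ℕ.+ N) <_) (ι-def n) (ι-mono-< (subst (ℕ._≤ n) (cong suc (ℕ.+-comm N 2)) N<))
  n+2≤2N : n ℕ.+ 2 ℕ.≤ 2 ℕ.* N
  n+2≤2N = ℕ.+-cancelʳ-≤ 2 (n ℕ.+ 2) (2 ℕ.* N) (ℕ.≤-trans (ℕ.≤-reflexive (ℕ.+-assoc n 2 2)) (ℕ.≤-trans n≤ (ℕ.≤-reflexive (form N))))
    where
    form : ∀ N → 2 ℕ.* suc N ≡ 2 ℕ.* N ℕ.+ 2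
    form = solve-∀
  0<N : 0 ℕ.< N
  0<N = ℕ.*-cancelˡ-< 2 0 N (ℕ.<-≤-trans (s≤s z≤n) (ℕ.≤-trans (ℕ.m≤n+m 2 n) n+2≤2N))
  n≤2X : fromℕ n ≤ᴿ fromℕ 2 *ᴿ X
  -- The lower cut of 2 is strict, so 2 - 1/N serves as left end. The least corner is then (2 - 1/N)
  -- N = 2N - 1, which is at least n and so above q.
  n≤2X q q<n = mulL {a = a} {b = ι 3} {c = ι N} {d = ι (2 ℕ.+ N)} (subst (a <_) (ι-def 2) a<2) (subst (_< ι 3) (ι-def 2) (ι-mono-< ℕ.≤-refl)) LN UN
      q<ac (<-≤-trans q<ac (*-monoˡ 0≤a N≤)) (<-≤-trans q<ac (*-monoʳ (0≤ι N) a≤3))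
      (<-≤-trans q<ac (*-mono-nonNeg 0≤a (0≤ι N) a≤3 N≤))
    where
    a : ℚ
    a = ι 2 - inv N
    a<2 : a < ι 2
    a<2 = <-by (inv N) (0<inv 0<N) (solve 2 (λ t v → t := t :- v :+ v) refl (ι 2) (inv N))
    a≤3 : a ≤ ι 3
    a≤3 = ≤-trans (<⇒≤ a<2) (ι-mono (ℕ.n≤1+n 2))
    0≤a : 0ℚ ≤ a
    0≤a = 0≤-diff (≤-trans (inv-anti (s≤s z≤n) 0<N) (≤-trans (≤-reflexive (trans inv-1 (sym ι-1))) (ι-mono (ℕ.n≤1+n 1))))
    N≤ : ι N ≤ ι (2 ℕ.+ N)
    N≤ = ι-mono (ℕ.m≤n+m N 2)
    ac≡ : a * ι N ≡ ι (2 ℕ.* N) - 1ℚ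
    ac≡ = trans (solve 3 (λ t v n → (t :- v) :* n := t :* n :- n :* v) refl (ι 2) (inv N) (ι N))
      (cong₂ (λ s t → s - t) (sym (ι-* 2 N)) (ι*inv 0<N))
    q<ac : q < a * ι N
    q<ac = <-≤-trans (subst (q <_) (sym (ι-def n)) q<n) (subst (ι n ≤_) (sym ac≡)
      (≤-by (ι (2 ℕ.* N) - ι (suc n)) (0≤-diff (ι-mono (ℕ.≤-trans (ℕ.≤-trans (ℕ.n≤1+n (suc n)) (ℕ.≤-reflexive (ℕ.+-comm 2 n))) n+2≤2N)))
        (trans (solve 2 (λ t n → t :- con 1ℚ := n :+ (t :- (con 1ℚ :+ n))) refl (ι (2 ℕ.* N)) (ι n)) (cong (λ s → ι n + (ι (2 ℕ.* N) - s)) (sym (ι-suc n))))))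
  not-represented : ∀ (x y z : ℤ) → fromℕ ∣ z ∣ ≤ᴿ C *ᴿ √ (log n) → + n ≢ x ℤ.* x ℤ.+ y ℤ.* y ℤ.+ z ℤ.* z
  not-represented x y z z≤ eq = let ρ , ρ²≤ , <[1+ρ]² = isqrt (len n) in
    unrep ρ (∣ z ∣) ρ²≤ (C√log-≤ C c n ρ (∣ z ∣) 0<C Uc <[1+ρ]² z≤) (∣ x ∣) (∣ y ∣)
      (ℤ.+-injective (trans eq (cong₂ ℤ._+_ (cong₂ ℤ._+_ (square-abs x) (square-abs y)) (square-abs z))))

-- A bound at the four corners holds throughout the box, in particular at (1/D, c) with c < X < N.
-- Hence q < c/D ≤ N/D ≤ l.
product-≤ : ∀ D X l N → 0 ℕ.< D → U X (ι N) → N ℕ.≤ D ℕ.* l → fromℚ (inv D) *ᴿ X ≤ᴿ fromℕ l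
product-≤ D X l N 0<D UN N≤Dl q (mulL {c = c} La Ub Lc Ud ac ad bc bd) = subst (q <_) (ι-def l) (<-≤-trans
  (box< (<⇒≤ La) (<⇒≤ Ub) ≤-refl (<⇒≤ (L<U X Lc Ud)) ac ad bc bd) (begin
    inv D * c                ≤⟨ *-monoˡ (0≤inv D) (<⇒≤ (L<U X Lc UN)) ⟩
    inv D * ι N              ≤⟨ *-monoˡ (0≤inv D) (≤-trans (ι-mono N≤Dl) (≤-reflexive (ι-* D l))) ⟩
    inv D * (ι D * ι l)      ≡⟨ solve 3 (λ v d l → v :* (d :* l) := d :* v :* l) refl (inv D) (ι D) (ι l) ⟩
    ι D * inv D * ι l        ≡⟨ trans (cong (_* ι l) (ι*inv 0<D)) (*-identityˡ (ι l)) ⟩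
    ι l                      ∎))
  where open ≤-Reasoning

∈⇒<8 : ∀ {a₀} → a₀ ∈ 1 ∷ 2 ∷ 3 ∷ 5 ∷ 6 ∷ [] → a₀ ℕ.< 8
∈⇒<8 = All.lookup {P = ℕ._< 8} (ℕ.m≤m+n 2 6 ∷ ℕ.m≤m+n 3 5 ∷ ℕ.m≤m+n 4 4 ∷ ℕ.m≤m+n 6 2 ∷ ℕ.m≤m+n 7 1 ∷ [])

theorem1p3 : ∀ (C : ℝ) → fromℕ 0 <ᴿ C →
    ∃ λ (δ : ℝ) → fromℕ 0 <ᴿ δ ×
    (∀ a₀ → a₀ ∈ 1 ∷ 2 ∷ 3 ∷ 5 ∷ 6 ∷ [] →
    ∃ λ (X₀ : ℝ) → ∀ (X : ℝ) → fromℕ 3 ≤ᴿ X → X₀ ≤ᴿ X →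
    # 𝓔 C a₀ X ≥ (δ *ᴿ X))
theorem1p3 C 0<C = bounded-by (ι-upper C)
  where
  Goal : Set₁
  Goal = ∃ λ (δ : ℝ) → fromℕ 0 <ᴿ δ × (∀ a₀ → a₀ ∈ 1 ∷ 2 ∷ 3 ∷ 5 ∷ 6 ∷ [] →
    ∃ λ (X₀ : ℝ) → ∀ (X : ℝ) → fromℕ 3 ≤ᴿ X → X₀ ≤ᴿ X → # 𝓔 C a₀ X ≥ (δ *ᴿ X))
  with-density : ∀ c → U C (ι c) → Density c → Goal
  with-density c Uc (D , 0<D , N₀ , density) = fromℚ (inv D) , <-dense (0<inv 0<D) , λ a₀ a₀∈ → fromℕ (2 ℕ.+ N₀) , λ X 3≤X X₀≤X →
    let N , LN , UN = integer-bracket X (≤ᴿ⇒L X {1} {3} (s≤s (s≤s z≤n)) 3≤X)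
        -- N + 2 > X ≥ 2 + N₀, so N < N₀ is impossible; this is why X₀ is 2 + N₀.
        N₀≤N = ℕ.≮⇒≥ λ N<N₀ → disjoint X (≤ᴿ⇒L X {n = 2 ℕ.+ N₀} (s≤s (s≤s N<N₀)) X₀≤X) UN
        ks , unique , suitable , size = density (suc N) (ℕ.m≤n⇒m≤1+n N₀≤N) a₀ (∈⇒<8 a₀∈)
    in ks , unique , All.map (Suitable⇒𝓔 C c a₀ X N _ 0<C Uc LN UN) suitable , product-≤ D X (length ks) (2 ℕ.+ N) 0<D UN size
  bounded-by : (∃ λ c → U C (ι c)) → Goal
  bounded-by (c , Uc) = with-density c Uc (unrepresentable-density c)
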